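{- Let $p=p(n)\in[0,1]$ be such that $\limsup_{n\to\infty}p(n)<1/2$. Then, asymptotically almost surely (i.e., with probability tending to $1$ as $n\to\infty$), every orientation of $G\sim G(n,p)$ contains a Sullivan vertex.
   Context: $G(n,p)$ denotes the binomial random graph on $n$ vertices in which each possible edge is present independently with probability $p$. For a digraph $D$ and $v\in V(D)$: $N^+(v)=\{w\in V(D)\setminus\{v\}: vw\in E(D)\}$ is the outneighbourhood, $N^-(v)=\{w\in V(D)\setminus\{v\}: wv\in E(D)\}$ is the inneighbourhood, and $N_2^+(v)=\{w\in V(D)\setminus(\{v\}\cup N^+(v)): \text{there is an edge from some vertex of } N^+(v)\text{ to } w\}$ is the second outneighbourhood. A vertex $v$ is a Sullivan vertex if $|N_2^+(v)|\ge |N^-(v)|$.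
   Formalization: The edge probabilities p(n) are taken to be rational numbers in [0,1] rather than arbitrary real numbers. -}

module Defs where

open import Data.Bool using (Bool; true; false; not; _∧_; _∨_)
open import Data.Nat using (ℕ; zero; suc)
open import Data.Fin using (Fin; zero; suc; _≟_)
open import Data.Fin.Subset using (Subset; ∣_∣)
open import Data.Vec using (Vec; []; _∷_; lookup; tabulate)
open import Data.List using (List; [_]; map; concatMap; foldr; allFin) renaming (_∷_ to _∷ₗ_; [] to []ₗ)
open import Data.Bool.ListAction using (any)
open import Data.Unit using (⊤; tt)
open import Data.Product using (_×_; _,_)
open import Data.Sum using (_⊎_)
open import Data.Rational using (ℚ; 0ℚ; 1ℚ; _*_; _+_; _-_; _≤_)
open import Relation.Nullary using (¬_)
open import Relation.Nullary.Decidable using (⌊_⌋)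
open import Relation.Binary.PropositionalEquality using (_≡_)

-- Simple graphs on vertex set Fin n.
-- A graph on suc n vertices = a graph on the vertices (suc i) together
-- with the row of adjacencies of the new vertex `zero` to the old ones.

Graph : ℕ → Set
Graph zero    = ⊤
Graph (suc n) = Graph n × Vec Bool n

adj : ∀ {n} → Graph n → Fin n → Fin n → Bool
adj {suc n} (g , r) zero    zero    = false
adj {suc n} (g , r) zero    (suc j) = lookup r j
adj {suc n} (g , r) (suc i) zero    = lookup r i
adj {suc n} (g , r) (suc i) (suc j) = adj g i j

allVecBool : (m : ℕ) → List (Vec Bool m)
allVecBool zero    = [ [] ]
allVecBool (suc m) = concatMap (λ v → (true ∷ v) ∷ₗ (false ∷ v) ∷ₗ []ₗ) (allVecBool m)

allGraphs : (n : ℕ) → List (Graph n)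
allGraphs zero    = [ tt ]
allGraphs (suc n) = concatMap (λ g → map (λ r → (g , r)) (allVecBool n)) (allGraphs n)

rowWeight : ℚ → ∀ {m} → Vec Bool m → ℚ
rowWeight p []          = 1ℚ
rowWeight p (true ∷ r)  = p * rowWeight p r
rowWeight p (false ∷ r) = (1ℚ - p) * rowWeight p r

weight : ℚ → ∀ {n} → Graph n → ℚ
weight p {zero}  tt      = 1ℚ
weight p {suc n} (g , r) = weight p g * rowWeight p r

indicator : Bool → ℚ
indicator true  = 1ℚ
indicator false = 0ℚ

sumℚ : List ℚ → ℚ
sumℚ = foldr _+_ 0ℚ

probOf : ℚ → (n : ℕ) → (Graph n → Bool) → ℚ
probOf p n f = sumℚ (map (λ g → weight p g * indicator (f g)) (allGraphs n))

Digraph : ℕ → Set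
Digraph n = Fin n → Fin n → Bool

IsOrientation : ∀ {n} → Graph n → Digraph n → Set
IsOrientation {n} G D = ∀ (i j : Fin n) →
  ((adj G i j ≡ true → (D i j ≡ true ⊎ D j i ≡ true) × ¬ (D i j ≡ true × D j i ≡ true))
  × (adj G i j ≡ false → D i j ≡ false))

neq : ∀ {n} → Fin n → Fin n → Bool
neq i j = not ⌊ i ≟ j ⌋

Nout : ∀ {n} → Digraph n → Fin n → Subset n
Nout D v = tabulate (λ w → neq w v ∧ D v w)

Nin : ∀ {n} → Digraph n → Fin n → Subset n
Nin D v = tabulate (λ w → neq w v ∧ D w v)

Nout2 : ∀ {n} → Digraph n → Fin n → Subset n
Nout2 {n} D v = tabulate (λ w →
  neq w v ∧ not (lookup (Nout D v) w) ∧ any (λ u → lookup (Nout D v) u ∧ D u w) (allFin n))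

IsSullivan : ∀ {n} → Digraph n → Fin n → Set
IsSullivan D v = ∣ Nin D v ∣ Data.Nat.≤ ∣ Nout2 D v ∣

EveryOrientationHasSullivan : ∀ {n} → Graph n → Set
EveryOrientationHasSullivan {n} G =
  ∀ (D : Digraph n) → IsOrientation G D → Data.Product.∃ (λ (v : Fin n) → IsSullivan D v)

{-# OPTIONS --safe #-}
module Submission where

-- Suppose an orientation has no Sullivan vertex, so |N₂⁺(v)| < d⁻(v) for every v. Count directed 2-paths
-- v → u → w: there are Q = ∑ d⁺ d⁻ of them, and w always lies in N⁺(v) ∪ N₂⁺(v). Write R = ∑ (d⁺)².
--
-- If p is bounded below, the 4-cycle count of the centred adjacency matrix bounds its cut norm, hence
-- up to o(n³) we have Q ≤ ½ p R + p Q (edges inside N⁺(v), resp. from N⁺(v) to N₂⁺(v)),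
-- Q + R = ½ p² n³ (all degrees together), and R ≤ ⅓ p² n³ (Landau-type bound: any s vertices
-- span about p s² / 2 edges, so the outdegrees cannot be too unequal). These are contradictory when p < ½.
--
-- If p is small but n p is large, codegrees alone give Q = o(n³ p²), because w is reached through at most
-- codegree(v, w) vertices; on the other hand every 2-colouring of G has of order n² p monochromatic edges,
-- and colouring the vertices by whether d⁺ ≤ d⁻ turns this into Q ≥ (∑ min(d⁺, d⁻))² / n, of order n³ p².
--
-- If n p is bounded, there is an isolated vertex, by the second moment method.

open import Defs renaming (indicator to ι)
open import Algebra.Bundles using (CommutativeRing)
import Algebra.Properties.Semiring.Exp
import Algebra.Properties.Semiring.Mult
import Algebra.Properties.Semiring.Sum
open import Data.Bool using (Bool; true; false; not; _∧_; if_then_else_)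
import Data.Bool.Properties as Bool
open import Data.Bool.ListAction using (any)
open import Data.Empty using (⊥; ⊥-elim)
open import Data.Fin using (Fin; zero; suc; toℕ)
import Data.Fin.Properties as Fin
open import Data.Fin.Subset using (∣_∣)
open import Data.Fin.Subset.Properties using (∣p∣≤n)
open import Data.Integer using (-[1+_])
import Data.Integer as ℤ
import Data.Integer.Properties as ℤ
open import Data.List using (List; map; concatMap; _++_; allFin) renaming (_∷_ to _∷ₗ_; [] to []ₗ)
open import Data.List.Membership.Propositional using (_∈_)
open import Data.List.Membership.Propositional.Properties using (∈-allFin)
import Data.List.Properties as List
open import Data.List.Relation.Unary.Any using (here; there)
open import Data.Nat using (ℕ; zero; suc) renaming (_≤_ to _≤ℕ_)
import Data.Nat as ℕ
import Data.Nat.DivMod as ℕ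
import Data.Nat.Properties as ℕ
open import Data.Nat.Tactic.RingSolver using () renaming (solve-∀ to ℕ-solve-∀)
open import Data.Product using (_×_; _,_; proj₁; proj₂; ∃-syntax)
open import Data.Rational using (ℚ; mkℚ; 0ℚ; 1ℚ; ½; _+_; _*_; _-_; -_; _/_; _⊔_; _≤_; _<_; *≤*; toℚᵘ; positive; nonNegative)
open import Data.Rational.Properties
import Data.Rational.Unnormalised.Properties as ℚᵘ
import Data.Rational.Unnormalised as ℚᵘ
open import Data.Sum using (_⊎_; inj₁; inj₂)
open import Data.Unit using (tt)
open import Data.Vec using (Vec; []; _∷_; lookup; tabulate; _[_]≔_)
import Data.Vec.Properties as Vec
open import Function using (_∘_)
open import Level using (0ℓ)
open import Relation.Binary.PropositionalEquality
open import Relation.Nullary using (¬_; Dec; yes; no; contradiction)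
open import Relation.Nullary.Decidable using (⌊_⌋; dec⇒maybe)
open import Tactic.RingSolver using (solve; solve-∀)
open import Tactic.RingSolver.Core.AlmostCommutativeRing using (AlmostCommutativeRing; fromCommutativeRing)

-- All estimates stay in the rationals, without real exponentials or roots, so no Chernoff bound is
-- used. Each regime rests instead on a single Markov inequality for one nonnegative statistic of G;
-- once that statistic is below its threshold, the absence of a Sullivan vertex is refuted
-- deterministically, for all orientations at once. The statistics are `spread`, the weighted sum
-- `moment G + T * colouring G`, and the squared deviation of `isolatedCount`. The dense
-- contradiction is tight at p = ½: in units of n³, R ≤ p²/3 and Q + R = p²/2 give Q ≥ p²/6, and
-- then (1 - p) Q ≤ p R / 2 reads 1 - p ≤ p. The discrepancy errors therefore have to be small
-- compared with the gap ½ - p. In the sparse regime the bound on the failure probability does not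
-- shrink with n while the range of p is fixed. The range K / n ≤ p ≤ p₀ is made to depend on ε
-- instead, and the other two regimes accept any K and any p₀ > 0.

module Sum = Algebra.Properties.Semiring.Sum (CommutativeRing.semiring +-*-commutativeRing)
open Algebra.Properties.Semiring.Exp (CommutativeRing.semiring +-*-commutativeRing)
module Mult = Algebra.Properties.Semiring.Mult (CommutativeRing.semiring +-*-commutativeRing)

-- Rational arithmetic and finite sums

ℚ-ring : AlmostCommutativeRing 0ℓ 0ℓ
ℚ-ring = fromCommutativeRing +-*-commutativeRing (λ x → dec⇒maybe (0ℚ ≟ x))

≤-by : ∀ {x y} d → 0ℚ ≤ d → y ≡ x + d → x ≤ y
≤-by {x} d 0≤d refl = ≤-trans (≤-reflexive (sym (+-identityʳ x))) (+-monoʳ-≤ x 0≤d)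

0≤y-x : ∀ {x y} → x ≤ y → 0ℚ ≤ y - x
0≤y-x {x} {y} x≤y = ≤-trans (≤-reflexive (sym (+-inverseʳ x))) (+-monoˡ-≤ (- x) x≤y)

0≤+ : ∀ {x y} → 0ℚ ≤ x → 0ℚ ≤ y → 0ℚ ≤ x + y
0≤+ 0≤x 0≤y = +-mono-≤ 0≤x 0≤y

0≤* : ∀ {x y} → 0ℚ ≤ x → 0ℚ ≤ y → 0ℚ ≤ x * y
0≤* {x} {y} 0≤x 0≤y = ≤-trans (≤-reflexive (sym (*-zeroˡ y))) (*-monoʳ-≤-nonNeg y {{nonNegative 0≤y}} 0≤x)

0<* : ∀ {x y} → 0ℚ < x → 0ℚ < y → 0ℚ < x * y
0<* {x} {y} 0<x 0<y = ≤-<-trans (≤-reflexive (sym (*-zeroˡ y))) (*-monoˡ-<-pos y {{positive 0<y}} 0<x)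

*-monoˡ : ∀ {x y z} → 0ℚ ≤ z → x ≤ y → z * x ≤ z * y
*-monoˡ {z = z} 0≤z = *-monoˡ-≤-nonNeg z {{nonNegative 0≤z}}

*-monoʳ : ∀ {x y z} → 0ℚ ≤ z → x ≤ y → x * z ≤ y * z
*-monoʳ {z = z} 0≤z = *-monoʳ-≤-nonNeg z {{nonNegative 0≤z}}

*-mono : ∀ {x y z w} → 0ℚ ≤ x → 0ℚ ≤ w → x ≤ y → z ≤ w → x * z ≤ y * w
*-mono 0≤x 0≤w x≤y z≤w = ≤-trans (*-monoˡ 0≤x z≤w) (*-monoʳ 0≤w x≤y)

0≤x² : ∀ x → 0ℚ ≤ x * x
0≤x² x with ≤-total 0ℚ x
... | inj₁ 0≤x = 0≤* 0≤x 0≤x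
... | inj₂ x≤0 = subst (0ℚ ≤_) (neg-square x) (0≤* (neg-antimono-≤ x≤0) (neg-antimono-≤ x≤0))
  where
  neg-square : ∀ x → (- x) * (- x) ≡ x * x
  neg-square = solve-∀ ℚ-ring

square-cancel-≤ : ∀ {x y} → 0ℚ ≤ y → x * x ≤ y * y → x ≤ y
square-cancel-≤ {x} {y} 0≤y x²≤y² with ≤-total x y
... | inj₁ x≤y = x≤y
... | inj₂ y≤x with x ≤? y
...   | yes x≤y = x≤y
...   | no  x≰y = contradiction x²≤y² (<⇒≱ (≤-<-trans (*-monoˡ 0≤y y≤x)
                    (*-monoˡ-<-pos x {{positive (≤-<-trans 0≤y (≰⇒> x≰y))}} (≰⇒> x≰y))))
  where
  <⇒≱ : ∀ {a b} → a < b → ¬ (b ≤ a)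
  <⇒≱ a<b b≤a = <-irrefl refl (<-≤-trans a<b b≤a)

0≤1 : 0ℚ ≤ 1ℚ
0≤1 = *≤* (ℤ.+≤+ ℕ.z≤n)

two : ℚ
two = 1ℚ + 1ℚ

0≤2 : 0ℚ ≤ two
0≤2 = 0≤+ 0≤1 0≤1

0≤½ : 0ℚ ≤ ½
0≤½ = *≤* (ℤ.+≤+ ℕ.z≤n)

⟦_⟧ : ℕ → ℚ
⟦ n ⟧ = n Mult.× 1ℚ

0≤⟦_⟧ : ∀ n → 0ℚ ≤ ⟦ n ⟧
0≤⟦ zero ⟧  = ≤-refl
0≤⟦ suc n ⟧ = 0≤+ 0≤1 0≤⟦ n ⟧

⟦⟧-mono : ∀ {m n} → m ≤ℕ n → ⟦ m ⟧ ≤ ⟦ n ⟧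
⟦⟧-mono {n = n} ℕ.z≤n = 0≤⟦ n ⟧
⟦⟧-mono (ℕ.s≤s m≤n) = +-monoʳ-≤ 1ℚ (⟦⟧-mono m≤n)

⟦⟧-+ : ∀ m n → ⟦ m ℕ.+ n ⟧ ≡ ⟦ m ⟧ + ⟦ n ⟧
⟦⟧-+ = Mult.×-homo-+ 1ℚ

⟦⟧-* : ∀ m n → ⟦ m ℕ.* n ⟧ ≡ ⟦ m ⟧ * ⟦ n ⟧
⟦⟧-* = Mult.×1-homo-*

⟦⟧-cancel-≤ : ∀ {m n} → ⟦ m ⟧ ≤ ⟦ n ⟧ → m ≤ℕ n
⟦⟧-cancel-≤ {m} {n} h with m ℕ.≤? n
... | yes m≤n = m≤n
... | no  m≰n = contradiction (≤-trans (⟦⟧-mono (ℕ.≰⇒> m≰n)) h) (λ 1+n≤n →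
  <-irrefl refl (<-≤-trans (subst (_< ⟦ suc n ⟧) (+-identityˡ ⟦ n ⟧) (+-monoˡ-< ⟦ n ⟧ (positive⁻¹ 1ℚ))) 1+n≤n))

⟦⟧-/ : ∀ n → ⟦ n ⟧ ≡ ℤ.+ n / 1
⟦⟧-/ zero    = refl
⟦⟧-/ (suc n) = trans (cong (1ℚ +_) (⟦⟧-/ n)) (toℚᵘ-injective
  (ℚᵘ.≃-trans (toℚᵘ-homo-+ 1ℚ (ℤ.+ n / 1))
  (ℚᵘ.≃-trans (ℚᵘ.+-congʳ (toℚᵘ 1ℚ) (toℚᵘ-fromℚᵘ (ℚᵘ.mkℚᵘ (ℤ.+ n) 0)))
  (ℚᵘ.≃-trans (ℚᵘ.*≡* (cong (λ z → (ℤ.+ 1 ℤ.+ z) ℤ.* ℤ.+ 1) (ℤ.*-identityʳ (ℤ.+ n))))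
  (ℚᵘ.≃-sym (toℚᵘ-fromℚᵘ (ℚᵘ.mkℚᵘ (ℤ.+ suc n) 0)))))))

archimedean : ∀ q → ∃[ n ] q ≤ ⟦ n ⟧
archimedean q@(mkℚ i d c) = ℤ.∣ i ∣ , ≤-trans (toℚᵘ-cancel-≤ (ℚᵘ.≤-respʳ-≃ (ℚᵘ.≃-sym (toℚᵘ-fromℚᵘ (ℚᵘ.mkℚᵘ (ℤ.+ ℤ.∣ i ∣) 0)))
  (ℚᵘ.*≤* (bound i)))) (≤-reflexive (sym (⟦⟧-/ ℤ.∣ i ∣)))
  where
  bound : ∀ i → i ℤ.* ℤ.+ 1 ℤ.≤ ℤ.+ ℤ.∣ i ∣ ℤ.* ℤ.+ suc d
  bound (ℤ.+ n)    = subst₂ ℤ._≤_ (ℤ.pos-* n 1) (ℤ.pos-* n (suc d)) (ℤ.+≤+ (ℕ.*-monoʳ-≤ n (ℕ.s≤s ℕ.z≤n)))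
  bound -[1+ n ] = ℤ.-≤+

archimedean-* : ∀ {x} y → 0ℚ < x → ∃[ N ] (∀ n → N ≤ℕ n → y ≤ x * ⟦ n ⟧)
archimedean-* {x} y 0<x = let instance _ = positive 0<x
                              instance _ = pos⇒nonZero x
                              z = (Data.Rational.1/ x) * y
                              N , z≤N = archimedean z
                          in N , λ n N≤n → ≤-trans (≤-reflexive (trans (sym (*-identityˡ y)) (trans (cong (_* y) (sym (*-inverseʳ x))) (*-assoc x _ y))))
                                 (*-monoˡ (<⇒≤ 0<x) (≤-trans z≤N (⟦⟧-mono N≤n)))

-- Opaque, so that unification can read the summand off an application.
opaque
  ∑ : ∀ {n} → (Fin n → ℚ) → ℚ
  ∑ = Sum.sum

syntax ∑ (λ i → x) = ∑[ i ] x

infixl 10 ∑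

opaque
  unfolding ∑

  ∑-zero : (f : Fin 0 → ℚ) → ∑ f ≡ 0ℚ
  ∑-zero f = refl

  ∑-suc : ∀ {n} (f : Fin (suc n) → ℚ) → ∑ f ≡ f zero + ∑[ i ] f (suc i)
  ∑-suc f = refl

  ∑-mono : ∀ {n} {f g : Fin n → ℚ} → (∀ i → f i ≤ g i) → ∑ f ≤ ∑ g
  ∑-mono {zero}  f≤g = ≤-refl
  ∑-mono {suc n} f≤g = +-mono-≤ (f≤g zero) (∑-mono (f≤g ∘ suc))

  ∑-cong : ∀ {n} {f g : Fin n → ℚ} → (∀ i → f i ≡ g i) → ∑ f ≡ ∑ g
  ∑-cong = Sum.sum-cong-≗

  ∑-0 : ∀ n → ∑ {n} (λ _ → 0ℚ) ≡ 0ℚ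
  ∑-0 n = Sum.sum-replicate-zero n

  ∑-+ : ∀ {n} (f g : Fin n → ℚ) → ∑[ i ] (f i + g i) ≡ ∑ f + ∑ g
  ∑-+ = Sum.∑-distrib-+

  ∑-comm : ∀ {m n} (f : Fin m → Fin n → ℚ) → ∑[ i ] ∑[ j ] f i j ≡ ∑[ j ] ∑[ i ] f i j
  ∑-comm = Sum.∑-comm

  ∑-*ˡ : ∀ {n} c (f : Fin n → ℚ) → ∑[ i ] (c * f i) ≡ c * ∑ f
  ∑-*ˡ c f = sym (Sum.*-distribˡ-sum c f)

  ∑-*ʳ : ∀ {n} c (f : Fin n → ℚ) → ∑[ i ] (f i * c) ≡ ∑ f * c
  ∑-*ʳ c f = sym (Sum.*-distribʳ-sum c f)

  ∑-const : ∀ n c → ∑ {n} (λ _ → c) ≡ ⟦ n ⟧ * c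
  ∑-const zero    c = sym (*-zeroˡ c)
  ∑-const (suc n) c = trans (cong (c +_) (∑-const n c)) (lemma c ⟦ n ⟧)
    where
    lemma : ∀ c x → c + x * c ≡ (1ℚ + x) * c
    lemma = solve-∀ ℚ-ring

0≤∑ : ∀ {n} {f : Fin n → ℚ} → (∀ i → 0ℚ ≤ f i) → 0ℚ ≤ ∑ f
0≤∑ {n} 0≤f = ≤-trans (≤-reflexive (sym (∑-0 n))) (∑-mono 0≤f)

∑-≤-const : ∀ {n} {f : Fin n → ℚ} c → (∀ i → f i ≤ c) → ∑ f ≤ ⟦ n ⟧ * c
∑-≤-const {n} c f≤c = ≤-trans (∑-mono f≤c) (≤-reflexive (∑-const n c))

∑-- : ∀ {n} (f g : Fin n → ℚ) → ∑[ i ] (f i - g i) ≡ ∑ f - ∑ g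
∑-- f g = trans (∑-cong (λ i → lemma (f i) (g i)))
         (trans (∑-+ f (λ i → - 1ℚ * g i))
         (trans (cong (∑ f +_) (∑-*ˡ (- 1ℚ) g)) (sym (lemma (∑ f) (∑ g)))))
  where
  lemma : ∀ x y → x - y ≡ x + - 1ℚ * y
  lemma = solve-∀ ℚ-ring

∑∑-+ : ∀ {m n} (f g : Fin m → Fin n → ℚ) → ∑[ i ] ∑[ j ] (f i j + g i j) ≡ ∑[ i ] ∑[ j ] f i j + ∑[ i ] ∑[ j ] g i j
∑∑-+ f g = trans (∑-cong (λ i → ∑-+ (f i) (g i))) (∑-+ _ _)

∑-*-∑ : ∀ {m n} (f : Fin m → ℚ) (g : Fin n → ℚ) → ∑[ i ] ∑[ j ] (f i * g j) ≡ ∑ f * ∑ g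
∑-*-∑ f g = trans (∑-cong (λ i → ∑-*ˡ (f i) g)) (∑-*ʳ (∑ g) f)

-- Lagrange's identity: the two sides differ by half the sum `L` of all squares (f i g j - f j g
-- i)².
cauchy-schwarz : ∀ {n} (f g : Fin n → ℚ) →
  ∑[ i ] (f i * g i) * ∑[ i ] (f i * g i) ≤ ∑[ i ] (f i * f i) * ∑[ i ] (g i * g i)
cauchy-schwarz f g = ≤-by (½ * L) (0≤* 0≤½ (0≤∑ λ i → 0≤∑ λ j → 0≤x² (f i * g j - f j * g i)))
  (lemma (∑[ i ] (f i * f i)) (∑[ i ] (g i * g i)) (∑[ i ] (f i * g i)) L expand)
  where
  L = ∑[ i ] ∑[ j ] ((f i * g j - f j * g i) * (f i * g j - f j * g i))
  term : ∀ a b c d → (a * d - c * b) * (a * d - c * b) ≡ (a * a) * (d * d) + (b * b) * (c * c) - (1ℚ + 1ℚ) * ((a * b) * (c * d))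
  term = solve-∀ ℚ-ring
  expand : L ≡ ∑[ i ] (f i * f i) * ∑[ i ] (g i * g i) + ∑[ i ] (g i * g i) * ∑[ i ] (f i * f i)
               - (1ℚ + 1ℚ) * (∑[ i ] (f i * g i) * ∑[ i ] (f i * g i))
  expand = begin
    L ≡⟨ ∑-cong (λ i → trans (∑-cong (λ j → term (f i) (g i) (f j) (g j)))
                      (trans (∑-- _ _) (cong₂ _-_ (∑-+ _ _) (∑-*ˡ (1ℚ + 1ℚ) _)))) ⟩
    _ ≡⟨ ∑-- _ _ ⟩
    _ ≡⟨ cong₂ _-_ (∑-+ _ _) (∑-*ˡ (1ℚ + 1ℚ) _) ⟩
    _ ≡⟨ cong₂ _-_ (cong₂ _+_ (∑-*-∑ _ _) (∑-*-∑ _ _)) (cong ((1ℚ + 1ℚ) *_) (∑-*-∑ _ _)) ⟩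
    _ ∎
    where open ≡-Reasoning
  lemma : ∀ a b c l → l ≡ a * b + b * a - (1ℚ + 1ℚ) * (c * c) → a * b ≡ c * c + ½ * l
  lemma a b c _ refl = solve (a ∷ₗ b ∷ₗ c ∷ₗ []ₗ) ℚ-ring

-- Expectation over the random graph

-- Iterated averaging over one bit at a time instead of a weighted sum over all outcomes: linearity,
-- monotonicity and independence become inductions. `𝔼-sum` connects this form with `probOf`.
row𝔼 : ℚ → ∀ m → (Vec Bool m → ℚ) → ℚ
row𝔼 p zero    F = F []
row𝔼 p (suc m) F = row𝔼 p m (λ v → p * F (true ∷ v) + (1ℚ - p) * F (false ∷ v))

𝔼 : ℚ → ∀ n → (Graph n → ℚ) → ℚ
𝔼 p zero    F = F tt
𝔼 p (suc n) F = 𝔼 p n (λ g → row𝔼 p n (λ r → F (g , r)))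

sumℚ-++ : ∀ xs ys → sumℚ (xs ++ ys) ≡ sumℚ xs + sumℚ ys
sumℚ-++ []ₗ       ys = sym (+-identityˡ (sumℚ ys))
sumℚ-++ (x ∷ₗ xs) ys = trans (cong (x +_) (sumℚ-++ xs ys)) (sym (+-assoc x (sumℚ xs) (sumℚ ys)))

sumℚ-map-concatMap : ∀ {A B : Set} (h : B → ℚ) (k : A → List B) xs →
  sumℚ (map h (concatMap k xs)) ≡ sumℚ (map (λ x → sumℚ (map h (k x))) xs)
sumℚ-map-concatMap h k []ₗ       = refl
sumℚ-map-concatMap h k (x ∷ₗ xs) = begin
  sumℚ (map h (k x ++ concatMap k xs))                ≡⟨ cong sumℚ (List.map-++ h (k x) (concatMap k xs)) ⟩
  sumℚ (map h (k x) ++ map h (concatMap k xs))        ≡⟨ sumℚ-++ (map h (k x)) _ ⟩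
  sumℚ (map h (k x)) + sumℚ (map h (concatMap k xs))  ≡⟨ cong (sumℚ (map h (k x)) +_) (sumℚ-map-concatMap h k xs) ⟩
  _ ∎
  where open ≡-Reasoning

sumℚ-map-* : ∀ {A : Set} c (h : A → ℚ) xs → sumℚ (map (λ x → c * h x) xs) ≡ c * sumℚ (map h xs)
sumℚ-map-* c h []ₗ       = sym (*-zeroʳ c)
sumℚ-map-* c h (x ∷ₗ xs) = trans (cong (c * h x +_) (sumℚ-map-* c h xs)) (sym (*-distribˡ-+ c (h x) _))

sumℚ-map-cong : ∀ {A : Set} {h k : A → ℚ} → (∀ x → h x ≡ k x) → ∀ xs → sumℚ (map h xs) ≡ sumℚ (map k xs)
sumℚ-map-cong h≗k xs = cong sumℚ (List.map-cong h≗k xs)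

row𝔼-sum : ∀ p m F → sumℚ (map (λ r → rowWeight p r * F r) (allVecBool m)) ≡ row𝔼 p m F
row𝔼-sum p zero    F = trans (+-identityʳ _) (*-identityˡ (F []))
row𝔼-sum p (suc m) F = trans (sumℚ-map-concatMap _ _ (allVecBool m))
  (trans (sumℚ-map-cong (λ v → lemma p (rowWeight p v) (F (true ∷ v)) (F (false ∷ v))) (allVecBool m))
         (row𝔼-sum p m _))
  where
  lemma : ∀ p w x y → p * w * x + ((1ℚ - p) * w * y + 0ℚ) ≡ w * (p * x + (1ℚ - p) * y)
  lemma = solve-∀ ℚ-ring

𝔼-sum : ∀ p n F → sumℚ (map (λ g → weight p {n} g * F g) (allGraphs n)) ≡ 𝔼 p n F
𝔼-sum p zero    F = trans (+-identityʳ _) (*-identityˡ (F tt))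
𝔼-sum p (suc n) F = trans (sumℚ-map-concatMap _ _ (allGraphs n))
  (trans (sumℚ-map-cong row (allGraphs n)) (𝔼-sum p n _))
  where
  row : ∀ g → sumℚ (map (λ g → weight p {suc n} g * F g) (map (λ r → (g , r)) (allVecBool n)))
            ≡ weight p {n} g * row𝔼 p n (λ r → F (g , r))
  row g = begin
    _ ≡⟨ cong sumℚ (sym (List.map-∘ (allVecBool n))) ⟩
    _ ≡⟨ sumℚ-map-cong (λ r → *-assoc (weight p {n} g) (rowWeight p r) (F (g , r))) (allVecBool n) ⟩
    _ ≡⟨ sumℚ-map-* (weight p {n} g) _ (allVecBool n) ⟩
    _ ≡⟨ cong (weight p {n} g *_) (row𝔼-sum p n _) ⟩
    _ ∎
    where open ≡-Reasoning

row𝔼-cong : ∀ p m {F H : Vec Bool m → ℚ} → (∀ r → F r ≡ H r) → row𝔼 p m F ≡ row𝔼 p m H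
row𝔼-cong p zero    F≗H = F≗H []
row𝔼-cong p (suc m) F≗H = row𝔼-cong p m (λ v → cong₂ (λ x y → p * x + (1ℚ - p) * y) (F≗H _) (F≗H _))

𝔼-cong : ∀ p n {F H : Graph n → ℚ} → (∀ G → F G ≡ H G) → 𝔼 p n F ≡ 𝔼 p n H
𝔼-cong p zero    F≗H = F≗H tt
𝔼-cong p (suc n) F≗H = 𝔼-cong p n (λ g → row𝔼-cong p n (λ r → F≗H (g , r)))

row𝔼-+ : ∀ p m (F H : Vec Bool m → ℚ) → row𝔼 p m (λ r → F r + H r) ≡ row𝔼 p m F + row𝔼 p m H
row𝔼-+ p zero    F H = refl
row𝔼-+ p (suc m) F H = trans (row𝔼-cong p m (λ v → lemma p (F (true ∷ v)) (F (false ∷ v)) (H (true ∷ v)) (H (false ∷ v)))) (row𝔼-+ p m _ _)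
  where
  lemma : ∀ p a b c d → p * (a + c) + (1ℚ - p) * (b + d) ≡ (p * a + (1ℚ - p) * b) + (p * c + (1ℚ - p) * d)
  lemma = solve-∀ ℚ-ring

𝔼-+ : ∀ p n (F H : Graph n → ℚ) → 𝔼 p n (λ G → F G + H G) ≡ 𝔼 p n F + 𝔼 p n H
𝔼-+ p zero    F H = refl
𝔼-+ p (suc n) F H = trans (𝔼-cong p n (λ g → row𝔼-+ p n (λ r → F (g , r)) (λ r → H (g , r)))) (𝔼-+ p n _ _)

row𝔼-*ˡ : ∀ p m c (F : Vec Bool m → ℚ) → row𝔼 p m (λ r → c * F r) ≡ c * row𝔼 p m F
row𝔼-*ˡ p zero    c F = refl
row𝔼-*ˡ p (suc m) c F = trans (row𝔼-cong p m (λ v → lemma p c (F (true ∷ v)) (F (false ∷ v)))) (row𝔼-*ˡ p m c _)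
  where
  lemma : ∀ p c a b → p * (c * a) + (1ℚ - p) * (c * b) ≡ c * (p * a + (1ℚ - p) * b)
  lemma = solve-∀ ℚ-ring

𝔼-*ˡ : ∀ p n c (F : Graph n → ℚ) → 𝔼 p n (λ G → c * F G) ≡ c * 𝔼 p n F
𝔼-*ˡ p zero    c F = refl
𝔼-*ˡ p (suc n) c F = trans (𝔼-cong p n (λ g → row𝔼-*ˡ p n c (λ r → F (g , r)))) (𝔼-*ˡ p n c _)

row𝔼-const : ∀ p m c → row𝔼 p m (λ _ → c) ≡ c
row𝔼-const p zero    c = refl
row𝔼-const p (suc m) c = trans (row𝔼-cong p m (λ _ → lemma p c)) (row𝔼-const p m c)
  where
  lemma : ∀ p c → p * c + (1ℚ - p) * c ≡ c
  lemma = solve-∀ ℚ-ring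

𝔼-const : ∀ p n c → 𝔼 p n (λ _ → c) ≡ c
𝔼-const p zero    c = refl
𝔼-const p (suc n) c = trans (𝔼-cong p n (λ _ → row𝔼-const p n c)) (𝔼-const p n c)

𝔼-∑ : ∀ p n {k} (F : Fin k → Graph n → ℚ) → 𝔼 p n (λ G → ∑[ i ] F i G) ≡ ∑[ i ] 𝔼 p n (F i)
𝔼-∑ p n {zero}  F = trans (𝔼-cong p n (λ G → ∑-zero _)) (trans (𝔼-const p n 0ℚ) (sym (∑-zero _)))
𝔼-∑ p n {suc k} F = begin
  _ ≡⟨ 𝔼-cong p n (λ G → ∑-suc (λ i → F i G)) ⟩
  _ ≡⟨ 𝔼-+ p n (F zero) _ ⟩
  _ ≡⟨ cong (𝔼 p n (F zero) +_) (𝔼-∑ p n (F ∘ suc)) ⟩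
  _ ≡⟨ sym (∑-suc _) ⟩
  _ ∎
  where open ≡-Reasoning

Probability : ℚ → Set
Probability p = 0ℚ ≤ p × p ≤ 1ℚ

row𝔼-mono : ∀ {p} → Probability p → ∀ m {F H : Vec Bool m → ℚ} → (∀ r → F r ≤ H r) → row𝔼 p m F ≤ row𝔼 p m H
row𝔼-mono _             zero    F≤H = F≤H []
row𝔼-mono P@(0≤p , p≤1) (suc m) F≤H =
  row𝔼-mono P m (λ v → +-mono-≤ (*-monoˡ 0≤p (F≤H _)) (*-monoˡ (0≤y-x p≤1) (F≤H _)))

𝔼-mono : ∀ {p} → Probability p → ∀ n {F H : Graph n → ℚ} → (∀ G → F G ≤ H G) → 𝔼 p n F ≤ 𝔼 p n H
𝔼-mono P zero    F≤H = F≤H tt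
𝔼-mono P (suc n) F≤H = 𝔼-mono P n (λ g → row𝔼-mono P n (λ r → F≤H (g , r)))

-- Pointwise t - X ≤ t · [X < t], because X ≥ 0 where X < t and t - X ≤ 0 elsewhere; then take
-- expectations.
markov : ∀ {p} → Probability p → ∀ n (X : Graph n → ℚ) {ε t} → (∀ G → 0ℚ ≤ X G) → 0ℚ < t → 𝔼 p n X ≤ ε * t →
         1ℚ - ε ≤ probOf p n (λ G → ⌊ X G <? t ⌋)
markov {p} P n X {ε} {t} 0≤X 0<t 𝔼X≤εt = *-cancelˡ-≤-pos t {{positive 0<t}} (begin
  t * (1ℚ - ε)                         ≡⟨ lemma₁ t ε ⟩
  t + - 1ℚ * (ε * t)                   ≤⟨ +-monoʳ-≤ t (*-monoˡ-≤-nonPos (- 1ℚ) 𝔼X≤εt) ⟩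
  t + - 1ℚ * 𝔼 p n X                   ≡⟨ cong₂ _+_ (𝔼-const p n t) (𝔼-*ˡ p n (- 1ℚ) X) ⟨
  𝔼 p n (λ _ → t) + 𝔼 p n (λ G → - 1ℚ * X G) ≡⟨ 𝔼-+ p n _ _ ⟨
  𝔼 p n (λ G → t + - 1ℚ * X G)         ≤⟨ 𝔼-mono P n pointwise ⟩
  𝔼 p n (λ G → t * ι ⌊ X G <? t ⌋)     ≡⟨ 𝔼-*ˡ p n t _ ⟩
  t * 𝔼 p n (λ G → ι ⌊ X G <? t ⌋)     ≡⟨ cong (t *_) (𝔼-sum p n _) ⟨
  t * probOf p n (λ G → ⌊ X G <? t ⌋)  ∎)
  where
  open ≤-Reasoning
  lemma₁ : ∀ t ε → t * (1ℚ - ε) ≡ t + - 1ℚ * (ε * t)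
  lemma₁ = solve-∀ ℚ-ring
  lemma₂ : ∀ t x → t * 1ℚ ≡ t + - 1ℚ * x + x
  lemma₂ = solve-∀ ℚ-ring
  lemma₃ : ∀ t x → t * 0ℚ ≡ t + - 1ℚ * x + (x - t)
  lemma₃ = solve-∀ ℚ-ring
  pointwise : ∀ G → t + - 1ℚ * X G ≤ t * ι ⌊ X G <? t ⌋
  pointwise G with X G <? t
  ... | yes _   = ≤-by (X G) (0≤X G) (lemma₂ t (X G))
  ... | no  X≮t = ≤-by (X G - t) (0≤y-x (≮⇒≥ X≮t)) (lemma₃ t (X G))

-- Overwriting one pair is the substitute for product measures: a statistic is independent of the
-- pair i j when it is invariant under `setEdge i j b`. On the diagonal there is nothing to
-- overwrite and the graph is returned as it is.
setEdge : ∀ {n} → Fin n → Fin n → Bool → Graph n → Graph n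
setEdge zero    zero    b G       = G
setEdge zero    (suc j) b (g , r) = g , r [ j ]≔ b
setEdge (suc i) zero    b (g , r) = g , r [ i ]≔ b
setEdge (suc i) (suc j) b (g , r) = setEdge i j b g , r

adj-sym : ∀ {n} (G : Graph n) i j → adj G i j ≡ adj G j i
adj-sym {suc n} (g , r) zero    zero    = refl
adj-sym {suc n} (g , r) zero    (suc j) = refl
adj-sym {suc n} (g , r) (suc i) zero    = refl
adj-sym {suc n} (g , r) (suc i) (suc j) = adj-sym g i j

adj-irrefl : ∀ {n} (G : Graph n) i → adj G i i ≡ false
adj-irrefl {suc n} (g , r) zero    = refl
adj-irrefl {suc n} (g , r) (suc i) = adj-irrefl g i

adj-setEdge : ∀ {n} (i j : Fin n) → i ≢ j → ∀ b G → adj (setEdge i j b G) i j ≡ b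
adj-setEdge zero    zero    i≢j b G       = contradiction refl i≢j
adj-setEdge zero    (suc j) i≢j b (g , r) = Vec.lookup∘updateAt j r
adj-setEdge (suc i) zero    i≢j b (g , r) = Vec.lookup∘updateAt i r
adj-setEdge (suc i) (suc j) i≢j b (g , r) = adj-setEdge i j (i≢j ∘ cong suc) b g

adj-setEdge-other : ∀ {n} (i j k l : Fin n) → ¬ (k ≡ i × l ≡ j) → ¬ (k ≡ j × l ≡ i) →
                    ∀ b G → adj (setEdge i j b G) k l ≡ adj G k l
adj-setEdge-other zero    zero    k       l       _  _  b G       = refl
adj-setEdge-other zero    (suc j) zero    zero    _  _  b (g , r) = refl
adj-setEdge-other zero    (suc j) zero    (suc l) ¬p ¬q b (g , r) = Vec.lookup∘updateAt′ l j (λ { refl → ¬p (refl , refl) }) r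
adj-setEdge-other zero    (suc j) (suc k) zero    ¬p ¬q b (g , r) = Vec.lookup∘updateAt′ k j (λ { refl → ¬q (refl , refl) }) r
adj-setEdge-other zero    (suc j) (suc k) (suc l) _  _  b (g , r) = refl
adj-setEdge-other (suc i) zero    zero    zero    _  _  b (g , r) = refl
adj-setEdge-other (suc i) zero    zero    (suc l) ¬p ¬q b (g , r) = Vec.lookup∘updateAt′ l i (λ { refl → ¬q (refl , refl) }) r
adj-setEdge-other (suc i) zero    (suc k) zero    ¬p ¬q b (g , r) = Vec.lookup∘updateAt′ k i (λ { refl → ¬p (refl , refl) }) r
adj-setEdge-other (suc i) zero    (suc k) (suc l) _  _  b (g , r) = refl
adj-setEdge-other (suc i) (suc j) zero    zero    _  _  b (g , r) = refl
adj-setEdge-other (suc i) (suc j) zero    (suc l) _  _  b (g , r) = refl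
adj-setEdge-other (suc i) (suc j) (suc k) zero    _  _  b (g , r) = refl
adj-setEdge-other (suc i) (suc j) (suc k) (suc l) ¬p ¬q b (g , r) =
  adj-setEdge-other i j k l (λ { (refl , refl) → ¬p (refl , refl) }) (λ { (refl , refl) → ¬q (refl , refl) }) b g

row𝔼-resample : ∀ p m j (F : Vec Bool m → ℚ) →
  row𝔼 p m F ≡ row𝔼 p m (λ r → p * F (r [ j ]≔ true) + (1ℚ - p) * F (r [ j ]≔ false))
row𝔼-resample p (suc m) zero    F = row𝔼-cong p m (λ v → lemma p (p * F (true ∷ v) + (1ℚ - p) * F (false ∷ v)))
  where
  lemma : ∀ p c → c ≡ p * c + (1ℚ - p) * c
  lemma = solve-∀ ℚ-ring
row𝔼-resample p (suc m) (suc j) F = trans (row𝔼-resample p m j _)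
  (row𝔼-cong p m (λ v → lemma p (F (true ∷ v [ j ]≔ true)) (F (false ∷ v [ j ]≔ true)) (F (true ∷ v [ j ]≔ false)) (F (false ∷ v [ j ]≔ false))))
  where
  lemma : ∀ p a b c d → p * (p * a + (1ℚ - p) * b) + (1ℚ - p) * (p * c + (1ℚ - p) * d)
                      ≡ p * (p * a + (1ℚ - p) * c) + (1ℚ - p) * (p * b + (1ℚ - p) * d)
  lemma = solve-∀ ℚ-ring

-- Drawing one pair afresh does not change the law of the graph. The recursion descends to the row
-- in which the pair is stored.
𝔼-resample : ∀ p n (i j : Fin n) → i ≢ j → (F : Graph n → ℚ) →
  𝔼 p n F ≡ 𝔼 p n (λ G → p * F (setEdge i j true G) + (1ℚ - p) * F (setEdge i j false G))
𝔼-resample p (suc n) zero    zero    i≢j F = contradiction refl i≢j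
𝔼-resample p (suc n) zero    (suc j) i≢j F = 𝔼-cong p n (λ g → row𝔼-resample p n j (λ r → F (g , r)))
𝔼-resample p (suc n) (suc i) zero    i≢j F = 𝔼-cong p n (λ g → row𝔼-resample p n i (λ r → F (g , r)))
𝔼-resample p (suc n) (suc i) (suc j) i≢j F = trans (𝔼-resample p n i j (i≢j ∘ cong suc) _)
  (𝔼-cong p n (λ g → sym (trans (row𝔼-+ p n _ _) (cong₂ _+_ (row𝔼-*ˡ p n p _) (row𝔼-*ˡ p n (1ℚ - p) _)))))

𝔼-independent : ∀ p n {i j : Fin n} → i ≢ j → (φ : Bool → ℚ) (X : Graph n → ℚ) →
  (∀ b G → X (setEdge i j b G) ≡ X G) →
  𝔼 p n (λ G → φ (adj G i j) * X G) ≡ (p * φ true + (1ℚ - p) * φ false) * 𝔼 p n X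
𝔼-independent p n {i} {j} i≢j φ X invariant = begin
  𝔼 p n (λ G → φ (adj G i j) * X G)
    ≡⟨ 𝔼-resample p n i j i≢j _ ⟩
  _ ≡⟨ 𝔼-cong p n (λ G → cong₂ (λ x y → p * x + (1ℚ - p) * y) (set true G) (set false G)) ⟩
  𝔼 p n (λ G → p * (φ true * X G) + (1ℚ - p) * (φ false * X G))
    ≡⟨ 𝔼-cong p n (λ G → lemma p (φ true) (φ false) (X G)) ⟩
  𝔼 p n (λ G → (p * φ true + (1ℚ - p) * φ false) * X G)
    ≡⟨ 𝔼-*ˡ p n (p * φ true + (1ℚ - p) * φ false) X ⟩
  _ ∎
  where
  open ≡-Reasoning
  lemma : ∀ p a b x → p * (a * x) + (1ℚ - p) * (b * x) ≡ (p * a + (1ℚ - p) * b) * x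
  lemma = solve-∀ ℚ-ring
  set : ∀ b G → φ (adj (setEdge i j b G) i j) * X (setEdge i j b G) ≡ φ b * X G
  set b G = cong₂ (λ c x → φ c * x) (adj-setEdge i j i≢j b G) (invariant b G)

-- Moments of degrees and codegrees

δ : ∀ {n} → Fin n → Fin n → ℚ
δ i j = ι ⌊ i Fin.≟ j ⌋

0≤ι : ∀ b → 0ℚ ≤ ι b
0≤ι true  = 0≤1
0≤ι false = ≤-refl

ι≤1 : ∀ b → ι b ≤ 1ℚ
ι≤1 true  = ≤-refl
ι≤1 false = 0≤1

δ-suc : ∀ {n} (i j : Fin n) → δ (suc i) (suc j) ≡ δ i j
δ-suc i j with i Fin.≟ j
... | yes _ = refl
... | no  _ = refl

∑-δ : ∀ {n} (i : Fin n) → ∑[ j ] δ i j ≡ 1ℚ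
∑-δ {suc n} zero    = trans (∑-suc _) (trans (cong (1ℚ +_) (∑-0 n)) (+-identityʳ 1ℚ))
∑-δ {suc n} (suc i) = trans (∑-suc _) (trans (+-identityˡ _) (trans (∑-cong (δ-suc i)) (∑-δ i)))

-- Edges are split off one at a time; distinctness of the vertices guarantees that the rest does not
-- see the pair being split off. φ stays arbitrary for the sake of the 4-cycle, which occurs with
-- `ι`, where m = p, and with the centred indicator, where m = 0.
𝔼-cherry : ∀ p n (φ : Bool → ℚ) {v w u : Fin n} → v ≢ w → v ≢ u → w ≢ u →
  let m = p * φ true + (1ℚ - p) * φ false in
  𝔼 p n (λ G → φ (adj G v u) * φ (adj G w u)) ≡ m * m
𝔼-cherry p n φ {v} {w} {u} v≢w v≢u w≢u = begin
  𝔼 p n (λ G → φ (adj G v u) * φ (adj G w u))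
    ≡⟨ 𝔼-independent p n v≢u φ _ (λ b G → cong φ
         (adj-setEdge-other v u w u (v≢w ∘ sym ∘ proj₁) (w≢u ∘ proj₁) b G)) ⟩
  m * 𝔼 p n (λ G → φ (adj G w u))
    ≡⟨ cong (m *_) (trans (𝔼-cong p n (λ G → sym (*-identityʳ (φ (adj G w u)))))
                   (trans (𝔼-independent p n w≢u φ (λ _ → 1ℚ) (λ _ _ → refl))
                   (trans (cong (m *_) (𝔼-const p n 1ℚ)) (*-identityʳ m)))) ⟩
  m * m ∎
  where
  open ≡-Reasoning
  m = p * φ true + (1ℚ - p) * φ false

𝔼-4-cycle : ∀ p n (φ : Bool → ℚ) {v w u x : Fin n} → v ≢ w → u ≢ x → v ≢ u → w ≢ u → v ≢ x → w ≢ x →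
  let m = p * φ true + (1ℚ - p) * φ false in
  𝔼 p n (λ G → (φ (adj G v u) * φ (adj G w u)) * (φ (adj G v x) * φ (adj G w x))) ≡ m * (m * (m * m))
𝔼-4-cycle p n φ {v} {w} {u} {x} v≢w u≢x v≢u w≢u v≢x w≢x = begin
  𝔼 p n (λ G → (φ (adj G v u) * φ (adj G w u)) * (φ (adj G v x) * φ (adj G w x)))
    ≡⟨ 𝔼-cong p n (λ G → *-assoc (φ (adj G v u)) (φ (adj G w u)) _) ⟩
  𝔼 p n (λ G → φ (adj G v u) * (φ (adj G w u) * (φ (adj G v x) * φ (adj G w x))))
    ≡⟨ 𝔼-independent p n v≢u φ _ (λ b G → cong₂ _*_
         (cong φ (adj-setEdge-other v u w u (v≢w ∘ sym ∘ proj₁) (w≢u ∘ proj₁) b G))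
         (cong₂ _*_ (cong φ (adj-setEdge-other v u v x (u≢x ∘ sym ∘ proj₂) (v≢u ∘ proj₁) b G))
                    (cong φ (adj-setEdge-other v u w x (v≢w ∘ sym ∘ proj₁) (w≢u ∘ proj₁) b G)))) ⟩
  m * 𝔼 p n (λ G → φ (adj G w u) * (φ (adj G v x) * φ (adj G w x)))
    ≡⟨ cong (m *_) (𝔼-independent p n w≢u φ _ (λ b G → cong₂ _*_
         (cong φ (adj-setEdge-other w u v x (v≢w ∘ proj₁) (v≢u ∘ proj₁) b G))
         (cong φ (adj-setEdge-other w u w x (u≢x ∘ sym ∘ proj₂) (w≢u ∘ proj₁) b G)))) ⟩
  m * (m * 𝔼 p n (λ G → φ (adj G v x) * φ (adj G w x)))
    ≡⟨ cong (λ y → m * (m * y)) (𝔼-cherry p n φ v≢w v≢x w≢x) ⟩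
  m * (m * (m * m)) ∎
  where
  open ≡-Reasoning
  m = p * φ true + (1ℚ - p) * φ false

𝔼-∑² : ∀ p n {k} (F : Fin k → Graph n → ℚ) →
  𝔼 p n (λ G → ∑[ i ] F i G * ∑[ i ] F i G) ≡ ∑[ i ] ∑[ j ] 𝔼 p n (λ G → F i G * F j G)
𝔼-∑² p n F = trans (𝔼-cong p n (λ G → sym (∑-*-∑ (λ i → F i G) (λ i → F i G))))
            (trans (𝔼-∑ p n _) (∑-cong (λ i → 𝔼-∑ p n _)))

edge : ∀ {n} → Graph n → Fin n → Fin n → ℚ
edge G i j = ι (adj G i j)

totalDegree : ∀ {n} → Graph n → ℚ
totalDegree G = ∑[ i ] ∑[ j ] edge G i j

𝔼-edge≤ : ∀ {p} → Probability p → ∀ n (i j : Fin n) → 𝔼 p n (λ G → edge G i j) ≤ p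
𝔼-edge≤ {p} (0≤p , _) n i j with i Fin.≟ j
... | yes refl = ≤-trans (≤-reflexive (trans (𝔼-cong p n (λ G → cong ι (adj-irrefl G i))) (𝔼-const p n 0ℚ))) 0≤p
... | no i≢j = ≤-reflexive (begin
  𝔼 p n (λ G → edge G i j)             ≡⟨ 𝔼-cong p n (λ G → sym (*-identityʳ (edge G i j))) ⟩
  𝔼 p n (λ G → ι (adj G i j) * 1ℚ)     ≡⟨ 𝔼-independent p n i≢j ι (λ _ → 1ℚ) (λ _ _ → refl) ⟩
  (p * 1ℚ + (1ℚ - p) * 0ℚ) * 𝔼 p n (λ _ → 1ℚ) ≡⟨ cong ((p * 1ℚ + (1ℚ - p) * 0ℚ) *_) (𝔼-const p n 1ℚ) ⟩
  (p * 1ℚ + (1ℚ - p) * 0ℚ) * 1ℚ        ≡⟨ solve (p ∷ₗ []ₗ) ℚ-ring ⟩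
  p ∎)
  where open ≡-Reasoning

𝔼-totalDegree≤ : ∀ {p} → Probability p → ∀ n → 𝔼 p n totalDegree ≤ ⟦ n ⟧ * (⟦ n ⟧ * p)
𝔼-totalDegree≤ {p} P n = ≤-trans
  (≤-reflexive (trans (𝔼-∑ p n _) (∑-cong (λ i → 𝔼-∑ p n _))))
  (∑-≤-const _ (λ i → ∑-≤-const _ (λ j → 𝔼-edge≤ P n i j)))

codegree : ∀ {n} → Graph n → Fin n → Fin n → ℚ
codegree G v w = ∑[ u ] (edge G v u * edge G w u)

-- Diagonal pairs, where the codegree is the whole degree, are left out: in an orientation no
-- directed 2-path returns to its start.
codegreeEnergy : ∀ {n} → Graph n → ℚ
codegreeEnergy G = ∑[ v ] ∑[ w ] (ι (neq v w) * (codegree G v w * codegree G v w))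

-- For u = x the product collapses to a cherry of mean p², for u ≠ x it is a 4-cycle of mean p⁴. If
-- u or x meets v or w, a loop enters the product and makes it vanish.
𝔼-codegree-term≤ : ∀ {p} → Probability p → ∀ n {v w : Fin n} → v ≢ w → ∀ u x →
  𝔼 p n (λ G → (edge G v u * edge G w u) * (edge G v x * edge G w x)) ≤ δ u x * (p * p) + p * p * (p * p)
𝔼-codegree-term≤ {p} (0≤p , _) n {v} {w} v≢w u x = cases (v Fin.≟ u) (w Fin.≟ u) (v Fin.≟ x) (w Fin.≟ x)
  where
  0≤bound : ∀ b → 0ℚ ≤ ι b * (p * p) + p * p * (p * p)
  0≤bound b = 0≤+ (0≤* (0≤ι b) (0≤* 0≤p 0≤p)) (0≤* (0≤* 0≤p 0≤p) (0≤* 0≤p 0≤p))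
  term : Graph n → ℚ
  term G = (edge G v u * edge G w u) * (edge G v x * edge G w x)
  vanish : (∀ G → term G ≡ 0ℚ) → 𝔼 p n term ≤ δ u x * (p * p) + p * p * (p * p)
  vanish term≡0 = ≤-trans (≤-reflexive (trans (𝔼-cong p n term≡0) (𝔼-const p n 0ℚ))) (0≤bound ⌊ u Fin.≟ x ⌋)
  loop : ∀ G i → edge G i i ≡ 0ℚ
  loop G i = cong ι (adj-irrefl G i)
  z₁ : ∀ a b c → (0ℚ * a) * (b * c) ≡ 0ℚ
  z₁ = solve-∀ ℚ-ring
  z₂ : ∀ a b c → (a * 0ℚ) * (b * c) ≡ 0ℚ
  z₂ = solve-∀ ℚ-ring
  z₃ : ∀ a b c → (a * b) * (0ℚ * c) ≡ 0ℚ
  z₃ = solve-∀ ℚ-ring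
  z₄ : ∀ a b c → (a * b) * (c * 0ℚ) ≡ 0ℚ
  z₄ = solve-∀ ℚ-ring
  idem : ∀ b c → (ι b * ι c) * (ι b * ι c) ≡ ι b * ι c
  idem true  true  = refl
  idem true  false = refl
  idem false true  = refl
  idem false false = refl
  value₂ : ∀ p → (p * 1ℚ + (1ℚ - p) * 0ℚ) * (p * 1ℚ + (1ℚ - p) * 0ℚ) ≡ p * p
  value₂ = solve-∀ ℚ-ring
  value₄ : ∀ p → let m = p * 1ℚ + (1ℚ - p) * 0ℚ in m * (m * (m * m)) ≡ 0ℚ * (p * p) + p * p * (p * p)
  value₄ = solve-∀ ℚ-ring
  identity₁ : ∀ p → 1ℚ * (p * p) + p * p * (p * p) ≡ p * p + p * p * (p * p)
  identity₁ = solve-∀ ℚ-ring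
  cases : Dec (v ≡ u) → Dec (w ≡ u) → Dec (v ≡ x) → Dec (w ≡ x) →
          𝔼 p n term ≤ ι ⌊ u Fin.≟ x ⌋ * (p * p) + p * p * (p * p)
  cases (yes refl) _ _ _ = vanish (λ G → trans (cong (λ z → z * edge G w v * (edge G v x * edge G w x)) (loop G v)) (z₁ (edge G w v) (edge G v x) (edge G w x)))
  cases _ (yes refl) _ _ = vanish (λ G → trans (cong (λ z → edge G v w * z * (edge G v x * edge G w x)) (loop G w)) (z₂ (edge G v w) (edge G v x) (edge G w x)))
  cases _ _ (yes refl) _ = vanish (λ G → trans (cong (λ z → edge G v u * edge G w u * (z * edge G w v)) (loop G v)) (z₃ (edge G v u) (edge G w u) (edge G w v)))
  cases _ _ _ (yes refl) = vanish (λ G → trans (cong (λ z → edge G v u * edge G w u * (edge G v w * z)) (loop G w)) (z₄ (edge G v u) (edge G w u) (edge G v w)))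
  cases (no v≢u) (no w≢u) (no v≢x) (no w≢x) with u Fin.≟ x
  ... | no u≢x = ≤-reflexive (trans (𝔼-4-cycle p n ι v≢w u≢x v≢u w≢u v≢x w≢x) (value₄ p))
  ... | yes refl = ≤-by (p * p * (p * p)) (0≤* (0≤* 0≤p 0≤p) (0≤* 0≤p 0≤p))
    (trans (identity₁ p) (cong (_+ p * p * (p * p)) (sym (trans (𝔼-cong p n (λ G → idem (adj G v u) (adj G w u)))
    (trans (𝔼-cherry p n ι v≢w v≢u w≢u) (value₂ p))))))

𝔼-codegreeEnergy≤ : ∀ {p} → Probability p → ∀ n →
  𝔼 p n codegreeEnergy ≤ ⟦ n ⟧ * (⟦ n ⟧ * (⟦ n ⟧ * (p * p + ⟦ n ⟧ * (p * p * (p * p)))))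
𝔼-codegreeEnergy≤ {p} P n = ≤-trans
  (≤-reflexive (trans (𝔼-∑ p n _) (∑-cong (λ v → 𝔼-∑ p n _))))
  (∑-≤-const _ (λ v → ∑-≤-const _ (λ w → ≤-trans (≤-reflexive (𝔼-*ˡ p n (ι (neq v w)) _)) (pair v w))))
  where
  bound = ⟦ n ⟧ * (p * p + ⟦ n ⟧ * (p * p * (p * p)))
  0≤p = proj₁ P
  0≤bound : 0ℚ ≤ bound
  0≤bound = 0≤* 0≤⟦ n ⟧ (0≤+ (0≤* 0≤p 0≤p) (0≤* 0≤⟦ n ⟧ (0≤* (0≤* 0≤p 0≤p) (0≤* 0≤p 0≤p))))
  inner : ∀ u → ∑[ x ] (δ u x * (p * p) + p * p * (p * p)) ≡ p * p + ⟦ n ⟧ * (p * p * (p * p))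
  inner u = trans (∑-+ _ _) (cong₂ _+_ (trans (∑-*ʳ (p * p) (δ u)) (trans (cong (_* (p * p)) (∑-δ u)) (*-identityˡ (p * p)))) (∑-const n _))
  pair : ∀ v w → ι (neq v w) * 𝔼 p n (λ G → codegree G v w * codegree G v w) ≤ bound
  pair v w with v Fin.≟ w
  ... | yes _  = ≤-trans (≤-reflexive (*-zeroˡ (𝔼 p n (λ G → codegree G v w * codegree G v w)))) 0≤bound
  ... | no v≢w = ≤-trans (≤-reflexive (trans (*-identityˡ (𝔼 p n (λ G → codegree G v w * codegree G v w))) (𝔼-∑² p n _)))
    (∑-≤-const _ (λ u → ≤-trans (∑-mono (λ x → 𝔼-codegree-term≤ P n v≢w u x)) (≤-reflexive (inner u))))

-- Discrepancy through the fourth moment of the centred adjacency matrix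

centred : ℚ → ∀ {n} → Graph n → Fin n → Fin n → ℚ
centred p G i j = ι (adj G i j) - p

centredGram : ℚ → ∀ {n} → Graph n → Fin n → Fin n → ℚ
centredGram p G v w = ∑[ u ] (centred p G v u * centred p G w u)

-- For the symmetric matrix M = `centred p G` this is the trace of M⁴, a signed count of closed
-- 4-walks.
spread : ℚ → ∀ {n} → Graph n → ℚ
spread p G = ∑[ v ] ∑[ w ] (centredGram p G v w * centredGram p G v w)

Contraction : ℚ → Set
Contraction x = - 1ℚ ≤ x × x ≤ 1ℚ

contraction-* : ∀ {x y} → Contraction x → Contraction y → Contraction (x * y)
contraction-* {x} {y} (-1≤x , x≤1) (-1≤y , y≤1) =
    ≤-by (½ * ((1ℚ - x) * (1ℚ - y) + (x - - 1ℚ) * (y - - 1ℚ)))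
         (0≤* 0≤½ (0≤+ (0≤* (0≤y-x x≤1) (0≤y-x y≤1)) (0≤* (0≤y-x -1≤x) (0≤y-x -1≤y)))) (lower x y)
  , ≤-by (½ * ((1ℚ - x) * (y - - 1ℚ) + (x - - 1ℚ) * (1ℚ - y)))
         (0≤* 0≤½ (0≤+ (0≤* (0≤y-x x≤1) (0≤y-x -1≤y)) (0≤* (0≤y-x -1≤x) (0≤y-x y≤1)))) (upper x y)
  where
  lower : ∀ x y → x * y ≡ - 1ℚ + ½ * ((1ℚ - x) * (1ℚ - y) + (x - - 1ℚ) * (y - - 1ℚ))
  lower = solve-∀ ℚ-ring
  upper : ∀ x y → 1ℚ ≡ x * y + ½ * ((1ℚ - x) * (y - - 1ℚ) + (x - - 1ℚ) * (1ℚ - y))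
  upper = solve-∀ ℚ-ring

centred-contraction : ∀ {p} → Probability p → ∀ {n} (G : Graph n) i j → Contraction (centred p G i j)
centred-contraction {p} (0≤p , p≤1) G i j =
    ≤-trans (neg-antimono-≤ p≤1) (≤-by (ι (adj G i j)) (0≤ι (adj G i j)) (+-comm (ι (adj G i j)) (- p)))
  , ≤-trans (+-mono-≤ (ι≤1 (adj G i j)) (neg-antimono-≤ 0≤p)) (≤-reflexive (+-identityʳ 1ℚ))

-- One step of a union bound: if A holds, its indicator alone pays for E ≤ 1; otherwise the
-- remaining steps may use ¬ A.
≤-indicator-+ : ∀ {A : Set} (d : Dec A) {E s} → E ≤ 1ℚ → 0ℚ ≤ s → (¬ A → E ≤ s) → E ≤ ι ⌊ d ⌋ + s
≤-indicator-+ (yes _) {s = s} E≤1 0≤s _ = ≤-trans E≤1 (≤-by s 0≤s refl)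
≤-indicator-+ (no ¬a) {s = s} _   _   f = ≤-trans (f ¬a) (≤-reflexive (sym (+-identityˡ s)))

-- Off the coincidences among v, w, u, x the four edges are distinct, so the centred product has mean zero.
𝔼-spread-term≤ : ∀ {p} → Probability p → ∀ n (v w u x : Fin n) →
  𝔼 p n (λ G → (centred p G v u * centred p G w u) * (centred p G v x * centred p G w x))
  ≤ δ v w + (δ u x + (δ v u + (δ w u + (δ v x + (δ w x + 0ℚ)))))
𝔼-spread-term≤ {p} P n v w u x =
  ≤-indicator-+ (v Fin.≟ w) term≤1 s₁ λ v≢w →
  ≤-indicator-+ (u Fin.≟ x) term≤1 s₂ λ u≢x →
  ≤-indicator-+ (v Fin.≟ u) term≤1 s₃ λ v≢u →
  ≤-indicator-+ (w Fin.≟ u) term≤1 s₄ λ w≢u →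
  ≤-indicator-+ (v Fin.≟ x) term≤1 s₅ λ v≢x →
  ≤-indicator-+ (w Fin.≟ x) term≤1 ≤-refl λ w≢x →
  ≤-reflexive (trans (𝔼-4-cycle p n (λ b → ι b - p) v≢w u≢x v≢u w≢u v≢x w≢x) (value p))
  where
  0≤δ : ∀ (i j : Fin n) → 0ℚ ≤ δ i j
  0≤δ i j = 0≤ι ⌊ i Fin.≟ j ⌋
  s₅ = 0≤+ (0≤δ w x) ≤-refl
  s₄ = 0≤+ (0≤δ v x) s₅
  s₃ = 0≤+ (0≤δ w u) s₄
  s₂ = 0≤+ (0≤δ v u) s₃
  s₁ = 0≤+ (0≤δ u x) s₂
  value : ∀ p → let m = p * (1ℚ - p) + (1ℚ - p) * (0ℚ - p) in m * (m * (m * m)) ≡ 0ℚ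
  value = solve-∀ ℚ-ring
  c : ∀ G i j → Contraction (centred p G i j)
  c = centred-contraction P
  term≤1 = ≤-trans (𝔼-mono P n (λ G → proj₂ (contraction-* (contraction-* (c G v u) (c G w u)) (contraction-* (c G v x) (c G w x)))))
                   (≤-reflexive (𝔼-const p n 1ℚ))

-- Each of the six coincidences ties one of the four summation vertices to another and so
-- contributes n³.
𝔼-spread≤ : ∀ {p} → Probability p → ∀ n → 𝔼 p n (spread p) ≤ ⟦ 6 ⟧ * (⟦ n ⟧ * ⟦ n ⟧ * ⟦ n ⟧)
𝔼-spread≤ {p} P n = ≤-trans (≤-reflexive (trans (𝔼-∑ p n _) (∑-cong (λ v → 𝔼-∑ p n _))))
  (≤-trans (∑-mono (λ v → ∑-mono (λ w → ≤-trans (≤-reflexive (𝔼-∑² p n _))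
     (≤-trans (∑-mono (λ u → ∑-mono (λ x → 𝔼-spread-term≤ P n v w u x))) (≤-reflexive (pair v w))))))
  (≤-reflexive (trans (∑-cong (λ v → trans (∑-+ _ _) (cong₂ _+_ (trans (∑-*ʳ (ν * ν) (δ v)) (cong (_* (ν * ν)) (∑-δ v))) (∑-const n _))))
    (trans (∑-const n _) (total ν)))))
  where
  ν = ⟦ n ⟧
  five : ℚ → ℚ
  five ν = ν * 1ℚ + (ν * 1ℚ + (ν * 1ℚ + (ν * 1ℚ + (ν * 1ℚ + ν * (ν * 0ℚ)))))
  total : ∀ ν → ν * (1ℚ * (ν * ν) + ν * (ν * 1ℚ + (ν * 1ℚ + (ν * 1ℚ + (ν * 1ℚ + (ν * 1ℚ + ν * (ν * 0ℚ))))))) ≡ ⟦ 6 ⟧ * (ν * ν * ν)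
  total = solve-∀ ℚ-ring
  constant : ∀ c → ∑[ u ] ∑[ x ] c ≡ ν * (ν * c)
  constant c = trans (∑-cong {n} (λ u → ∑-const n c)) (∑-const n _)
  first : ∀ v → ∑[ u ] ∑[ x ] δ v u ≡ ν * 1ℚ
  first v = trans (∑-cong (λ u → ∑-const n (δ v u))) (trans (∑-*ˡ ν (δ v)) (cong (ν *_) (∑-δ v)))
  second : ∀ (f : Fin n → Fin n) → ∑[ u ] ∑[ x ] δ (f u) x ≡ ν * 1ℚ
  second f = trans (∑-cong (λ u → ∑-δ (f u))) (∑-const n 1ℚ)
  lemma : ∀ ν d → ν * (ν * d) ≡ d * (ν * ν)
  lemma = solve-∀ ℚ-ring
  pair : ∀ v w → ∑[ u ] ∑[ x ] (δ v w + (δ u x + (δ v u + (δ w u + (δ v x + (δ w x + 0ℚ)))))) ≡ δ v w * (ν * ν) + five ν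
  pair v w = trans (∑∑-+ _ _) (cong₂ _+_ (trans (constant (δ v w)) (lemma ν (δ v w)))
            (trans (∑∑-+ _ _) (cong₂ _+_ (second (λ u → u))
            (trans (∑∑-+ _ _) (cong₂ _+_ (first v)
            (trans (∑∑-+ _ _) (cong₂ _+_ (first w)
            (trans (∑∑-+ _ _) (cong₂ _+_ (second (λ _ → v))
            (trans (∑∑-+ _ _) (cong₂ _+_ (second (λ _ → w)) (constant 0ℚ))))))))))))

bilinear : ∀ {n} → (Fin n → Fin n → ℚ) → (Fin n → ℚ) → (Fin n → ℚ) → ℚ
bilinear M x y = ∑[ u ] ∑[ w ] (x u * (M u w * y w))

Unit : ∀ {n} → (Fin n → ℚ) → Set
Unit x = ∀ i → 0ℚ ≤ x i × x i ≤ 1ℚ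

unit-square≤1 : ∀ {n} {x : Fin n → ℚ} → Unit x → ∀ i → x i * x i ≤ 1ℚ
unit-square≤1 {x = x} ux i = ≤-trans (*-mono (proj₁ (ux i)) 0≤1 (proj₂ (ux i)) (proj₂ (ux i))) (≤-reflexive (*-identityˡ 1ℚ))

-- Repeated Cauchy-Schwarz. With z the product of x and the matrix, b = ⟨z, y⟩ gives b² ≤ n N for N
-- = |z|². Since N is the quadratic form of the Gram matrix at x, N² ≤ n² · `spread`. Fourth powers
-- are kept, as no roots are taken.
bilinear⁴≤ : ∀ {n} p (G : Graph n) {x y : Fin n → ℚ} → Unit x → Unit y →
  let b = bilinear (centred p G) x y in
  (b * b) * (b * b) ≤ (⟦ n ⟧ * ⟦ n ⟧) * (⟦ n ⟧ * ⟦ n ⟧ * spread p G)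
bilinear⁴≤ {n} p G {x} {y} ux uy = ≤-trans
  (*-mono (0≤x² b) (0≤* 0≤⟦ n ⟧ 0≤N) b²≤ b²≤)
  (≤-trans (≤-reflexive (shuffle ν N)) (*-monoˡ (0≤* 0≤⟦ n ⟧ 0≤⟦ n ⟧) N²≤))
  where
  ν = ⟦ n ⟧
  M = centred p G
  b = bilinear M x y
  z : Fin n → ℚ
  z u = ∑[ w ] (x w * M w u)
  N = ∑[ u ] (z u * z u)
  0≤N : 0ℚ ≤ N
  0≤N = 0≤∑ (λ u → 0≤x² (z u))
  shuffle : ∀ ν N → (ν * N) * (ν * N) ≡ (ν * ν) * (N * N)
  shuffle = solve-∀ ℚ-ring
  swap : b ≡ ∑[ u ] (z u * y u)
  swap = trans (∑-comm _) (∑-cong (λ u → trans (∑-cong (λ w → sym (*-assoc (x w) (M w u) (y u)))) (∑-*ʳ (y u) _)))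
  norm≤ : ∀ {a : Fin n → ℚ} → Unit a → ∑[ i ] (a i * a i) ≤ ν
  norm≤ ua = ≤-trans (∑-≤-const 1ℚ (unit-square≤1 ua)) (≤-reflexive (*-identityʳ ν))
  b²≤ : b * b ≤ ν * N
  b²≤ = ≤-trans (≤-reflexive (cong₂ _*_ swap swap))
       (≤-trans (cauchy-schwarz z y)
       (≤-trans (*-monoˡ 0≤N (norm≤ uy)) (≤-reflexive (*-comm N ν))))
  g : Fin n → Fin n → ℚ
  g = centredGram p G
  regroup : ∀ a b c d → (a * b) * (c * d) ≡ (a * c) * (b * d)
  regroup = solve-∀ ℚ-ring
  N≡ : N ≡ ∑[ v ] ∑[ w ] ((x v * x w) * g v w)
  N≡ = begin
    N ≡⟨ ∑-cong (λ u → sym (∑-*-∑ (λ w → x w * M w u) (λ w → x w * M w u))) ⟩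
    ∑[ u ] ∑[ v ] ∑[ w ] ((x v * M v u) * (x w * M w u)) ≡⟨ ∑-comm _ ⟩
    ∑[ v ] ∑[ u ] ∑[ w ] ((x v * M v u) * (x w * M w u)) ≡⟨ ∑-cong (λ v → ∑-comm _) ⟩
    ∑[ v ] ∑[ w ] ∑[ u ] ((x v * M v u) * (x w * M w u))
      ≡⟨ ∑-cong (λ v → ∑-cong (λ w → trans (∑-cong (λ u → regroup (x v) (M v u) (x w) (M w u))) (∑-*ˡ (x v * x w) _))) ⟩
    _ ∎
    where open ≡-Reasoning
  r : Fin n → ℚ
  r v = ∑[ w ] (x w * g v w)
  N≡r : N ≡ ∑[ v ] (x v * r v)
  N≡r = trans N≡ (∑-cong (λ v → trans (∑-cong (λ w → *-assoc (x v) (x w) (g v w))) (∑-*ˡ (x v) _)))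
  r²≤ : ∀ v → r v * r v ≤ ν * ∑[ w ] (g v w * g v w)
  r²≤ v = ≤-trans (cauchy-schwarz x (g v)) (*-monoʳ (0≤∑ (λ w → 0≤x² (g v w))) (norm≤ ux))
  N²≤ : N * N ≤ ν * ν * spread p G
  N²≤ = ≤-trans (≤-reflexive (cong₂ _*_ N≡r N≡r))
       (≤-trans (cauchy-schwarz x r)
       (≤-trans (*-mono (0≤∑ (λ v → 0≤x² (x v))) (0≤* 0≤⟦ n ⟧ (0≤∑ λ v → 0≤∑ λ w → 0≤x² (g v w)))
                        (norm≤ ux) (≤-trans (∑-mono r²≤) (≤-reflexive (∑-*ˡ ν _))))
                (≤-reflexive (sym (*-assoc ν ν (spread p G))))))

-- Orientations without Sullivan vertices

∣tabulate∣ : ∀ {n} (f : Fin n → Bool) → ⟦ ∣ tabulate f ∣ ⟧ ≡ ∑[ i ] ι (f i)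
∣tabulate∣ {zero}  f = sym (∑-zero _)
∣tabulate∣ {suc n} f with f zero in eq
... | true  = trans (cong₂ _+_ (sym (cong ι eq)) (∣tabulate∣ (f ∘ suc))) (sym (∑-suc _))
... | false = trans (∣tabulate∣ (f ∘ suc)) (trans (sym (+-identityˡ _)) (trans (cong (_+ ∑[ i ] ι (f (suc i))) (sym (cong ι eq))) (sym (∑-suc _))))

any-∈ : ∀ {A : Set} (f : A → Bool) {x xs} → x ∈ xs → f x ≡ true → any f xs ≡ true
any-∈ f (here refl) fx rewrite fx = refl
any-∈ f {xs = y ∷ₗ _} (there x∈) fx with f y
... | true  = refl
... | false = any-∈ f x∈ fx

module Orientation {n} (G : Graph n) (D : Digraph n) (oriented : IsOrientation G D)
                   (noSullivan : ∀ v → ∣ Nout2 D v ∣ ℕ.< ∣ Nin D v ∣) where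

  arc : Fin n → Fin n → ℚ
  arc i j = ι (D i j)

  second : Fin n → Fin n → ℚ
  second v w = ι (lookup (Nout2 D v) w)

  outdeg indeg : Fin n → ℚ
  outdeg v = ∑[ w ] arc v w
  indeg  v = ∑[ w ] arc w v

  0≤arc : ∀ i j → 0ℚ ≤ arc i j
  0≤arc i j = 0≤ι (D i j)

  loopless : ∀ v → D v v ≡ false
  loopless v = proj₂ (oriented v v) (adj-irrefl G v)

  arc-antisym : ∀ i j → arc i j * arc j i ≡ 0ℚ
  arc-antisym i j with adj G i j in eq | D i j in ij | D j i in ji
  ... | _     | false | b     = *-zeroˡ (ι b)
  ... | _     | true  | false = refl
  ... | true  | true  | true  = contradiction (ij , ji) (proj₂ (proj₁ (oriented i j) eq))
  ... | false | true  | true  = contradiction (trans (sym ij) (proj₂ (oriented i j) eq)) λ ()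

  arc-sum : ∀ i j → arc i j + arc j i ≡ edge G i j
  arc-sum i j with adj G i j in eq
  ... | false = cong₂ _+_ (cong ι (proj₂ (oriented i j) eq))
                          (cong ι (proj₂ (oriented j i) (trans (adj-sym G j i) eq)))
  ... | true with D i j | D j i | proj₁ (oriented i j) eq
  ...   | true  | true  | _ , ¬both = contradiction (refl , refl) ¬both
  ...   | true  | false | _ = refl
  ...   | false | true  | _ = refl
  ...   | false | false | inj₁ () , _
  ...   | false | false | inj₂ () , _

  arc≤edge : ∀ u w → arc u w ≤ edge G u w
  arc≤edge u w = ≤-by (arc w u) (0≤arc w u) (sym (arc-sum u w))

  neq-∧ : ∀ (f : Fin n → Bool) v → f v ≡ false → ∀ w → neq w v ∧ f w ≡ f w
  neq-∧ f v fv w with w Fin.≟ v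
  ... | yes refl = sym fv
  ... | no  _    = refl

  lookup-Nout : ∀ v w → lookup (Nout D v) w ≡ D v w
  lookup-Nout v w = trans (Vec.lookup∘tabulate _ w) (neq-∧ (D v) v (loopless v) w)

  lookup-Nout2 : ∀ v w → lookup (Nout2 D v) w
    ≡ neq w v ∧ not (lookup (Nout D v) w) ∧ any (λ u → lookup (Nout D v) u ∧ D u w) (allFin n)
  lookup-Nout2 v w = Vec.lookup∘tabulate _ w

  -- The path indicator is kept as a factor on the right. Summed up, it splits `walks` into
  -- transitive triangles and paths ending in N₂⁺(v); in the sparse regime it confines codegrees to
  -- the reached pairs.
  walk≤ : ∀ v u w → arc v u * arc u w ≤ (arc v u * arc u w) * (arc v w + second v w)
  walk≤ v u w with D v u in vu | D u w in uw
  ... | false | b = ≤-reflexive (zero₁ (ι b) (arc v w + second v w))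
    where
    zero₁ : ∀ b c → 0ℚ * b ≡ 0ℚ * b * c
    zero₁ = solve-∀ ℚ-ring
  ... | true | false = ≤-reflexive (zero₂ (arc v w + second v w))
    where
    zero₂ : ∀ c → 1ℚ * 0ℚ ≡ 1ℚ * 0ℚ * c
    zero₂ = solve-∀ ℚ-ring
  ... | true | true = ≤-trans reach (≤-reflexive (one (arc v w + second v w)))
    where
    one : ∀ c → c ≡ 1ℚ * 1ℚ * c
    one = solve-∀ ℚ-ring
    through-u : any (λ u → lookup (Nout D v) u ∧ D u w) (allFin n) ≡ true
    through-u = any-∈ _ (∈-allFin u) (cong₂ _∧_ (trans (lookup-Nout v u) vu) uw)
    v≢w : w ≢ v
    v≢w refl = contradiction (trans (sym (cong₂ (λ a b → ι a * ι b) vu uw)) (arc-antisym v u)) 1≢0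
    neq-true : neq w v ≡ true
    neq-true with w Fin.≟ v
    ... | yes e = contradiction e v≢w
    ... | no  _ = refl
    reach : 1ℚ ≤ arc v w + second v w
    reach with D v w in vw
    ... | true  = ≤-by (second v w) (0≤ι (lookup (Nout2 D v) w)) refl
    ... | false = ≤-reflexive (sym (trans (+-identityˡ _) (cong ι (trans (lookup-Nout2 v w)
                    (cong₂ _∧_ neq-true (cong₂ (λ a b → not a ∧ b) (trans (lookup-Nout v w) vw) through-u))))))

  arc+second≤1 : ∀ v w → arc v w + second v w ≤ 1ℚ
  arc+second≤1 v w with D v w in vw
  ... | false = ≤-trans (≤-reflexive (+-identityˡ _)) (ι≤1 (lookup (Nout2 D v) w))
  ... | true  = ≤-reflexive (cong (λ b → 1ℚ + ι b) (trans (lookup-Nout2 v w)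
                  (trans (cong (λ a → neq w v ∧ not a ∧ any (λ u → lookup (Nout D v) u ∧ D u w) (allFin n)) (trans (lookup-Nout v w) vw))
                         (Bool.∧-zeroʳ (neq w v)))))

  ∣Nin∣ : ∀ v → ⟦ ∣ Nin D v ∣ ⟧ ≡ indeg v
  ∣Nin∣ v = trans (∣tabulate∣ _) (∑-cong (λ w → cong ι (neq-∧ (λ w → D w v) v (loopless v) w)))

  ∑-second≤ : ∀ v → ∑[ w ] second v w ≤ indeg v
  ∑-second≤ v = ≤-trans (≤-reflexive (sym (trans (∣tabulate∣ _) (∑-cong (λ w → cong ι (sym (lookup-Nout2 v w)))))))
               (≤-trans (⟦⟧-mono (ℕ.<⇒≤ (noSullivan v))) (≤-reflexive (∣Nin∣ v)))

  -- Here the strictness of 0 ≤ |N₂⁺(v)| < d⁻(v) matters; this is what an isolated vertex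
  -- contradicts.
  1≤indeg : ∀ v → 1ℚ ≤ indeg v
  1≤indeg v = ≤-trans (⟦⟧-mono (ℕ.≤-trans (ℕ.s≤s ℕ.z≤n) (noSullivan v))) (≤-reflexive (∣Nin∣ v))

  -- Q and R of the overview; `walks` counts directed 2-paths by their middle vertex.
  walks squares : ℚ
  walks   = ∑[ v ] (indeg v * outdeg v)
  squares = ∑[ v ] (outdeg v * outdeg v)

  walks≡∑ : walks ≡ ∑[ v ] ∑[ u ] ∑[ w ] (arc v u * arc u w)
  walks≡∑ = trans (∑-cong (λ u → sym (∑-*-∑ (λ v → arc v u) (arc u)))) (∑-comm _)

-- The dense regime

_⁺ : ℚ → ℚ
x ⁺ = 0ℚ ⊔ x

cube : ℚ → ℚ
cube x = x * x * x

⁺-pos : ∀ {x} → 0ℚ ≤ x → x ⁺ ≡ x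
⁺-pos = p≤q⇒p⊔q≡q

⁺-neg : ∀ {x} → x ≤ 0ℚ → x ⁺ ≡ 0ℚ
⁺-neg = p≥q⇒p⊔q≡p

0≤⁺ : ∀ x → 0ℚ ≤ x ⁺
0≤⁺ x = p≤p⊔q 0ℚ x

0≤cube : ∀ {x} → 0ℚ ≤ x → 0ℚ ≤ cube x
0≤cube 0≤x = 0≤* (0≤* 0≤x 0≤x) 0≤x

x-1≤0 : ∀ {x} → x ≤ 1ℚ → x - 1ℚ ≤ 0ℚ
x-1≤0 {x} x≤1 = ≤-trans (+-monoˡ-≤ (- 1ℚ) x≤1) (≤-reflexive (+-inverseʳ 1ℚ))

-- The maximum of h (2 y - 1 - h) is (y - ½)², which is less than the increment of y³ / 3.
cube-increment : ∀ y {h} → 0ℚ ≤ h → ⟦ 3 ⟧ * (h * (y + y - 1ℚ - h)) ≤ cube (y ⁺) - cube ((y - 1ℚ) ⁺)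
cube-increment y {h} 0≤h with ≤-total y 0ℚ
... | inj₁ y≤0 = ≤-trans
  (≤-by (⟦ 3 ⟧ * (h * ((0ℚ - y) + (0ℚ - y) + 1ℚ + h)))
        (0≤* 0≤⟦ 3 ⟧ (0≤* 0≤h (0≤+ (0≤+ (0≤+ (0≤y-x y≤0) (0≤y-x y≤0)) 0≤1) 0≤h))) (lemma y h))
  (≤-reflexive (sym (cong₂ (λ a b → cube a - cube b) (⁺-neg y≤0) (⁺-neg (x-1≤0 (≤-trans y≤0 0≤1))))))
  where
  lemma : ∀ y h → 0ℚ ≡ ⟦ 3 ⟧ * (h * (y + y - 1ℚ - h)) + ⟦ 3 ⟧ * (h * ((0ℚ - y) + (0ℚ - y) + 1ℚ + h))
  lemma = solve-∀ ℚ-ring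
... | inj₂ 0≤y with ≤-total y 1ℚ
...   | inj₂ 1≤y = ≤-trans
  (≤-by (⟦ 3 ⟧ * ((h - (y - ½)) * (h - (y - ½))) + ½ * ½) (0≤+ (0≤* 0≤⟦ 3 ⟧ (0≤x² (h - (y - ½)))) (0≤* 0≤½ 0≤½)) (lemma y h))
  (≤-reflexive (sym (cong₂ (λ a b → cube a - cube b) (⁺-pos 0≤y) (⁺-pos (0≤y-x 1≤y)))))
  where
  lemma : ∀ y h → y * y * y - (y - 1ℚ) * (y - 1ℚ) * (y - 1ℚ) ≡ ⟦ 3 ⟧ * (h * (y + y - 1ℚ - h)) + (⟦ 3 ⟧ * ((h - (y - ½)) * (h - (y - ½))) + ½ * ½)
  lemma = solve-∀ ℚ-ring
...   | inj₁ y≤1 = ≤-trans middle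
  (≤-reflexive (trans (sym (+-identityʳ (cube y))) (sym (cong₂ (λ a b → cube a - cube b) (⁺-pos 0≤y) (⁺-neg (x-1≤0 y≤1))))))
  where
  middle : ⟦ 3 ⟧ * (h * (y + y - 1ℚ - h)) ≤ y * y * y
  middle with ≤-total y ½
  ... | inj₁ y≤½ = ≤-by (cube y + ⟦ 3 ⟧ * (h * ((½ - y) + (½ - y) + h)))
                    (0≤+ (0≤cube 0≤y) (0≤* 0≤⟦ 3 ⟧ (0≤* 0≤h (0≤+ (0≤+ (0≤y-x y≤½) (0≤y-x y≤½)) 0≤h)))) (lemma y h)
    where
    lemma : ∀ y h → y * y * y ≡ ⟦ 3 ⟧ * (h * (y + y - 1ℚ - h)) + (y * y * y + ⟦ 3 ⟧ * (h * ((½ - y) + (½ - y) + h)))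
    lemma = solve-∀ ℚ-ring
  -- Completing the square in h leaves y³ - 3 (y - ½)² = (y - ½)((y - 5/4)² + 3/16) + 1/8, which is
  -- positive for y ≥ ½.
  ... | inj₂ ½≤y = ≤-by (⟦ 3 ⟧ * ((h - (y - ½)) * (h - (y - ½))) + ((y - ½) * ((y - 1ℚ - ½ * ½) * (y - 1ℚ - ½ * ½) + ½ * ½ * ½ * ½ * ⟦ 3 ⟧) + ½ * ½ * ½))
                    (0≤+ (0≤* 0≤⟦ 3 ⟧ (0≤x² (h - (y - ½))))
                         (0≤+ (0≤* (0≤y-x ½≤y) (0≤+ (0≤x² (y - 1ℚ - ½ * ½)) (*≤* (ℤ.+≤+ ℕ.z≤n)))) (*≤* (ℤ.+≤+ ℕ.z≤n)))) (lemma y h)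
    where
    lemma : ∀ y h → y * y * y ≡ ⟦ 3 ⟧ * (h * (y + y - 1ℚ - h))
      + (⟦ 3 ⟧ * ((h - (y - ½)) * (h - (y - ½))) + ((y - ½) * ((y - 1ℚ - ½ * ½) * (y - 1ℚ - ½ * ½) + ½ * ½ * ½ * ½ * ⟦ 3 ⟧) + ½ * ½ * ½))
    lemma = solve-∀ ℚ-ring

-- The sum telescopes, and the cube subtracted at the end is nonnegative because `_⁺` truncates it
-- even when n exceeds y.
∑-cube-increment≤ : ∀ n y → ∑[ t ] (cube ((y - ⟦ toℕ {n} t ⟧) ⁺) - cube ((y - ⟦ toℕ t ⟧ - 1ℚ) ⁺)) ≤ cube (y ⁺)
∑-cube-increment≤ zero    y = ≤-trans (≤-reflexive (∑-zero _)) (0≤cube (0≤⁺ y))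
∑-cube-increment≤ (suc n) y = ≤-trans (≤-reflexive (∑-suc _))
  (≤-trans (+-mono-≤ (≤-reflexive (cong₂ (λ a b → cube (a ⁺) - cube (b ⁺)) (+-identityʳ y) (cong (_- 1ℚ) (+-identityʳ y))))
                     (≤-trans (≤-reflexive (∑-cong λ t → cong₂ (λ a b → cube (a ⁺) - cube (b ⁺)) (shift₁ y ⟦ toℕ t ⟧) (shift₂ y ⟦ toℕ t ⟧)))
                              (∑-cube-increment≤ n (y - 1ℚ))))
           (≤-reflexive (cancel (cube (y ⁺)) (cube ((y - 1ℚ) ⁺)))))
  where
  shift₁ : ∀ y t → y - (1ℚ + t) ≡ y - 1ℚ - t
  shift₁ = solve-∀ ℚ-ring
  shift₂ : ∀ y t → y - (1ℚ + t) - 1ℚ ≡ y - 1ℚ - t - 1ℚ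
  shift₂ = solve-∀ ℚ-ring
  cancel : ∀ a b → a - b + b ≡ a
  cancel = solve-∀ ℚ-ring

∑-below : ∀ n k → k ≤ℕ n → ∑[ t ] ι (toℕ {n} t ℕ.<ᵇ k) ≡ ⟦ k ⟧
∑-below n       zero    _           = ∑-0 n
∑-below (suc n) (suc k) (ℕ.s≤s k≤n) = trans (∑-suc _) (cong (1ℚ +_) (∑-below n k k≤n))

-- Consecutive odd numbers add up to (s + k)² - s². The shift s makes the induction go through; the
-- application has s = 0.
∑-odd-below : ∀ n k s → k ≤ℕ n →
  ∑[ t ] ((s + s + ⟦ toℕ {n} t ⟧ + ⟦ toℕ t ⟧ + 1ℚ) * ι (toℕ t ℕ.<ᵇ k)) ≡ ⟦ k ⟧ * (s + s + ⟦ k ⟧)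
∑-odd-below n       zero    s _           = trans (∑-cong (λ t → *-zeroʳ (s + s + ⟦ toℕ t ⟧ + ⟦ toℕ t ⟧ + 1ℚ))) (trans (∑-0 n) (sym (*-zeroˡ (s + s + 0ℚ))))
∑-odd-below (suc n) (suc k) s (ℕ.s≤s k≤n) = begin
  _ ≡⟨ ∑-suc _ ⟩
  _ ≡⟨ cong ((s + s + 0ℚ + 0ℚ + 1ℚ) * 1ℚ +_) (trans (∑-cong (λ t → cong (_* ι (toℕ t ℕ.<ᵇ k)) (shift s ⟦ toℕ t ⟧))) (∑-odd-below n k (s + 1ℚ) k≤n)) ⟩
  (s + s + 0ℚ + 0ℚ + 1ℚ) * 1ℚ + ⟦ k ⟧ * (s + 1ℚ + (s + 1ℚ) + ⟦ k ⟧) ≡⟨ collect s ⟦ k ⟧ ⟩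
  _ ∎
  where
  open ≡-Reasoning
  shift : ∀ s t → s + s + (1ℚ + t) + (1ℚ + t) + 1ℚ ≡ s + 1ℚ + (s + 1ℚ) + t + t + 1ℚ
  shift = solve-∀ ℚ-ring
  collect : ∀ s k → (s + s + 0ℚ + 0ℚ + 1ℚ) * 1ℚ + k * (s + 1ℚ + (s + 1ℚ) + k) ≡ (1ℚ + k) * (s + s + (1ℚ + k))
  collect = solve-∀ ℚ-ring

-- c bounds the cut norm of the centred matrix: by `edge-bilinear`, the weighted edge count between
-- x and y is p · ∑ x · ∑ y up to an error c.
Cut : ℚ → ∀ {n} → Graph n → ℚ → Set
Cut p {n} G c = ∀ {x y : Fin n → ℚ} → Unit x → Unit y →
  bilinear (centred p G) x y ≤ c × - c ≤ bilinear (centred p G) x y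

edge-bilinear : ∀ p {n} (G : Graph n) x y →
  bilinear (edge G) x y ≡ p * (∑ x * ∑ y) + bilinear (centred p G) x y
edge-bilinear p G x y = begin
  _ ≡⟨ ∑-cong (λ u → trans (∑-cong (λ w → term p (x u) (edge G u w) (y w))) (∑-+ _ _)) ⟩
  _ ≡⟨ ∑-+ _ _ ⟩
  _ ≡⟨ cong (_+ bilinear (centred p G) x y) (trans (∑-cong (λ u → ∑-*ˡ p _)) (trans (∑-*ˡ p _) (cong (p *_) (∑-*-∑ x y)))) ⟩
  _ ∎
  where
  open ≡-Reasoning
  term : ∀ p x a y → x * (a * y) ≡ p * (x * y) + x * ((a - p) * y)
  term = solve-∀ ℚ-ring

unit-1 : ∀ {n} → Unit {n} (λ _ → 1ℚ)
unit-1 _ = 0≤1 , ≤-refl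

unit-ι : ∀ {n} (f : Fin n → Bool) → Unit (λ i → ι (f i))
unit-ι f i = 0≤ι (f i) , ι≤1 (f i)

∑-1 : ∀ n → ∑ {n} (λ _ → 1ℚ) ≡ ⟦ n ⟧
∑-1 n = trans (∑-const n 1ℚ) (*-identityʳ ⟦ n ⟧)

module DenseOrientation {n} (G : Graph n) (D : Digraph n) (oriented : IsOrientation G D)
                        (noSullivan : ∀ v → ∣ Nout2 D v ∣ ℕ.< ∣ Nin D v ∣)
                        {p c : ℚ} (0≤p : 0ℚ ≤ p) (cut : Cut p G c) where
  open Orientation G D oriented noSullivan

  ν = ⟦ n ⟧

  -- T counts arcs inside N⁺(v). Adding T with u and w exchanged turns arcs into edges, and the
  -- ordered edge count of N⁺(v) is p d⁺(v)² up to c. The doubling is the origin of the factor ½ in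
  -- front of R.
  triangles≤ : ∀ v → let T = ∑[ u ] ∑[ w ] (arc v u * (arc u w * arc v w)) in
               T + T ≤ p * (outdeg v * outdeg v) + c
  triangles≤ v = ≤-trans (≤-reflexive T+T) (+-monoʳ-≤ (p * (outdeg v * outdeg v)) (proj₁ (cut (unit-ι (D v)) (unit-ι (D v)))))
    where
    T = ∑[ u ] ∑[ w ] (arc v u * (arc u w * arc v w))
    merge : ∀ x a b y → x * (a * y) + y * (b * x) ≡ x * ((a + b) * y)
    merge = solve-∀ ℚ-ring
    T+T : T + T ≡ p * (outdeg v * outdeg v) + bilinear (centred p G) (arc v) (arc v)
    T+T = begin
      T + T ≡⟨ cong (T +_) (∑-comm _) ⟩
      T + ∑[ u ] ∑[ w ] (arc v w * (arc w u * arc v u)) ≡⟨ ∑∑-+ _ _ ⟨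
      _ ≡⟨ ∑-cong (λ u → ∑-cong (λ w → trans (merge (arc v u) (arc u w) (arc w u) (arc v w))
             (cong (λ a → arc v u * (a * arc v w)) (arc-sum u w)))) ⟩
      bilinear (edge G) (arc v) (arc v) ≡⟨ edge-bilinear p G (arc v) (arc v) ⟩
      _ ∎
      where open ≡-Reasoning

  -- All edges between N⁺(v) and N₂⁺(v) might point outwards, so nothing is halved here. The
  -- hypothesis that v is not a Sullivan vertex enters as |N₂⁺(v)| ≤ d⁻(v).
  seconds≤ : ∀ v → ∑[ u ] ∑[ w ] (arc v u * (arc u w * second v w)) ≤ p * (indeg v * outdeg v) + c
  seconds≤ v = begin
    _ ≤⟨ ∑-mono (λ u → ∑-mono (λ w → *-monoˡ (0≤arc v u) (*-monoʳ (0≤ι (lookup (Nout2 D v) w)) (arc≤edge u w)))) ⟩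
    bilinear (edge G) (arc v) (second v) ≡⟨ edge-bilinear p G (arc v) (second v) ⟩
    _ ≤⟨ +-mono-≤ (*-monoˡ 0≤p (*-monoˡ (0≤∑ (0≤arc v)) (∑-second≤ v))) (proj₁ (cut (unit-ι (D v)) (unit-ι (lookup (Nout2 D v))))) ⟩
    p * (outdeg v * indeg v) + c ≡⟨ cong (λ x → p * x + c) (*-comm (outdeg v) (indeg v)) ⟩
    _ ∎
    where open ≤-Reasoning

  walks-upper : two * walks ≤ p * squares + two * (p * walks) + ⟦ 3 ⟧ * (ν * c)
  walks-upper = begin
    two * walks ≡⟨ cong (two *_) walks≡∑ ⟩
    two * ∑[ v ] ∑[ u ] ∑[ w ] (arc v u * arc u w)
      ≤⟨ *-monoˡ 0≤2 (∑-mono λ v → ∑-mono λ u → ∑-mono λ w → walk≤ v u w) ⟩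
    two * ∑[ v ] ∑[ u ] ∑[ w ] ((arc v u * arc u w) * (arc v w + second v w))
      ≡⟨ cong (two *_) (∑-cong λ v → trans (∑-cong λ u → ∑-cong λ w → split (arc v u) (arc u w) (arc v w) (second v w)) (∑∑-+ _ _)) ⟩
    two * ∑[ v ] (T v + U v) ≡⟨ ∑-*ˡ two (λ v → T v + U v) ⟨
    ∑[ v ] (two * (T v + U v)) ≤⟨ ∑-mono pointwise ⟩
    ∑[ v ] (p * (outdeg v * outdeg v) + two * (p * (indeg v * outdeg v)) + ⟦ 3 ⟧ * c)
      ≡⟨ trans (∑-+ _ _) (cong₂ _+_ (trans (∑-+ _ _) (cong₂ _+_ (∑-*ˡ p _) (trans (∑-*ˡ two _) (cong (two *_) (∑-*ˡ p _))))) (trans (∑-const n _) (swap ν c))) ⟩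
    _ ∎
    where
    open ≤-Reasoning
    T U : Fin n → ℚ
    T v = ∑[ u ] ∑[ w ] (arc v u * (arc u w * arc v w))
    U v = ∑[ u ] ∑[ w ] (arc v u * (arc u w * second v w))
    split : ∀ x a y z → (x * a) * (y + z) ≡ x * (a * y) + x * (a * z)
    split = solve-∀ ℚ-ring
    swap : ∀ ν c → ν * (⟦ 3 ⟧ * c) ≡ ⟦ 3 ⟧ * (ν * c)
    swap = solve-∀ ℚ-ring
    combine₁ : ∀ t u → two * (t + u) ≡ (t + t) + (u + u)
    combine₁ = solve-∀ ℚ-ring
    combine₂ : ∀ r q c → (r + c) + ((q + c) + (q + c)) ≡ r + two * q + ⟦ 3 ⟧ * c
    combine₂ = solve-∀ ℚ-ring
    pointwise : ∀ v → two * (T v + U v) ≤ p * (outdeg v * outdeg v) + two * (p * (indeg v * outdeg v)) + ⟦ 3 ⟧ * c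
    pointwise v = ≤-trans (≤-reflexive (combine₁ (T v) (U v)))
      (≤-trans (+-mono-≤ (triangles≤ v) (+-mono-≤ (seconds≤ v) (seconds≤ v)))
               (≤-reflexive (combine₂ (p * (outdeg v * outdeg v)) (p * (indeg v * outdeg v)) c)))

  arcs : ℚ
  arcs = ∑[ v ] indeg v

  arcs-lower : p * (ν * ν) - c ≤ two * arcs
  arcs-lower = begin
    p * (ν * ν) - c ≤⟨ +-monoʳ-≤ (p * (ν * ν)) (proj₂ (cut {λ _ → 1ℚ} {λ _ → 1ℚ} unit-1 unit-1)) ⟩
    p * (ν * ν) + bilinear (centred p G) (λ _ → 1ℚ) (λ _ → 1ℚ)
      ≡⟨ cong (λ s → p * (s * s) + bilinear (centred p G) (λ _ → 1ℚ) (λ _ → 1ℚ)) (∑-1 n) ⟨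
    _ ≡⟨ edge-bilinear p G _ _ ⟨
    bilinear (edge G) (λ _ → 1ℚ) (λ _ → 1ℚ)
      ≡⟨ ∑-cong (λ u → ∑-cong (λ w → trans (drop-1 (edge G u w)) (sym (arc-sum u w)))) ⟩
    ∑[ u ] ∑[ w ] (arc u w + arc w u) ≡⟨ ∑∑-+ _ _ ⟩
    ∑[ u ] ∑[ w ] arc u w + arcs ≡⟨ cong (_+ arcs) (∑-comm _) ⟩
    arcs + arcs ≡⟨ double arcs ⟩
    two * arcs ∎
    where
    open ≤-Reasoning
    drop-1 : ∀ a → 1ℚ * (a * 1ℚ) ≡ a
    drop-1 = solve-∀ ℚ-ring
    double : ∀ a → a + a ≡ two * a
    double = solve-∀ ℚ-ring

  -- R + Q is the sum of d⁺(v) d(v) over all v. Grouped by the head u of the arc leaving v, it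
  -- becomes the sum over u of the edge count between N⁻(u) and all vertices, which is p n d⁻(u) up
  -- to c. No concentration of single degrees is needed.
  squares+walks-lower : p * (ν * arcs) - ν * c ≤ squares + walks
  squares+walks-lower = begin
    p * (ν * arcs) - ν * c ≡⟨ rearrange p ν arcs c ⟩
    p * ν * arcs + ν * (- c) ≡⟨ cong₂ _+_ (sym (∑-*ˡ (p * ν) indeg)) (sym (∑-const n (- c))) ⟩
    _ ≡⟨ ∑-+ _ _ ⟨
    ∑[ u ] (p * ν * indeg u + - c) ≤⟨ ∑-mono pointwise ⟩
    ∑[ u ] ∑[ v ] ∑[ w ] (arc v u * (edge G v w * 1ℚ)) ≡⟨ ∑-comm _ ⟩
    ∑[ v ] ∑[ u ] ∑[ w ] (arc v u * (edge G v w * 1ℚ)) ≡⟨ ∑-cong row ⟩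
    ∑[ v ] (outdeg v * outdeg v + indeg v * outdeg v) ≡⟨ ∑-+ _ _ ⟩
    _ ∎
    where
    open ≤-Reasoning
    rearrange : ∀ p ν e c → p * (ν * e) - ν * c ≡ p * ν * e + ν * (- c)
    rearrange = solve-∀ ℚ-ring
    commute : ∀ p ν d → p * ν * d ≡ p * (d * ν)
    commute = solve-∀ ℚ-ring
    pointwise : ∀ u → p * ν * indeg u + - c ≤ ∑[ v ] ∑[ w ] (arc v u * (edge G v w * 1ℚ))
    pointwise u = ≤-trans
      (+-mono-≤ (≤-reflexive (trans (commute p ν (indeg u)) (cong (λ s → p * (indeg u * s)) (sym (∑-1 n)))))
                (proj₂ (cut {y = λ _ → 1ℚ} (unit-ι (λ v → D v u)) unit-1)))
      (≤-reflexive (sym (edge-bilinear p G (λ v → arc v u) (λ _ → 1ℚ))))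
    distrib : ∀ a b → a * (a + b) ≡ a * a + b * a
    distrib = solve-∀ ℚ-ring
    row : ∀ v → ∑[ u ] ∑[ w ] (arc v u * (edge G v w * 1ℚ)) ≡ outdeg v * outdeg v + indeg v * outdeg v
    row v = trans (∑-*-∑ (arc v) (λ w → edge G v w * 1ℚ))
           (trans (cong (outdeg v *_) (trans (∑-cong (λ w → trans (*-identityʳ (edge G v w)) (sym (arc-sum v w)))) (∑-+ _ _)))
                  (distrib (outdeg v) (indeg v)))

  degree : Fin n → ℕ
  degree v = ∣ tabulate (D v) ∣

  ⟦degree⟧ : ∀ v → ⟦ degree v ⟧ ≡ outdeg v
  ⟦degree⟧ v = ∣tabulate∣ (D v)

  -- Layer-cake decomposition: summing the levels over t gives d⁺(v), and summing them with weights
  -- 2 t + 1 gives its square.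
  above : Fin n → Fin n → ℚ
  above t v = ι (toℕ t ℕ.<ᵇ degree v)

  below : Fin n → Fin n → ℚ
  below t v = 1ℚ - above t v

  size : Fin n → ℚ
  size t = ∑[ v ] above t v

  degree≤n : ∀ v → degree v ≤ℕ n
  degree≤n v = ∣p∣≤n (tabulate (D v))

  outdeg-layers : ∀ v → outdeg v ≡ ∑[ t ] above t v
  outdeg-layers v = trans (sym (⟦degree⟧ v)) (sym (∑-below n (degree v) (degree≤n v)))

  squares-layers : squares ≡ ∑[ t ] ((⟦ toℕ t ⟧ + ⟦ toℕ t ⟧ + 1ℚ) * size t)
  squares-layers = begin
    squares ≡⟨ ∑-cong (λ v → trans (cong₂ _*_ (sym (⟦degree⟧ v)) (sym (trans (+-identityˡ _) (⟦degree⟧ v)))) (sym (∑-odd-below n (degree v) 0ℚ (degree≤n v)))) ⟩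
    _ ≡⟨ ∑-comm _ ⟩
    _ ≡⟨ ∑-cong (λ t → trans (∑-*ˡ (0ℚ + 0ℚ + ⟦ toℕ t ⟧ + ⟦ toℕ t ⟧ + 1ℚ) (above t)) (cong (λ z → (z + ⟦ toℕ t ⟧ + 1ℚ) * size t) (+-identityˡ ⟦ toℕ t ⟧))) ⟩
    _ ∎
    where open ≡-Reasoning

  -- The maximum of the two outdegrees, written layer by layer.
  top : Fin n → Fin n → ℚ
  top u w = ∑[ t ] (1ℚ - below t u * below t w)

  0≤above : ∀ t v → 0ℚ ≤ above t v
  0≤above t v = 0≤ι (toℕ t ℕ.<ᵇ degree v)

  unit-below : ∀ t → Unit (below t)
  unit-below t v = 0≤y-x (ι≤1 (toℕ t ℕ.<ᵇ degree v))
                 , ≤-by (above t v) (0≤above t v) (cancel (above t v))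
    where
    cancel : ∀ a → 1ℚ ≡ 1ℚ - a + a
    cancel = solve-∀ ℚ-ring

  outdeg≤top : ∀ u w → outdeg u ≤ top u w
  outdeg≤top u w = ≤-trans (≤-reflexive (outdeg-layers u)) (∑-mono λ t →
    ≤-by (below t u * above t w) (0≤* (proj₁ (unit-below t u)) (0≤above t w)) (lemma (above t u) (above t w)))
    where
    lemma : ∀ a b → 1ℚ - (1ℚ - a) * (1ℚ - b) ≡ a + (1ℚ - a) * b
    lemma = solve-∀ ℚ-ring

  top-sym : ∀ u w → top u w ≡ top w u
  top-sym u w = ∑-cong λ t → cong (λ z → 1ℚ - z) (*-comm (below t u) (below t w))

  -- Edges with an end of outdegree above t are all edges minus those inside the complement of that
  -- set, and ν² - (ν - g)² = g (2 ν - g). Each of the two counts costs one error c.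
  layer≤ : ∀ t → ∑[ u ] ∑[ w ] (edge G u w * (1ℚ - below t u * below t w)) ≤ p * (size t * (ν + ν - size t)) + (c + c)
  layer≤ t = begin
    _ ≡⟨ ∑-cong (λ u → trans (∑-cong (λ w → split (edge G u w) (below t u) (below t w))) (∑-- _ _)) ⟩
    _ ≡⟨ ∑-- _ _ ⟩
    bilinear (edge G) (λ _ → 1ℚ) (λ _ → 1ℚ) - bilinear (edge G) (below t) (below t)
      ≡⟨ cong₂ _-_ (edge-bilinear p G _ _) (edge-bilinear p G _ _) ⟩
    (p * (∑ {n} (λ _ → 1ℚ) * ∑ {n} (λ _ → 1ℚ)) + B₁) - (p * (∑ (below t) * ∑ (below t)) + B₂)
      ≡⟨ cong₂ (λ x y → (p * (x * x) + B₁) - (p * (y * y) + B₂)) (∑-1 n) (trans (∑-- _ _) (cong (_- size t) (∑-1 n))) ⟩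
    (p * (ν * ν) + B₁) - (p * ((ν - size t) * (ν - size t)) + B₂) ≡⟨ collect p ν (size t) B₁ B₂ ⟩
    p * (size t * (ν + ν - size t)) + (B₁ + - B₂)
      ≤⟨ +-monoʳ-≤ (p * (size t * (ν + ν - size t))) (+-mono-≤ (proj₁ (cut {λ _ → 1ℚ} {λ _ → 1ℚ} unit-1 unit-1))
           (≤-trans (neg-antimono-≤ (proj₂ (cut (unit-below t) (unit-below t)))) (≤-reflexive (neg-neg c)))) ⟩
    _ ∎
    where
    open ≤-Reasoning
    B₁ = bilinear (centred p G) (λ _ → 1ℚ) (λ _ → 1ℚ)
    B₂ = bilinear (centred p G) (below t) (below t)
    neg-neg : ∀ c → - (- c) ≡ c
    neg-neg = solve-∀ ℚ-ring
    split : ∀ a x y → a * (1ℚ - x * y) ≡ 1ℚ * (a * 1ℚ) - x * (a * y)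
    split = solve-∀ ℚ-ring
    collect : ∀ p ν g b b′ → (p * (ν * ν) + b) - (p * ((ν - g) * (ν - g)) + b′) ≡ p * (g * (ν + ν - g)) + (b + - b′)
    collect = solve-∀ ℚ-ring

  -- R weights every arc by the outdegree of its tail. Passing to the larger outdegree of both ends
  -- makes the weight symmetric, so the orientation disappears and every layer is an edge count. The
  -- factor 2 comes from ordered pairs.
  squares≤layers : two * squares ≤ ∑[ t ] (p * (size t * (ν + ν - size t)) + (c + c))
  squares≤layers = begin
    two * squares ≡⟨ double squares ⟩
    squares + squares ≡⟨ cong₂ _+_ expand (trans expand (∑-comm _)) ⟩
    ∑[ u ] ∑[ w ] (arc u w * outdeg u) + ∑[ u ] ∑[ w ] (arc w u * outdeg w) ≡⟨ ∑∑-+ _ _ ⟨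
    ∑[ u ] ∑[ w ] (arc u w * outdeg u + arc w u * outdeg w) ≤⟨ ∑-mono (λ u → ∑-mono (λ w → pointwise u w)) ⟩
    ∑[ u ] ∑[ w ] (edge G u w * top u w) ≡⟨ ∑-cong (λ u → trans (∑-cong λ w → sym (∑-*ˡ (edge G u w) _)) (∑-comm _)) ⟩
    ∑[ u ] ∑[ t ] ∑[ w ] (edge G u w * (1ℚ - below t u * below t w)) ≡⟨ ∑-comm _ ⟩
    ∑[ t ] ∑[ u ] ∑[ w ] (edge G u w * (1ℚ - below t u * below t w)) ≤⟨ ∑-mono layer≤ ⟩
    _ ∎
    where
    open ≤-Reasoning
    double : ∀ a → two * a ≡ a + a
    double = solve-∀ ℚ-ring
    expand : squares ≡ ∑[ u ] ∑[ w ] (arc u w * outdeg u)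
    expand = ∑-cong (λ u → sym (∑-*ʳ (outdeg u) (arc u)))
    pointwise : ∀ u w → arc u w * outdeg u + arc w u * outdeg w ≤ edge G u w * top u w
    pointwise u w = ≤-trans
      (+-mono-≤ (*-monoˡ (0≤arc u w) (outdeg≤top u w))
                (*-monoˡ (0≤arc w u) (≤-trans (outdeg≤top w u) (≤-reflexive (top-sym w u)))))
      (≤-reflexive (trans (sym (*-distribʳ-+ (top u w) (arc u w) (arc w u))) (cong (_* top u w) (arc-sum u w))))

  -- Subtracting the exact layer formula for R from the bound on 2 R leaves R. For g = `size t`, h =
  -- p g and y = p ν - t, layer t then contributes h (2 y - 1 - h) after multiplication by p.
  -- `cube-increment` bounds this whatever g is, and the bounds telescope to (p ν)³ / 3. The
  -- extremal layer sizes decrease linearly in t.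
  squares-upper : ⟦ 3 ⟧ * (p * (squares - two * (ν * c))) ≤ cube (p * ν)
  squares-upper = begin
    ⟦ 3 ⟧ * (p * (squares - two * (ν * c)))
      ≤⟨ *-monoˡ 0≤⟦ 3 ⟧ (*-monoˡ 0≤p (≤-by (L - two * squares) (0≤y-x squares≤layers) (rearrange squares L (ν * c)))) ⟩
    ⟦ 3 ⟧ * (p * (L - squares - two * (ν * c))) ≡⟨ cong (λ z → ⟦ 3 ⟧ * (p * z)) expand ⟩
    ⟦ 3 ⟧ * (p * ∑[ t ] (p * (size t * (ν + ν - size t)) - (⟦ toℕ t ⟧ + ⟦ toℕ t ⟧ + 1ℚ) * size t))
      ≡⟨ trans (cong (⟦ 3 ⟧ *_) (sym (∑-*ˡ p _))) (sym (∑-*ˡ ⟦ 3 ⟧ _)) ⟩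
    ∑[ t ] (⟦ 3 ⟧ * (p * (p * (size t * (ν + ν - size t)) - (⟦ toℕ t ⟧ + ⟦ toℕ t ⟧ + 1ℚ) * size t)))
      ≤⟨ ∑-mono (λ t → ≤-trans (≤-reflexive (factor p ν (size t) ⟦ toℕ t ⟧)) (cube-increment (p * ν - ⟦ toℕ t ⟧) (0≤* 0≤p (0≤∑ (0≤above t))))) ⟩
    ∑[ t ] (cube ((p * ν - ⟦ toℕ t ⟧) ⁺) - cube ((p * ν - ⟦ toℕ t ⟧ - 1ℚ) ⁺)) ≤⟨ ∑-cube-increment≤ n (p * ν) ⟩
    cube ((p * ν) ⁺) ≡⟨ cong cube (⁺-pos (0≤* 0≤p 0≤⟦ n ⟧)) ⟩
    cube (p * ν) ∎
    where
    open ≤-Reasoning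
    L = ∑[ t ] (p * (size t * (ν + ν - size t)) + (c + c))
    main odd : Fin n → ℚ
    main t = p * (size t * (ν + ν - size t))
    odd t = (⟦ toℕ t ⟧ + ⟦ toℕ t ⟧ + 1ℚ) * size t
    rearrange : ∀ r l k → l - r - two * k ≡ r - two * k + (l - two * r)
    rearrange = solve-∀ ℚ-ring
    collect : ∀ a b ν c → a + ν * (c + c) - b - two * (ν * c) ≡ a - b
    collect = solve-∀ ℚ-ring
    expand : L - squares - two * (ν * c) ≡ ∑[ t ] (p * (size t * (ν + ν - size t)) - (⟦ toℕ t ⟧ + ⟦ toℕ t ⟧ + 1ℚ) * size t)
    expand = trans (cong₂ (λ x y → x - y - two * (ν * c)) (trans (∑-+ main (λ _ → c + c)) (cong (∑ main +_) (∑-const n (c + c)))) squares-layers)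
            (trans (collect (∑ main) (∑ odd) ν c) (sym (∑-- main odd)))
    factor : ∀ p ν g t → ⟦ 3 ⟧ * (p * (p * (g * (ν + ν - g)) - (t + t + 1ℚ) * g)) ≡ ⟦ 3 ⟧ * (p * g * ((p * ν - t) + (p * ν - t) - 1ℚ - p * g))
    factor = solve-∀ ℚ-ring

-- The positive combination 3 A + 6 (1 - p) B + 3 (1 - p) p ν E + (2 - p) C of the hypotheses eliminates Q, R and e.
dense-inequality : ∀ {p ν c e Q R} → 0ℚ ≤ p → p ≤ 1ℚ → 0ℚ ≤ ν → 0ℚ ≤ c →
  two * Q ≤ p * R + two * (p * Q) + ⟦ 3 ⟧ * (ν * c) →
  p * (ν * e) - ν * c ≤ R + Q →
  p * (ν * ν) - c ≤ two * e →
  ⟦ 3 ⟧ * (R - two * (ν * c)) ≤ p * p * (ν * ν * ν) →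
  p * p * (1ℚ - two * p) * (ν * ν * ν) ≤ ⟦ 30 ⟧ * (ν * c)
dense-inequality {p} {ν} {c} {e} {Q} {R} 0≤p p≤1 0≤ν 0≤c A B E C =
  -- The errors of the four hypotheses add up to (27 - 9 p - 3 p²) ν c; the last summand is the
  -- difference to 30 ν c.
  ≤-by (⟦ 3 ⟧ * a + (two - p) * c₁ + ⟦ 6 ⟧ * ((1ℚ - p) * b) + ⟦ 3 ⟧ * ((1ℚ - p) * (p * ν * e₁)) + ν * c * (⟦ 3 ⟧ + ⟦ 9 ⟧ * p + ⟦ 3 ⟧ * (p * p)))
    (0≤+ (0≤+ (0≤+ (0≤+ (0≤* 0≤⟦ 3 ⟧ (0≤y-x A)) (0≤* 0≤2-p (0≤y-x C)))
      (0≤* 0≤⟦ 6 ⟧ (0≤* 0≤1-p (0≤y-x B)))) (0≤* 0≤⟦ 3 ⟧ (0≤* 0≤1-p (0≤* (0≤* 0≤p 0≤ν) (0≤y-x E)))))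
      (0≤* (0≤* 0≤ν 0≤c) (0≤+ (0≤+ 0≤⟦ 3 ⟧ (0≤* 0≤⟦ 9 ⟧ 0≤p)) (0≤* 0≤⟦ 3 ⟧ (0≤* 0≤p 0≤p)))))
    (identity p ν c e Q R)
  where
  a  = p * R + two * (p * Q) + ⟦ 3 ⟧ * (ν * c) - two * Q
  b  = R + Q - (p * (ν * e) - ν * c)
  e₁ = two * e - (p * (ν * ν) - c)
  c₁ = p * p * (ν * ν * ν) - ⟦ 3 ⟧ * (R - two * (ν * c))
  0≤1-p = 0≤y-x p≤1
  0≤2-p : 0ℚ ≤ two - p
  0≤2-p = ≤-trans 0≤1-p (+-monoˡ-≤ (- p) (≤-by {1ℚ} {two} 1ℚ 0≤1 refl))
  identity : ∀ p ν c e Q R → ⟦ 30 ⟧ * (ν * c) ≡ p * p * (1ℚ - two * p) * (ν * ν * ν) +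
    (⟦ 3 ⟧ * (p * R + two * (p * Q) + ⟦ 3 ⟧ * (ν * c) - two * Q)
    + (two - p) * (p * p * (ν * ν * ν) - ⟦ 3 ⟧ * (R - two * (ν * c)))
    + ⟦ 6 ⟧ * ((1ℚ - p) * (R + Q - (p * (ν * e) - ν * c)))
    + ⟦ 3 ⟧ * ((1ℚ - p) * (p * ν * (two * e - (p * (ν * ν) - c))))
    + ν * c * (⟦ 3 ⟧ + ⟦ 9 ⟧ * p + ⟦ 3 ⟧ * (p * p)))
  identity = solve-∀ ℚ-ring

-- `probOf` measures Boolean predicates, whereas the property quantifies over all orientations. It
-- is therefore approximated from inside by a test f, which in each regime compares one statistic
-- with a threshold.
AlmostSurelySullivan : ℚ → ℕ → ℚ → Set
AlmostSurelySullivan p n ε =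
  ∃[ f ] ((∀ (G : Graph n) → f G ≡ true → EveryOrientationHasSullivan G) × (1ℚ - ε ≤ probOf p n f))

sullivan-by-contradiction : ∀ {n} (G : Graph n) →
  (∀ D → IsOrientation G D → (∀ v → ∣ Nout2 D v ∣ ℕ.< ∣ Nin D v ∣) → ⊥) → EveryOrientationHasSullivan G
sullivan-by-contradiction G absurd D oriented with Fin.any? (λ v → ∣ Nin D v ∣ ℕ.≤? ∣ Nout2 D v ∣)
... | yes found = found
... | no  none  = ⊥-elim (absurd D oriented (λ v → ℕ.≰⇒> (λ v-Sullivan → none (v , v-Sullivan))))

almost-surely : ∀ {p n ε t} → Probability p → (X : Graph n → ℚ) → (∀ G → 0ℚ ≤ X G) → 0ℚ < t → 𝔼 p n X ≤ ε * t →
  (∀ G → X G < t → EveryOrientationHasSullivan G) → AlmostSurelySullivan p n ε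
almost-surely {p} {n} {ε} {t} P X 0≤X 0<t 𝔼X≤ good = (λ G → ⌊ X G <? t ⌋) , true⇒good , markov P n X {ε} 0≤X 0<t 𝔼X≤
  where
  true⇒good : ∀ G → ⌊ X G <? t ⌋ ≡ true → EveryOrientationHasSullivan G
  true⇒good G _  with X G <? t
  true⇒good G _  | yes X<t = good G X<t
  true⇒good G () | no _

-- The hypothesis says `spread p G` ≤ η⁴ n⁴, so b⁴ ≤ (η n²)⁴ by `bilinear⁴≤`. The fourth root is two
-- uses of `square-cancel-≤`; applying the last one to - b as well gives the lower bound.
small-spread⇒cut : ∀ {p n} (G : Graph n) {η} → 0ℚ ≤ η →
  spread p G ≤ (η * η * ⟦ n ⟧ * ⟦ n ⟧) * (η * η) * (⟦ n ⟧ * ⟦ n ⟧) → Cut p G (η * (⟦ n ⟧ * ⟦ n ⟧))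
small-spread⇒cut {p} {n} G {η} 0≤η small {x} {y} ux uy =
    square-cancel-≤ 0≤c b²≤c²
  , ≤-trans (neg-antimono-≤ (square-cancel-≤ { - b} 0≤c (≤-trans (≤-reflexive (neg-square b)) b²≤c²))) (≤-reflexive (neg-neg b))
  where
  ν = ⟦ n ⟧
  b = bilinear (centred p G) x y
  c = η * (ν * ν)
  0≤c : 0ℚ ≤ c
  0≤c = 0≤* 0≤η (0≤* 0≤⟦ n ⟧ 0≤⟦ n ⟧)
  neg-neg : ∀ b → - (- b) ≡ b
  neg-neg = solve-∀ ℚ-ring
  neg-square : ∀ b → (- b) * (- b) ≡ b * b
  neg-square = solve-∀ ℚ-ring
  regroup : ∀ ν η → (ν * ν) * (ν * ν * ((η * η * ν * ν) * (η * η) * (ν * ν))) ≡ ((η * (ν * ν)) * (η * (ν * ν))) * ((η * (ν * ν)) * (η * (ν * ν)))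
  regroup = solve-∀ ℚ-ring
  0≤ν² = 0≤* 0≤⟦ n ⟧ 0≤⟦ n ⟧
  b²≤c² : b * b ≤ c * c
  b²≤c² = square-cancel-≤ (0≤x² c) (≤-trans (bilinear⁴≤ p G ux uy)
    (≤-trans (*-monoˡ 0≤ν² (*-monoˡ 0≤ν² small)) (≤-reflexive (regroup ν η))))

dense-regime : ∀ {δ p₀ ε} → 0ℚ < δ → 0ℚ < p₀ → 0ℚ < ε →
  ∃[ N ] (∀ n → N ≤ℕ n → ∀ {p} → Probability p → p₀ ≤ p → p ≤ ½ - δ → AlmostSurelySullivan p n ε)
dense-regime {δ} {p₀} {ε} 0<δ 0<p₀ 0<ε = suc (proj₁ large) , λ n N≤n {p} P p₀≤p p≤½-δ →
  let ν = ⟦ n ⟧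
      0<ν : 0ℚ < ν
      0<ν = <-≤-trans (positive⁻¹ 1ℚ) (≤-trans (≤-reflexive (sym (+-identityʳ 1ℚ))) (⟦⟧-mono {1} (ℕ.≤-trans (ℕ.s≤s ℕ.z≤n) N≤n)))
      t = (η * η * ν * ν) * (η * η) * (ν * ν)
      0<t : 0ℚ < t
      0<t = 0<* (0<* (0<* (0<* (0<* 0<η 0<η) 0<ν) 0<ν) (0<* 0<η 0<η)) (0<* 0<ν 0<ν)
      𝔼≤ = ≤-trans (𝔼-spread≤ P n)
           (≤-trans (*-monoʳ (0≤* (0≤* 0≤⟦ n ⟧ 0≤⟦ n ⟧) 0≤⟦ n ⟧) (proj₂ large n (ℕ.≤-trans (ℕ.n≤1+n _) N≤n)))
                    (≤-reflexive (regroup ε η ν)))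
  in almost-surely {ε = ε} P (spread p) (λ G → 0≤∑ λ v → 0≤∑ λ w → 0≤x² (centredGram p G v w)) 0<t 𝔼≤ λ G X<t →
     sullivan-by-contradiction G λ D oriented noSullivan →
       absurd P p₀≤p p≤½-δ 0<ν G D oriented noSullivan (small-spread⇒cut G (<⇒≤ 0<η) (<⇒≤ X<t))
  where
  -- With c = η n² the error 30 n c equals (15/8) p₀² δ n³, an eighth of p₀² δ n³ below the main
  -- term 2 p₀² δ n³. That eighth is `gap`.
  η = p₀ * p₀ * δ * (ℤ.+ 1 / 16)
  0<η : 0ℚ < η
  0<η = 0<* (0<* (0<* 0<p₀ 0<p₀) 0<δ) (positive⁻¹ (ℤ.+ 1 / 16))
  -- The mean of `spread` is at most 6 n³ and the threshold is η⁴ n⁴, so Markov asks for 6 ≤ ε η⁴ n.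
  large = archimedean-* ⟦ 6 ⟧ (0<* 0<ε (0<* (0<* 0<η 0<η) (0<* 0<η 0<η)))
  regroup : ∀ ε η ν → ε * ((η * η) * (η * η)) * ν * (ν * ν * ν) ≡ ε * ((η * η * ν * ν) * (η * η) * (ν * ν))
  regroup = solve-∀ ℚ-ring
  absurd : ∀ {n p} → Probability p → p₀ ≤ p → p ≤ ½ - δ → 0ℚ < ⟦ n ⟧ → (G : Graph n) (D : Digraph n) → IsOrientation G D →
           (∀ v → ∣ Nout2 D v ∣ ℕ.< ∣ Nin D v ∣) → Cut p G (η * (⟦ n ⟧ * ⟦ n ⟧)) → ⊥
  absurd {n} {p} (0≤p , p≤1) p₀≤p p≤½-δ 0<ν G D oriented noSullivan cut = <-irrefl refl (<-≤-trans 0<gap gap≤0)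
    where
    open DenseOrientation G D oriented noSullivan 0≤p cut
    open Orientation G D oriented noSullivan
    c = η * (ν * ν)
    0<p = <-≤-trans 0<p₀ p₀≤p
    squares≤ : ⟦ 3 ⟧ * (squares - two * (ν * c)) ≤ p * p * (ν * ν * ν)
    squares≤ = *-cancelˡ-≤-pos p {{positive 0<p}} (≤-trans (≤-reflexive (move p (squares - two * (ν * c))))
      (≤-trans squares-upper (≤-reflexive (cube-* p ν))))
      where
      move : ∀ p x → p * (⟦ 3 ⟧ * x) ≡ ⟦ 3 ⟧ * (p * x)
      move = solve-∀ ℚ-ring
      cube-* : ∀ p ν → (p * ν) * (p * ν) * (p * ν) ≡ p * (p * p * (ν * ν * ν))
      cube-* = solve-∀ ℚ-ring
    upper : p * p * (1ℚ - two * p) * (ν * ν * ν) ≤ ⟦ 30 ⟧ * (ν * c)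
    upper = dense-inequality 0≤p p≤1 0≤⟦ n ⟧ (0≤* (<⇒≤ 0<η) (0≤* 0≤⟦ n ⟧ 0≤⟦ n ⟧)) walks-upper squares+walks-lower arcs-lower squares≤
    w = p₀ * p₀ * δ * (ν * ν * ν)
    gap = (ℤ.+ 1 / 8) * w
    0<gap : 0ℚ < gap
    0<gap = 0<* (positive⁻¹ (ℤ.+ 1 / 8)) (0<* (0<* (0<* 0<p₀ 0<p₀) 0<δ) (0<* (0<* 0<ν 0<ν) 0<ν))
    2δ≤ : two * δ ≤ 1ℚ - two * p
    2δ≤ = ≤-by (two * ((½ - δ) - p)) (0≤* 0≤2 (0≤y-x p≤½-δ)) (lemma p δ)
      where
      lemma : ∀ p δ → 1ℚ - two * p ≡ two * δ + two * ((½ - δ) - p)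
      lemma = solve-∀ ℚ-ring
    lower : p₀ * p₀ * (two * δ) * (ν * ν * ν) ≤ p * p * (1ℚ - two * p) * (ν * ν * ν)
    lower = *-monoʳ (0≤* (0≤* 0≤⟦ n ⟧ 0≤⟦ n ⟧) 0≤⟦ n ⟧)
      (*-mono (0≤* (<⇒≤ 0<p₀) (<⇒≤ 0<p₀)) (≤-trans (0≤* 0≤2 (<⇒≤ 0<δ)) 2δ≤)
              (*-mono (<⇒≤ 0<p₀) 0≤p p₀≤p p₀≤p) 2δ≤)
    gap≤0 : gap ≤ 0ℚ
    gap≤0 = ≤-trans (≤-reflexive (lemma p₀ δ ν)) (≤-trans (+-monoˡ-≤ (- (⟦ 30 ⟧ * (ν * c))) (≤-trans lower upper)) (≤-reflexive (+-inverseʳ (⟦ 30 ⟧ * (ν * c)))))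
      where
      lemma : ∀ q δ ν → (ℤ.+ 1 / 8) * (q * q * δ * (ν * ν * ν)) ≡ q * q * (two * δ) * (ν * ν * ν) - ⟦ 30 ⟧ * (ν * (q * q * δ * (ℤ.+ 1 / 16) * (ν * ν)))
      lemma = solve-∀ ℚ-ring

-- Monochromatic edges of 2-colourings

same : Bool → Bool → Bool
same true  b = b
same false b = not b

same-sym : ∀ a b → same a b ≡ same b a
same-sym true  true  = refl
same-sym true  false = refl
same-sym false true  = refl
same-sym false false = refl

count-same : ∀ {m} → Bool → Vec Bool m → ℕ
count-same b []      = 0
count-same b (s ∷ S) = (if same b s then 1 else 0) ℕ.+ count-same b S

pairs : ∀ {n} → Vec Bool n → ℕ
pairs []      = 0
pairs (b ∷ S) = count-same b S ℕ.+ pairs S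

rowMono : ∀ {m} → Bool → Vec Bool m → Vec Bool m → ℕ
rowMono b []      []      = 0
rowMono b (s ∷ S) (x ∷ r) = (if x ∧ same b s then 1 else 0) ℕ.+ rowMono b S r

mono : ∀ {n} → Graph n → Vec Bool n → ℕ
mono {zero}  G       []      = 0
mono {suc n} (g , r) (b ∷ S) = rowMono b S r ℕ.+ mono g S

row𝔼-½^mono : ∀ p m b (S : Vec Bool m) → row𝔼 p m (λ r → ½ ^ rowMono b S r) ≡ (p * ½ + (1ℚ - p)) ^ count-same b S
row𝔼-½^mono p zero    b []      = refl
row𝔼-½^mono p (suc m) b (s ∷ S) with same b s
... | true  = trans (row𝔼-cong p m (λ r → lemma p (½ ^ rowMono b S r)))
             (trans (row𝔼-*ˡ p m (p * ½ + (1ℚ - p)) _) (cong ((p * ½ + (1ℚ - p)) *_) (row𝔼-½^mono p m b S)))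
  where
  lemma : ∀ p x → p * (½ * x) + (1ℚ - p) * x ≡ (p * ½ + (1ℚ - p)) * x
  lemma = solve-∀ ℚ-ring
... | false = trans (row𝔼-cong p m (λ r → lemma p (½ ^ rowMono b S r))) (row𝔼-½^mono p m b S)
  where
  lemma : ∀ p x → p * x + (1ℚ - p) * x ≡ x
  lemma = solve-∀ ℚ-ring

-- The generating function of a binomial count at ½: every monochromatic pair contributes an
-- independent factor p · ½ + (1 - p), every other pair a factor 1.
𝔼-½^mono : ∀ p n (S : Vec Bool n) → 𝔼 p n (λ G → ½ ^ mono G S) ≡ (p * ½ + (1ℚ - p)) ^ pairs S
𝔼-½^mono p zero    []      = refl
𝔼-½^mono p (suc n) (b ∷ S) = begin
  _ ≡⟨ 𝔼-cong p n (λ g → trans (row𝔼-cong p n (λ r → trans (^-homo-* ½ (rowMono b S r) (mono g S)) (*-comm (½ ^ rowMono b S r) (½ ^ mono g S))))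
                        (trans (row𝔼-*ˡ p n (½ ^ mono g S) _) (trans (cong (½ ^ mono g S *_) (row𝔼-½^mono p n b S)) (*-comm (½ ^ mono g S) (θ ^ count-same b S))))) ⟩
  _ ≡⟨ 𝔼-*ˡ p n (θ ^ count-same b S) _ ⟩
  _ ≡⟨ cong (θ ^ count-same b S *_) (𝔼-½^mono p n S) ⟩
  _ ≡⟨ ^-homo-* θ (count-same b S) (pairs S) ⟨
  _ ∎
  where
  open ≡-Reasoning
  θ = p * ½ + (1ℚ - p)

𝔼-row𝔼-comm : ∀ p q n m (F : Graph n → Vec Bool m → ℚ) →
  𝔼 p n (λ G → row𝔼 q m (F G)) ≡ row𝔼 q m (λ r → 𝔼 p n (λ G → F G r))
𝔼-row𝔼-comm p q n zero    F = refl
𝔼-row𝔼-comm p q n (suc m) F = trans (𝔼-row𝔼-comm p q n m _)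
  (row𝔼-cong q m (λ v → trans (𝔼-+ p n _ _) (cong₂ _+_ (𝔼-*ˡ p n q _) (𝔼-*ˡ p n (1ℚ - q) _))))

-- A uniformly random colouring takes the place of a union bound over all colourings.
colouring : ∀ {n} → Graph n → ℚ
colouring {n} G = row𝔼 ½ n (λ S → ½ ^ mono G S)

½-probability : Probability ½
½-probability = 0≤½ , *≤* (ℤ.+≤+ (ℕ.s≤s ℕ.z≤n))

0≤^ : ∀ {x} → 0ℚ ≤ x → ∀ k → 0ℚ ≤ x ^ k
0≤^ 0≤x zero    = 0≤1
0≤^ 0≤x (suc k) = 0≤* 0≤x (0≤^ 0≤x k)

0<^ : ∀ {x} → 0ℚ < x → ∀ k → 0ℚ < x ^ k
0<^ 0<x zero    = positive⁻¹ 1ℚ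
0<^ 0<x (suc k) = 0<* 0<x (0<^ 0<x k)

^≤1 : ∀ {x} → 0ℚ ≤ x → x ≤ 1ℚ → ∀ k → x ^ k ≤ 1ℚ
^≤1 0≤x x≤1 zero    = ≤-refl
^≤1 0≤x x≤1 (suc k) = ≤-trans (*-mono 0≤x 0≤1 x≤1 (^≤1 0≤x x≤1 k)) (≤-reflexive (*-identityˡ 1ℚ))

^-antimono : ∀ {x} → 0ℚ ≤ x → x ≤ 1ℚ → ∀ {j k} → j ≤ℕ k → x ^ k ≤ x ^ j
^-antimono 0≤x x≤1 {k = k} ℕ.z≤n       = ^≤1 0≤x x≤1 k
^-antimono 0≤x x≤1         (ℕ.s≤s j≤k) = *-monoˡ 0≤x (^-antimono 0≤x x≤1 j≤k)

^-mono : ∀ {x y} → 0ℚ ≤ x → x ≤ y → ∀ k → x ^ k ≤ y ^ k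
^-mono 0≤x x≤y zero    = ≤-refl
^-mono 0≤x x≤y (suc k) = *-mono 0≤x (0≤^ (≤-trans 0≤x x≤y) k) x≤y (^-mono 0≤x x≤y k)

row𝔼-½-term : ∀ m (F : Vec Bool m → ℚ) → (∀ S → 0ℚ ≤ F S) → ∀ S → ½ ^ m * F S ≤ row𝔼 ½ m F
row𝔼-½-term zero    F 0≤F []      = ≤-reflexive (*-identityˡ (F []))
row𝔼-½-term (suc m) F 0≤F (b ∷ S) = ≤-trans
  (≤-trans (≤-reflexive (commute (½ ^ m) (F (b ∷ S)))) (*-monoˡ (0≤^ 0≤½ m) (half b)))
  (row𝔼-½-term m _ (λ v → 0≤+ (0≤* 0≤½ (0≤F (true ∷ v))) (0≤* 0≤½ (0≤F (false ∷ v)))) S)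
  where
  commute : ∀ x y → ½ * x * y ≡ x * (½ * y)
  commute = solve-∀ ℚ-ring
  half : ∀ b → ½ * F (b ∷ S) ≤ ½ * F (true ∷ S) + ½ * F (false ∷ S)
  half true  = ≤-by (½ * F (false ∷ S)) (0≤* 0≤½ (0≤F (false ∷ S))) refl
  half false = ≤-by (½ * F (true ∷ S)) (0≤* 0≤½ (0≤F (true ∷ S))) (+-comm (½ * F (true ∷ S)) _)

-- A colouring has weight 2^(-n) in the average. One with at most k monochromatic edges would alone
-- contribute 2^(-n-k).
colouring<⇒mono≥ : ∀ {n} (G : Graph n) {k} → colouring G < ½ ^ (n ℕ.+ k) → ∀ S → k ≤ℕ mono G S
colouring<⇒mono≥ {n} G {k} small S with k ℕ.≤? mono G S
... | yes k≤mono = k≤mono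
... | no  k≰mono = contradiction (<-≤-trans small (≤-trans (≤-reflexive (^-homo-* ½ n k))
  (≤-trans (*-monoˡ (0≤^ 0≤½ n) (^-antimono 0≤½ (proj₂ ½-probability) (ℕ.<⇒≤ (ℕ.≰⇒> k≰mono))))
           (row𝔼-½-term n _ (λ S → 0≤^ 0≤½ (mono G S)) S)))) (<-irrefl refl)

count-same-total : ∀ {n} (S : Vec Bool n) → count-same true S ℕ.+ count-same false S ≡ n
count-same-total []          = refl
count-same-total (true  ∷ S) = cong suc (count-same-total S)
count-same-total (false ∷ S) = trans (ℕ.+-suc (count-same true S) (count-same false S)) (cong suc (count-same-total S))

pairs-squares : ∀ {n} (S : Vec Bool n) → let s = count-same true S ; t = count-same false S in
  2 ℕ.* pairs S ℕ.+ (s ℕ.+ t) ≡ s ℕ.* s ℕ.+ t ℕ.* t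
pairs-squares []          = refl
pairs-squares (true  ∷ S) = trans (step₁ s t (pairs S)) (trans (cong (λ x → x ℕ.+ (2 ℕ.* s ℕ.+ 1)) (pairs-squares S)) (step₂ s t))
  where
  s = count-same true S
  t = count-same false S
  step₁ : ∀ s t q → 2 ℕ.* (s ℕ.+ q) ℕ.+ (1 ℕ.+ s ℕ.+ t) ≡ 2 ℕ.* q ℕ.+ (s ℕ.+ t) ℕ.+ (2 ℕ.* s ℕ.+ 1)
  step₁ = ℕ-solve-∀
  step₂ : ∀ s t → s ℕ.* s ℕ.+ t ℕ.* t ℕ.+ (2 ℕ.* s ℕ.+ 1) ≡ (1 ℕ.+ s) ℕ.* (1 ℕ.+ s) ℕ.+ t ℕ.* t
  step₂ = ℕ-solve-∀
pairs-squares (false ∷ S) = trans (step₁ s t (pairs S)) (trans (cong (λ x → x ℕ.+ (2 ℕ.* t ℕ.+ 1)) (pairs-squares S)) (step₂ s t))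
  where
  s = count-same true S
  t = count-same false S
  step₁ : ∀ s t q → 2 ℕ.* (t ℕ.+ q) ℕ.+ (s ℕ.+ (1 ℕ.+ t)) ≡ 2 ℕ.* q ℕ.+ (s ℕ.+ t) ℕ.+ (2 ℕ.* t ℕ.+ 1)
  step₁ = ℕ-solve-∀
  step₂ : ∀ s t → s ℕ.* s ℕ.+ t ℕ.* t ℕ.+ (2 ℕ.* t ℕ.+ 1) ≡ s ℕ.* s ℕ.+ (1 ℕ.+ t) ℕ.* (1 ℕ.+ t)
  step₂ = ℕ-solve-∀

square-sum≤ : ∀ s t → (s ℕ.+ t) ℕ.* (s ℕ.+ t) ≤ℕ 2 ℕ.* (s ℕ.* s ℕ.+ t ℕ.* t)
square-sum≤ s t with ℕ.≤-total s t
... | inj₁ s≤t rewrite sym (ℕ.m+[n∸m]≡n s≤t) = ordered s (t ℕ.∸ s)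
  where
  identity : ∀ s k → (s ℕ.+ (s ℕ.+ k)) ℕ.* (s ℕ.+ (s ℕ.+ k)) ℕ.+ k ℕ.* k ≡ 2 ℕ.* (s ℕ.* s ℕ.+ (s ℕ.+ k) ℕ.* (s ℕ.+ k))
  identity = ℕ-solve-∀
  ordered : ∀ s k → (s ℕ.+ (s ℕ.+ k)) ℕ.* (s ℕ.+ (s ℕ.+ k)) ≤ℕ 2 ℕ.* (s ℕ.* s ℕ.+ (s ℕ.+ k) ℕ.* (s ℕ.+ k))
  ordered s k = ℕ.≤-trans (ℕ.m≤m+n _ (k ℕ.* k)) (ℕ.≤-reflexive (identity s k))
... | inj₂ t≤s rewrite sym (ℕ.m+[n∸m]≡n t≤s) = ordered t (s ℕ.∸ t)
  where
  identity : ∀ s k → ((s ℕ.+ k) ℕ.+ s) ℕ.* ((s ℕ.+ k) ℕ.+ s) ℕ.+ k ℕ.* k ≡ 2 ℕ.* ((s ℕ.+ k) ℕ.* (s ℕ.+ k) ℕ.+ s ℕ.* s)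
  identity = ℕ-solve-∀
  ordered : ∀ s k → ((s ℕ.+ k) ℕ.+ s) ℕ.* ((s ℕ.+ k) ℕ.+ s) ≤ℕ 2 ℕ.* ((s ℕ.+ k) ℕ.* (s ℕ.+ k) ℕ.+ s ℕ.* s)
  ordered s k = ℕ.≤-trans (ℕ.m≤m+n _ (k ℕ.* k)) (ℕ.≤-reflexive (identity s k))

-- Balanced colour classes are the worst case; the bound n²/4 - n/2 is multiplied out to stay in the
-- naturals.
pairs-lower : ∀ {n} (S : Vec Bool n) → n ℕ.* n ≤ℕ 4 ℕ.* pairs S ℕ.+ 2 ℕ.* n
pairs-lower {n} S = ℕ.≤-trans (ℕ.≤-reflexive (cong (λ z → z ℕ.* z) (sym (count-same-total S))))
  (ℕ.≤-trans (square-sum≤ s t)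
  (ℕ.≤-reflexive (trans (cong (2 ℕ.*_) (sym (pairs-squares S))) (trans (regroup (pairs S) (s ℕ.+ t)) (cong (λ z → 4 ℕ.* pairs S ℕ.+ 2 ℕ.* z) (count-same-total S))))))
  where
  s = count-same true S
  t = count-same false S
  regroup : ∀ q z → 2 ℕ.* (2 ℕ.* q ℕ.+ z) ≡ 4 ℕ.* q ℕ.+ 2 ℕ.* z
  regroup = ℕ-solve-∀

-- The sparse regime

⟦rowMono⟧ : ∀ {m} b (S r : Vec Bool m) → ⟦ rowMono b S r ⟧ ≡ ∑[ j ] (ι (same b (lookup S j)) * ι (lookup r j))
⟦rowMono⟧ b []      []      = sym (∑-zero _)
⟦rowMono⟧ b (s ∷ S) (x ∷ r) = trans (⟦⟧-+ (if x ∧ same b s then 1 else 0) (rowMono b S r))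
  (trans (cong₂ _+_ (head x (same b s)) (⟦rowMono⟧ b S r)) (sym (∑-suc _)))
  where
  head : ∀ x y → ⟦ if x ∧ y then 1 else 0 ⟧ ≡ ι y * ι x
  head true  true  = refl
  head true  false = refl
  head false true  = refl
  head false false = refl

-- Stated for any splitting d of the edge indicators, since the induction removes vertex `zero` and
-- needs only the restriction of d to the rest. The diagonal terms are discarded.
⟦mono⟧≤ : ∀ {n} (G : Graph n) (S : Vec Bool n) (d : Fin n → Fin n → ℚ) →
  (∀ i j → 0ℚ ≤ d i j) → (∀ i j → d i j + d j i ≡ edge G i j) →
  ⟦ mono G S ⟧ ≤ ∑[ i ] ∑[ j ] (ι (same (lookup S i) (lookup S j)) * d i j)
⟦mono⟧≤ {zero}  G       []      d 0≤d dsum = ≤-reflexive (sym (∑-zero _))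
⟦mono⟧≤ {suc n} (g , r) (b ∷ S) d 0≤d dsum = begin
  ⟦ rowMono b S r ℕ.+ mono g S ⟧ ≡⟨ ⟦⟧-+ (rowMono b S r) (mono g S) ⟩
  ⟦ rowMono b S r ⟧ + ⟦ mono g S ⟧
    ≤⟨ +-mono-≤ (≤-reflexive row) (⟦mono⟧≤ g S (λ i j → d (suc i) (suc j)) (λ i j → 0≤d _ _) (λ i j → dsum (suc i) (suc j))) ⟩
  (X + Y) + Z ≤⟨ ≤-by d₀ (0≤* (0≤ι (same b b)) (0≤d zero zero)) (regroup d₀ X Y Z) ⟩
  (d₀ + X) + (Y + Z) ≡⟨ cong₂ _+_ (sym (∑-suc _)) (trans (sym (∑-+ _ _)) (∑-cong (λ i → sym (∑-suc _)))) ⟩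
  _ ≡⟨ ∑-suc _ ⟨
  _ ∎
  where
  open ≤-Reasoning
  σ : Fin (suc n) → Fin (suc n) → ℚ
  σ i j = ι (same (lookup (b ∷ S) i) (lookup (b ∷ S) j))
  d₀ = σ zero zero * d zero zero
  X = ∑[ j ] (σ zero (suc j) * d zero (suc j))
  Y = ∑[ i ] (σ (suc i) zero * d (suc i) zero)
  Z = ∑[ i ] ∑[ j ] (σ (suc i) (suc j) * d (suc i) (suc j))
  regroup : ∀ a x y z → (a + x) + (y + z) ≡ (x + y) + z + a
  regroup = solve-∀ ℚ-ring
  row : ⟦ rowMono b S r ⟧ ≡ X + Y
  row = trans (⟦rowMono⟧ b S r) (trans (∑-cong (λ j →
    trans (cong (ι (same b (lookup S j)) *_) (sym (dsum zero (suc j))))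
   (trans (*-distribˡ-+ (ι (same b (lookup S j))) (d zero (suc j)) (d (suc j) zero))
          (cong (λ z → ι (same b (lookup S j)) * d zero (suc j) + ι z * d (suc j) zero) (same-sym b (lookup S j)))))) (∑-+ _ _))

module SparseOrientation {n} (G : Graph n) (D : Digraph n) (oriented : IsOrientation G D)
                         (noSullivan : ∀ v → ∣ Nout2 D v ∣ ℕ.< ∣ Nin D v ∣) where
  open Orientation G D oriented noSullivan

  reached : Fin n → Fin n → ℚ
  reached v w = arc v w + second v w

  0≤reached : ∀ v w → 0ℚ ≤ reached v w
  0≤reached v w = 0≤+ (0≤arc v w) (0≤ι (lookup (Nout2 D v) w))

  walk≤cherry : ∀ v u w → arc v u * arc u w ≤ ι (neq v w) * (edge G v u * edge G w u)
  walk≤cherry v u w with v Fin.≟ w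
  ... | yes refl = ≤-reflexive (trans (arc-antisym v u) (sym (*-zeroˡ (edge G v u * edge G v u))))
  ... | no  _    = ≤-trans (*-mono (0≤arc v u) (0≤ι (adj G w u)) (arc≤edge v u) (≤-trans (arc≤edge u w) (≤-reflexive (cong ι (adj-sym G u w)))))
                           (≤-reflexive (sym (*-identityˡ (edge G v u * edge G w u))))

  walks≤ : walks ≤ ∑[ v ] ∑[ w ] (reached v w * (ι (neq v w) * codegree G v w))
  walks≤ = begin
    walks ≡⟨ walks≡∑ ⟩
    _ ≤⟨ ∑-mono (λ v → ∑-mono (λ u → ∑-mono (λ w → ≤-trans (walk≤ v u w) (*-monoʳ (0≤reached v w) (walk≤cherry v u w))))) ⟩
    ∑[ v ] ∑[ u ] ∑[ w ] (ι (neq v w) * (edge G v u * edge G w u) * reached v w) ≡⟨ ∑-cong (λ v → ∑-comm _) ⟩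
    ∑[ v ] ∑[ w ] ∑[ u ] (ι (neq v w) * (edge G v u * edge G w u) * reached v w)
      ≡⟨ ∑-cong (λ v → ∑-cong (λ w → trans (∑-*ʳ (reached v w) _) (trans (*-comm _ (reached v w)) (cong (reached v w *_) (∑-*ˡ (ι (neq v w)) _))))) ⟩
    _ ∎
    where open ≤-Reasoning

  -- 2 a c ≤ a² + c² on the reached pairs, with c the codegree. At most d⁺(v) + d⁻(v) vertices are
  -- reached from v, so the a² terms sum to a² times the total degree. The parameter a is later set
  -- to 2 κ n p.
  walks-upper : ∀ {a} → 0ℚ ≤ a → two * a * walks ≤ a * a * totalDegree G + codegreeEnergy G
  walks-upper {a} 0≤a = begin
    two * a * walks ≤⟨ 2a-walks≤ ⟩
    ∑[ v ] ∑[ w ] (a * a * reached v w + ι (neq v w) * (codegree G v w * codegree G v w)) ≡⟨ ∑∑-+ _ _ ⟩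
    ∑[ v ] ∑[ w ] (a * a * reached v w) + codegreeEnergy G
      ≡⟨ cong (_+ codegreeEnergy G) (trans (∑-cong (λ v → ∑-*ˡ (a * a) (reached v))) (∑-*ˡ (a * a) _)) ⟩
    a * a * ∑[ v ] ∑[ w ] reached v w + codegreeEnergy G ≤⟨ +-monoˡ-≤ (codegreeEnergy G) (*-monoˡ (0≤x² a) (∑-mono reached≤)) ⟩
    _ ∎
    where
    open ≤-Reasoning
    identity : ∀ a b i c → i * i ≡ i → a * a * b + i * (c * c) ≡ two * a * (b * (i * c)) + ((a * b - i * c) * (a * b - i * c) + a * a * (b * (1ℚ - b)))
    identity a b i c i²≡i = trans (cong (λ z → a * a * b + z * (c * c)) (sym i²≡i)) (expand a b i c)
      where
      expand : ∀ a b i c → a * a * b + i * i * (c * c) ≡ two * a * (b * (i * c)) + ((a * b - i * c) * (a * b - i * c) + a * a * (b * (1ℚ - b)))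
      expand = solve-∀ ℚ-ring
    ι-idem : ∀ b → ι b * ι b ≡ ι b
    ι-idem true  = refl
    ι-idem false = refl
    pointwise : ∀ v w → two * a * (reached v w * (ι (neq v w) * codegree G v w)) ≤ a * a * reached v w + ι (neq v w) * (codegree G v w * codegree G v w)
    pointwise v w = let b = reached v w ; i = ι (neq v w) ; c = codegree G v w in
      ≤-by ((a * b - i * c) * (a * b - i * c) + a * a * (b * (1ℚ - b)))
        (0≤+ (0≤x² (a * b - i * c)) (0≤* (0≤x² a) (0≤* (0≤reached v w) (0≤y-x (arc+second≤1 v w)))))
        (identity a b i c (ι-idem (neq v w)))
    2a-walks≤ : two * a * walks ≤ ∑[ v ] ∑[ w ] (a * a * reached v w + ι (neq v w) * (codegree G v w * codegree G v w))
    2a-walks≤ = ≤-trans (*-monoˡ (0≤* 0≤2 0≤a) walks≤)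
      (≤-trans (≤-reflexive (sym (trans (∑-cong (λ v → ∑-*ˡ (two * a) _)) (∑-*ˡ (two * a) _)))) (∑-mono (λ v → ∑-mono (pointwise v))))
    reached≤ : ∀ v → ∑[ w ] reached v w ≤ ∑[ w ] edge G v w
    reached≤ v = ≤-trans (≤-reflexive (∑-+ _ _)) (≤-trans (+-monoʳ-≤ (outdeg v) (∑-second≤ v))
      (≤-reflexive (trans (sym (∑-+ _ _)) (∑-cong (arc-sum v)))))

  -- Colour v by whether it sends out at most as many arcs as it receives; every monochromatic arc is
  -- then charged to an end at which it is of the minority kind.
  minority : Fin n → Bool
  minority v = ⌊ outdeg v ≤? indeg v ⌋

  -- This is min(d⁺(v), d⁻(v)).
  minorityDegree : Fin n → ℚ
  minorityDegree v = ι (minority v) * outdeg v + (1ℚ - ι (minority v)) * indeg v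

  mono-minority≤ : ⟦ mono G (tabulate minority) ⟧ ≤ ∑[ v ] minorityDegree v
  mono-minority≤ = begin
    ⟦ mono G (tabulate minority) ⟧ ≤⟨ ⟦mono⟧≤ G (tabulate minority) arc 0≤arc arc-sum ⟩
    _ ≡⟨ ∑-cong (λ i → ∑-cong (λ j → cong₂ (λ x y → ι (same x y) * arc i j) (Vec.lookup∘tabulate minority i) (Vec.lookup∘tabulate minority j))) ⟩
    ∑[ i ] ∑[ j ] (ι (same (minority i) (minority j)) * arc i j)
      ≤⟨ ∑-mono (λ i → ∑-mono (λ j → ≤-trans (*-monoʳ (0≤arc i j) (charge (minority i) (minority j)))
           (≤-reflexive (*-distribʳ-+ (arc i j) (ι (minority i)) (1ℚ - ι (minority j)))))) ⟩
    _ ≡⟨ ∑∑-+ _ _ ⟩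
    ∑[ i ] ∑[ j ] (ι (minority i) * arc i j) + ∑[ i ] ∑[ j ] ((1ℚ - ι (minority j)) * arc i j)
      ≡⟨ cong₂ _+_ (∑-cong (λ i → ∑-*ˡ (ι (minority i)) (arc i))) (trans (∑-comm _) (∑-cong (λ j → ∑-*ˡ (1ℚ - ι (minority j)) (λ i → arc i j)))) ⟩
    _ ≡⟨ ∑-+ _ _ ⟨
    _ ∎
    where
    open ≤-Reasoning
    charge : ∀ x y → ι (same x y) ≤ ι x + (1ℚ - ι y)
    charge true  true  = ≤-refl
    charge true  false = ≤-by two 0≤2 refl
    charge false true  = ≤-refl
    charge false false = ≤-refl

  walks-lower : ∀ {k} → k ≤ℕ mono G (tabulate minority) → ⟦ k ⟧ * ⟦ k ⟧ ≤ ⟦ n ⟧ * walks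
  walks-lower {k} k≤mono = begin
    ⟦ k ⟧ * ⟦ k ⟧ ≤⟨ *-mono 0≤⟦ k ⟧ (≤-trans 0≤⟦ k ⟧ k≤∑) k≤∑ k≤∑ ⟩
    ∑[ v ] minorityDegree v * ∑[ v ] minorityDegree v ≡⟨ cong₂ _*_ with-1 with-1 ⟩
    _ ≤⟨ cauchy-schwarz (λ _ → 1ℚ) minorityDegree ⟩
    ∑ {n} (λ _ → 1ℚ * 1ℚ) * ∑[ v ] (minorityDegree v * minorityDegree v) ≡⟨ cong (_* ∑[ v ] (minorityDegree v * minorityDegree v)) (∑-1 n) ⟩
    ⟦ n ⟧ * ∑[ v ] (minorityDegree v * minorityDegree v) ≤⟨ *-monoˡ 0≤⟦ n ⟧ (∑-mono square≤) ⟩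
    _ ∎
    where
    open ≤-Reasoning
    k≤∑ : ⟦ k ⟧ ≤ ∑[ v ] minorityDegree v
    k≤∑ = ≤-trans (⟦⟧-mono k≤mono) mono-minority≤
    with-1 : ∑[ v ] minorityDegree v ≡ ∑[ v ] (1ℚ * minorityDegree v)
    with-1 = ∑-cong (λ v → sym (*-identityˡ (minorityDegree v)))
    0≤outdeg : ∀ v → 0ℚ ≤ outdeg v
    0≤outdeg v = 0≤∑ (0≤arc v)
    0≤indeg : ∀ v → 0ℚ ≤ indeg v
    0≤indeg v = 0≤∑ (λ w → 0≤arc w v)
    first : ∀ x y → 1ℚ * x + (1ℚ - 1ℚ) * y ≡ x
    first = solve-∀ ℚ-ring
    other : ∀ x y → 0ℚ * x + (1ℚ - 0ℚ) * y ≡ y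
    other = solve-∀ ℚ-ring
    square≤ : ∀ v → minorityDegree v * minorityDegree v ≤ indeg v * outdeg v
    square≤ v with outdeg v ≤? indeg v
    ... | yes o≤i = ≤-trans (≤-reflexive (cong₂ _*_ (first (outdeg v) (indeg v)) (first (outdeg v) (indeg v)))) (*-monoʳ (0≤outdeg v) o≤i)
    ... | no  o≰i = ≤-trans (≤-reflexive (cong₂ _*_ (other (outdeg v) (indeg v)) (other (outdeg v) (indeg v)))) (*-monoˡ (0≤indeg v) (<⇒≤ (≰⇒> o≰i)))

-- A rational substitute for (1 - x)^m ≤ e^(-m x).
bernoulli-upper : ∀ {x} → 0ℚ ≤ x → x ≤ 1ℚ → ∀ m → (1ℚ - x) ^ m * (1ℚ + ⟦ m ⟧ * x) ≤ 1ℚ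
bernoulli-upper {x} 0≤x x≤1 zero    = ≤-reflexive (lemma x)
  where
  lemma : ∀ x → 1ℚ * (1ℚ + 0ℚ * x) ≡ 1ℚ
  lemma = solve-∀ ℚ-ring
bernoulli-upper {x} 0≤x x≤1 (suc m) = ≤-trans
  (≤-by ((1ℚ - x) ^ m * ((1ℚ + ⟦ m ⟧) * (x * x)))
        (0≤* (0≤^ (0≤y-x x≤1) m) (0≤* (0≤+ 0≤1 0≤⟦ m ⟧) (0≤x² x))) (lemma x ((1ℚ - x) ^ m) ⟦ m ⟧))
  (bernoulli-upper 0≤x x≤1 m)
  where
  lemma : ∀ x y m → y * (1ℚ + m * x) ≡ (1ℚ - x) * y * (1ℚ + (1ℚ + m) * x) + y * ((1ℚ + m) * (x * x))
  lemma = solve-∀ ℚ-ring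

½^*two^ : ∀ n → ½ ^ n * two ^ n ≡ 1ℚ
½^*two^ zero    = refl
½^*two^ (suc n) = trans (cancel (½ ^ n) (two ^ n)) (½^*two^ n)
  where
  cancel : ∀ x y → ½ * x * (two * y) ≡ x * y
  cancel = solve-∀ ℚ-ring

½^n*n≤1 : ∀ n → ½ ^ n * ⟦ n ⟧ ≤ 1ℚ
½^n*n≤1 n = ≤-trans (*-monoˡ (0≤^ 0≤½ n) (n≤2^n n)) (≤-reflexive (½^*two^ n))
  where
  1≤2^n : ∀ n → 1ℚ ≤ two ^ n
  1≤2^n zero    = ≤-refl
  1≤2^n (suc n) = ≤-trans (1≤2^n n) (≤-by (two ^ n) (≤-trans 0≤1 (1≤2^n n)) (double (two ^ n)))
    where
    double : ∀ x → two * x ≡ x + x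
    double = solve-∀ ℚ-ring
  n≤2^n : ∀ n → ⟦ n ⟧ ≤ two ^ n
  n≤2^n zero    = 0≤1
  n≤2^n (suc n) = ≤-trans (+-mono-≤ (1≤2^n n) (n≤2^n n)) (≤-reflexive (double (two ^ n)))
    where
    double : ∀ x → x + x ≡ two * x
    double = solve-∀ ℚ-ring

-- The resulting `suc m` is 2/p rounded up: 2 ≤ m p lets a block of m pairs halve an expectation, m
-- p ≤ 3 keeps blocks short. The search runs downwards from N, and p ≤ 1 limits the overshoot.
multiple-near-2 : ∀ {p} → p ≤ 1ℚ → ∀ N → two ≤ ⟦ N ⟧ * p → ∃[ m ] (two ≤ ⟦ suc m ⟧ * p × ⟦ suc m ⟧ * p ≤ ⟦ 3 ⟧)
multiple-near-2 {p} p≤1 zero    2≤0 = contradiction (≤-trans 2≤0 (≤-reflexive (*-zeroˡ p))) (λ { (*≤* (ℤ.+≤+ ())) })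
multiple-near-2 {p} p≤1 (suc N) 2≤N+1 with two ≤? ⟦ N ⟧ * p
... | yes 2≤N = multiple-near-2 p≤1 N 2≤N
... | no  2≰N = N , 2≤N+1 , ≤-trans (≤-reflexive (distrib p ⟦ N ⟧)) (+-mono-≤ p≤1 (<⇒≤ (≰⇒> 2≰N)))
  where
  distrib : ∀ p x → (1ℚ + x) * p ≡ p + x * p
  distrib = solve-∀ ℚ-ring

-- After `pairs-lower` and multiplication by 4 the claim is 32 m n + 16 m k + 8 n ≤ 4 n²; the
-- summands are at most n², 2 n² and n² by the three hypotheses.
pairs-enough : ∀ {n} m k → 8 ≤ℕ n → 32 ℕ.* m ≤ℕ n → k ℕ.* (8 ℕ.* m) ≤ℕ n ℕ.* n →
  ∀ (S : Vec Bool n) → m ℕ.* (n ℕ.+ (n ℕ.+ k)) ≤ℕ pairs S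
pairs-enough {n} m k 8≤n 32m≤n 8mk≤n² S = ℕ.*-cancelˡ-≤ 4 (ℕ.+-cancelʳ-≤ (2 ℕ.* n) _ _ (ℕ.≤-trans bound (pairs-lower S)))
  where
  identity : ∀ n m k → 4 ℕ.* (4 ℕ.* (m ℕ.* (n ℕ.+ (n ℕ.+ k))) ℕ.+ 2 ℕ.* n)
                     ≡ 32 ℕ.* m ℕ.* n ℕ.+ (k ℕ.* (8 ℕ.* m) ℕ.+ k ℕ.* (8 ℕ.* m)) ℕ.+ 8 ℕ.* n
  identity = ℕ-solve-∀
  four : ∀ x → x ℕ.+ (x ℕ.+ x) ℕ.+ x ≡ 4 ℕ.* x
  four = ℕ-solve-∀
  bound : 4 ℕ.* (m ℕ.* (n ℕ.+ (n ℕ.+ k))) ℕ.+ 2 ℕ.* n ≤ℕ n ℕ.* n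
  bound = ℕ.*-cancelˡ-≤ 4 (ℕ.≤-trans (ℕ.≤-reflexive (identity n m k))
    (ℕ.≤-trans (ℕ.+-mono-≤ (ℕ.+-mono-≤ (ℕ.*-monoˡ-≤ n 32m≤n) (ℕ.+-mono-≤ 8mk≤n² 8mk≤n²)) (ℕ.*-monoˡ-≤ n 8≤n))
               (ℕ.≤-reflexive (four (n ℕ.* n)))))

-- The monochromatic pairs contain k blocks of m, and each block halves the mean: (1 - p/2)^m ≤ 1 /
-- (1 + m p / 2) ≤ ½.
𝔼-colouring≤ : ∀ {p} → Probability p → ∀ n m k → two ≤ ⟦ m ⟧ * p → (∀ (S : Vec Bool n) → m ℕ.* k ≤ℕ pairs S) →
  𝔼 p n colouring ≤ ½ ^ k
𝔼-colouring≤ {p} (0≤p , p≤1) n m k 2≤mp enough = begin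
  𝔼 p n colouring ≡⟨ 𝔼-row𝔼-comm p ½ n n _ ⟩
  row𝔼 ½ n (λ S → 𝔼 p n (λ G → ½ ^ mono G S)) ≡⟨ row𝔼-cong ½ n (λ S → trans (𝔼-½^mono p n S) (cong (_^ pairs S) (θ-form p))) ⟩
  row𝔼 ½ n (λ S → (1ℚ - ½ * p) ^ pairs S) ≤⟨ row𝔼-mono ½-probability n (λ S → ^-antimono 0≤θ θ≤1 (enough S)) ⟩
  row𝔼 ½ n (λ S → (1ℚ - ½ * p) ^ (m ℕ.* k)) ≡⟨ row𝔼-const ½ n _ ⟩
  (1ℚ - ½ * p) ^ (m ℕ.* k) ≡⟨ ^-assocʳ (1ℚ - ½ * p) m k ⟨
  ((1ℚ - ½ * p) ^ m) ^ k ≤⟨ ^-mono (0≤^ 0≤θ m) θ^m≤½ k ⟩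
  ½ ^ k ∎
  where
  open ≤-Reasoning
  θ-form : ∀ p → p * ½ + (1ℚ - p) ≡ 1ℚ - ½ * p
  θ-form = solve-∀ ℚ-ring
  0≤½p : 0ℚ ≤ ½ * p
  0≤½p = 0≤* 0≤½ 0≤p
  ½p≤1 : ½ * p ≤ 1ℚ
  ½p≤1 = ≤-trans (*-monoˡ 0≤½ p≤1) (≤-by ½ 0≤½ refl)
  0≤θ = 0≤y-x ½p≤1
  θ≤1 : 1ℚ - ½ * p ≤ 1ℚ
  θ≤1 = ≤-by (½ * p) 0≤½p (cancel (½ * p))
    where
    cancel : ∀ x → 1ℚ ≡ 1ℚ - x + x
    cancel = solve-∀ ℚ-ring
  θ^m≤½ : (1ℚ - ½ * p) ^ m ≤ ½
  θ^m≤½ = ≤-trans (≤-by (½ * (y * (⟦ m ⟧ * p * ½ - 1ℚ))) (0≤* 0≤½ (0≤* (0≤^ 0≤θ m) 0≤mp/2-1)) (lemma y ⟦ m ⟧ p))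
                  (≤-trans (*-monoˡ 0≤½ (bernoulli-upper 0≤½p ½p≤1 m)) (≤-reflexive (*-identityʳ ½)))
    where
    y = (1ℚ - ½ * p) ^ m
    0≤mp/2-1 : 0ℚ ≤ ⟦ m ⟧ * p * ½ - 1ℚ
    0≤mp/2-1 = 0≤y-x (*-monoʳ 0≤½ 2≤mp)
    lemma : ∀ y m p → ½ * (y * (1ℚ + m * (½ * p))) ≡ y + ½ * (y * (m * p * ½ - 1ℚ))
    lemma = solve-∀ ℚ-ring

m≤[1+m/n]*n : ∀ m n .{{_ : ℕ.NonZero n}} → m ≤ℕ suc (m ℕ./ n) ℕ.* n
m≤[1+m/n]*n m n = ℕ.≤-trans (ℕ.≤-reflexive (ℕ.m≡m%n+[m/n]*n m n)) (ℕ.+-monoˡ-≤ (m ℕ./ n ℕ.* n) (ℕ.<⇒≤ (ℕ.m%n<n m n)))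

-- The constants: 48 comes from k ≥ ν² p / 48, so 2 a k² / ν ≥ κ ν⁴ p³ / 576 for a = 2 κ ν p, and κ = ε / 18432
-- makes half of ε times this threshold equal to 16 κ² ν⁴ p³, against a mean of at most 12 κ² ν⁴ p³.
sparse-moment≤ : ∀ {κ p ν} → 0ℚ ≤ p → 0ℚ ≤ ν → p ≤ ⟦ 4 ⟧ * (κ * κ) → 1ℚ ≤ ⟦ 4 ⟧ * (κ * κ) * (p * ν) →
  let a = two * (κ * (ν * p)) in
  a * a * (ν * (ν * p)) + ν * (ν * (ν * (p * p + ν * (p * p * (p * p)))))
  ≤ ½ * (κ * (ℤ.+ 18432 / 1)) * (κ * (ν * ν * ν * ν * (p * p * p)) * (ℤ.+ 1 / 576))
sparse-moment≤ {κ} {p} {ν} 0≤p 0≤ν p≤ 1≤ = ≤-by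
  (⟦ 4 ⟧ * (κ * κ) * (ν⁴ * p³) + ν³ * (p * p) * (⟦ 4 ⟧ * (κ * κ) * (p * ν) - 1ℚ) + ν⁴ * p³ * (⟦ 4 ⟧ * (κ * κ) - p))
  (0≤+ (0≤+ (0≤* (0≤* 0≤⟦ 4 ⟧ (0≤x² κ)) (0≤* 0≤ν⁴ 0≤p³)) (0≤* (0≤* 0≤ν³ (0≤x² p)) (0≤y-x 1≤)))
       (0≤* (0≤* 0≤ν⁴ 0≤p³) (0≤y-x p≤)))
  (identity κ p ν)
  where
  ν³ = ν * ν * ν
  ν⁴ = ν * ν * ν * ν
  p³ = p * p * p
  0≤ν³ = 0≤* (0≤x² ν) 0≤ν
  0≤ν⁴ = 0≤* 0≤ν³ 0≤ν
  0≤p³ = 0≤* (0≤x² p) 0≤p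
  identity : ∀ κ p ν →
    ½ * (κ * (ℤ.+ 18432 / 1)) * (κ * (ν * ν * ν * ν * (p * p * p)) * (ℤ.+ 1 / 576)) ≡
    (two * (κ * (ν * p))) * (two * (κ * (ν * p))) * (ν * (ν * p)) + ν * (ν * (ν * (p * p + ν * (p * p * (p * p)))))
    + (⟦ 4 ⟧ * (κ * κ) * (ν * ν * ν * ν * (p * p * p)) + ν * ν * ν * (p * p) * (⟦ 4 ⟧ * (κ * κ) * (p * ν) - 1ℚ) + ν * ν * ν * ν * (p * p * p) * (⟦ 4 ⟧ * (κ * κ) - p))
  identity = solve-∀ ℚ-ring

sparse-inequality : ∀ {κ p ν k W} → 0ℚ ≤ κ → 0ℚ ≤ p → 0ℚ < ν → 0ℚ ≤ k → ν * (ν * p) ≤ (ℤ.+ 48 / 1) * k → k * k ≤ ν * W →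
  κ * (ν * ν * ν * ν * (p * p * p)) * (ℤ.+ 1 / 576) ≤ two * (two * (κ * (ν * p))) * W
sparse-inequality {κ} {p} {ν} {k} {W} 0≤κ 0≤p 0<ν 0≤k k-large k²≤νW = *-cancelˡ-≤-pos ν {{positive 0<ν}} (begin
  ν * (κ * (ν * ν * ν * ν * (p * p * p)) * (ℤ.+ 1 / 576)) ≡⟨ left κ p ν ⟩
  κ * (ν * p) * (ν * (ν * p) * (ν * (ν * p))) * (ℤ.+ 1 / 576)
    ≤⟨ *-monoʳ 0≤1/576 (*-monoˡ (0≤* 0≤κ (0≤* 0≤ν 0≤p)) (*-mono (0≤* 0≤ν (0≤* 0≤ν 0≤p)) (0≤* 0≤48 0≤k) k-large k-large)) ⟩
  κ * (ν * p) * ((ℤ.+ 48 / 1) * k * ((ℤ.+ 48 / 1) * k)) * (ℤ.+ 1 / 576) ≡⟨ middle κ p ν k ⟩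
  two * (two * (κ * (ν * p))) * (k * k) ≤⟨ *-monoˡ (0≤* 0≤2 (0≤* 0≤2 (0≤* 0≤κ (0≤* 0≤ν 0≤p)))) k²≤νW ⟩
  two * (two * (κ * (ν * p))) * (ν * W) ≡⟨ right κ p ν W ⟩
  ν * (two * (two * (κ * (ν * p))) * W) ∎)
  where
  open ≤-Reasoning
  0≤ν = <⇒≤ 0<ν
  0≤48 : 0ℚ ≤ ℤ.+ 48 / 1
  0≤48 = nonNegative⁻¹ (ℤ.+ 48 / 1)
  0≤1/576 : 0ℚ ≤ ℤ.+ 1 / 576
  0≤1/576 = nonNegative⁻¹ (ℤ.+ 1 / 576)
  left : ∀ κ p ν → ν * (κ * (ν * ν * ν * ν * (p * p * p)) * (ℤ.+ 1 / 576)) ≡ κ * (ν * p) * (ν * (ν * p) * (ν * (ν * p))) * (ℤ.+ 1 / 576)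
  left = solve-∀ ℚ-ring
  middle : ∀ κ p ν k → κ * (ν * p) * ((ℤ.+ 48 / 1) * k * ((ℤ.+ 48 / 1) * k)) * (ℤ.+ 1 / 576) ≡ two * (two * (κ * (ν * p))) * (k * k)
  middle = solve-∀ ℚ-ring
  right : ∀ κ p ν W → two * (two * (κ * (ν * p))) * (ν * W) ≡ ν * (two * (two * (κ * (ν * p))) * W)
  right = solve-∀ ℚ-ring

-- Two events are needed at once: a small moment, and at least k monochromatic edges in every
-- colouring. `Y` handles both with one Markov inequality: T is scaled so that T · 2^(-n-k) = t, and
-- each summand of `Y` has mean at most ½ ε t. Asking for 2 n + k blocks instead of n + k leaves the
-- factor 2^(-n) that makes the second mean small.
sparse-almost-surely : ∀ {κ p n} m k → Probability p → 0ℚ < κ → 0ℚ < p → 0ℚ < ⟦ n ⟧ →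
  p ≤ ⟦ 4 ⟧ * (κ * κ) → 1ℚ ≤ ⟦ 4 ⟧ * (κ * κ) * (p * ⟦ n ⟧) →
  two ≤ ⟦ m ⟧ * p → (∀ (S : Vec Bool n) → m ℕ.* (n ℕ.+ (n ℕ.+ k)) ≤ℕ pairs S) →
  ⟦ n ⟧ * (⟦ n ⟧ * p) ≤ (ℤ.+ 48 / 1) * ⟦ k ⟧ → ½ ^ n ≤ ½ * (κ * (ℤ.+ 18432 / 1)) →
  AlmostSurelySullivan p n (κ * (ℤ.+ 18432 / 1))
sparse-almost-surely {κ} {p} {n} m k probability 0<κ 0<p 0<ν p-small pν-large 2≤mp enough k-large ½^n-small =
  almost-surely {ε = ε} probability Y 0≤Y 0<t 𝔼Y≤ good
  where
  ε = κ * (ℤ.+ 18432 / 1)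
  ν = ⟦ n ⟧
  a = two * (κ * (ν * p))
  t = κ * (ν * ν * ν * ν * (p * p * p)) * (ℤ.+ 1 / 576)
  T = t * two ^ (n ℕ.+ k)
  0≤p = <⇒≤ 0<p
  0≤κ = <⇒≤ 0<κ
  0<2 : 0ℚ < two
  0<2 = positive⁻¹ two
  0≤a : 0ℚ ≤ a
  0≤a = 0≤* (<⇒≤ 0<2) (0≤* 0≤κ (0≤* (<⇒≤ 0<ν) 0≤p))
  0<t : 0ℚ < t
  0<t = 0<* (0<* 0<κ (0<* (0<* (0<* (0<* 0<ν 0<ν) 0<ν) 0<ν) (0<* (0<* 0<p 0<p) 0<p))) (positive⁻¹ (ℤ.+ 1 / 576))
  0<T : 0ℚ < T
  0<T = 0<* 0<t (0<^ 0<2 (n ℕ.+ k))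
  moment : Graph n → ℚ
  moment G = a * a * totalDegree G + codegreeEnergy G
  Y : Graph n → ℚ
  Y G = moment G + T * colouring G
  0≤moment : ∀ G → 0ℚ ≤ moment G
  0≤moment G = 0≤+ (0≤* (0≤x² a) (0≤∑ λ i → 0≤∑ λ j → 0≤ι (adj G i j)))
                   (0≤∑ λ v → 0≤∑ λ w → 0≤* (0≤ι (neq v w)) (0≤x² (codegree G v w)))
  0≤colouring : ∀ G → 0ℚ ≤ T * colouring G
  0≤colouring G = 0≤* (<⇒≤ 0<T) (≤-trans (≤-reflexive (sym (row𝔼-const ½ n 0ℚ))) (row𝔼-mono ½-probability n (λ S → 0≤^ 0≤½ (mono G S))))
  0≤Y : ∀ G → 0ℚ ≤ Y G
  0≤Y G = 0≤+ (0≤moment G) (0≤colouring G)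
  𝔼moment≤ : 𝔼 p n moment ≤ ½ * ε * t
  𝔼moment≤ = ≤-trans (≤-reflexive (trans (𝔼-+ p n _ _) (cong (_+ 𝔼 p n codegreeEnergy) (𝔼-*ˡ p n (a * a) totalDegree))))
    (≤-trans (+-mono-≤ (*-monoˡ (0≤x² a) (𝔼-totalDegree≤ probability n)) (𝔼-codegreeEnergy≤ probability n))
             (sparse-moment≤ {κ} 0≤p (<⇒≤ 0<ν) p-small pν-large))
  𝔼colouring≤ : T * 𝔼 p n colouring ≤ ½ * ε * t
  𝔼colouring≤ = begin
    T * 𝔼 p n colouring ≤⟨ *-monoˡ (<⇒≤ 0<T) (𝔼-colouring≤ probability n m (n ℕ.+ (n ℕ.+ k)) 2≤mp enough) ⟩
    T * ½ ^ (n ℕ.+ (n ℕ.+ k)) ≡⟨ cong (T *_) (^-homo-* ½ n (n ℕ.+ k)) ⟩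
    T * (½ ^ n * ½ ^ (n ℕ.+ k)) ≡⟨ regroup t (two ^ (n ℕ.+ k)) (½ ^ n) (½ ^ (n ℕ.+ k)) ⟩
    ½ ^ n * t * (½ ^ (n ℕ.+ k) * two ^ (n ℕ.+ k)) ≡⟨ cong (½ ^ n * t *_) (½^*two^ (n ℕ.+ k)) ⟩
    ½ ^ n * t * 1ℚ ≡⟨ *-identityʳ (½ ^ n * t) ⟩
    ½ ^ n * t ≤⟨ *-monoʳ (<⇒≤ 0<t) ½^n-small ⟩
    ½ * ε * t ∎
    where
    open ≤-Reasoning
    regroup : ∀ t x y z → t * x * (y * z) ≡ y * t * (z * x)
    regroup = solve-∀ ℚ-ring
  𝔼Y≤ : 𝔼 p n Y ≤ ε * t
  𝔼Y≤ = ≤-trans (≤-reflexive (trans (𝔼-+ p n moment _) (cong (𝔼 p n moment +_) (𝔼-*ˡ p n T colouring))))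
       (≤-trans (+-mono-≤ 𝔼moment≤ 𝔼colouring≤) (≤-reflexive (halves ε t)))
    where
    halves : ∀ ε t → ½ * ε * t + ½ * ε * t ≡ ε * t
    halves = solve-∀ ℚ-ring
  good : ∀ G → Y G < t → EveryOrientationHasSullivan G
  good G Y<t = sullivan-by-contradiction G λ D oriented noSullivan →
    let open SparseOrientation G D oriented noSullivan
        open Orientation G D oriented noSullivan in
    <-irrefl refl (<-≤-trans (≤-<-trans (walks-upper 0≤a) moment<t)
      (sparse-inequality 0≤κ 0≤p 0<ν 0≤⟦ k ⟧ k-large (walks-lower (colouring<⇒mono≥ G colouring< (tabulate minority)))))
    where
    moment<t : moment G < t
    moment<t = ≤-<-trans (≤-by (T * colouring G) (0≤colouring G) refl) Y<t
    T*½^ : T * ½ ^ (n ℕ.+ k) ≡ t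
    T*½^ = trans (regroup t (two ^ (n ℕ.+ k)) (½ ^ (n ℕ.+ k))) (trans (cong (t *_) (½^*two^ (n ℕ.+ k))) (*-identityʳ t))
      where
      regroup : ∀ t x y → t * x * y ≡ t * (y * x)
      regroup = solve-∀ ℚ-ring
    colouring< : colouring G < ½ ^ (n ℕ.+ k)
    colouring< = *-cancelˡ-<-nonNeg T {{nonNegative (<⇒≤ 0<T)}} (<-≤-trans
      (≤-<-trans (≤-by (moment G) (0≤moment G) (+-comm (moment G) (T * colouring G))) Y<t) (≤-reflexive (sym T*½^)))

sparse-regime : ∀ {κ} → 0ℚ < κ → ∀ K → 96 ≤ℕ K → 1ℚ ≤ ⟦ 4 ⟧ * (κ * κ) * ⟦ K ⟧ →
  ∃[ N ] (∀ n → N ≤ℕ n → ∀ {p} → Probability p → ⟦ K ⟧ ≤ p * ⟦ n ⟧ → p ≤ ⟦ 4 ⟧ * (κ * κ) →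
          AlmostSurelySullivan p n (κ * (ℤ.+ 18432 / 1)))
sparse-regime {κ} 0<κ K 96≤K K-large = 8 ℕ.+ proj₁ large , λ n N≤n P K≤pν p≤ →
  finish n (ℕ.≤-trans (ℕ.m≤m+n 8 _) N≤n) (proj₂ large n (ℕ.≤-trans (ℕ.m≤n+m _ 8) N≤n)) P K≤pν p≤
  where
  ε = κ * (ℤ.+ 18432 / 1)
  0<ε : 0ℚ < ε
  0<ε = 0<* 0<κ (positive⁻¹ (ℤ.+ 18432 / 1))
  large = archimedean-* two 0<ε
  finish : ∀ n → 8 ≤ℕ n → two ≤ ε * ⟦ n ⟧ → ∀ {p} → Probability p → ⟦ K ⟧ ≤ p * ⟦ n ⟧ → p ≤ ⟦ 4 ⟧ * (κ * κ) → AlmostSurelySullivan p n ε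
  finish n 8≤n 2≤εn {p} P@(0≤p , p≤1) K≤pν p≤ =
    sparse-almost-surely {κ} m k P 0<κ 0<p 0<ν p≤ (≤-trans K-large (*-monoˡ (0≤* 0≤⟦ 4 ⟧ (0≤x² κ)) K≤pν))
      (proj₁ (proj₂ near)) (pairs-enough m k 8≤n 32m≤n (ℕ.m/n*n≤m (n ℕ.* n) (8 ℕ.* m))) k-large ½^n-small
    where
    ν = ⟦ n ⟧
    0<ν : 0ℚ < ν
    0<ν = <-≤-trans (positive⁻¹ ⟦ 8 ⟧) (⟦⟧-mono 8≤n)
    96≤pν : ⟦ 96 ⟧ ≤ p * ν
    96≤pν = ≤-trans (⟦⟧-mono 96≤K) K≤pν
    0<p : 0ℚ < p
    0<p = *-cancelʳ-<-nonNeg ν {{nonNegative (<⇒≤ 0<ν)}} (≤-<-trans (≤-reflexive (*-zeroˡ ν)) (<-≤-trans (positive⁻¹ ⟦ 96 ⟧) 96≤pν))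
    near = multiple-near-2 p≤1 n (≤-trans (⟦⟧-mono {2} {96} (ℕ.s≤s (ℕ.s≤s ℕ.z≤n))) (≤-trans 96≤pν (≤-reflexive (*-comm p ν))))
    m = suc (proj₁ near)
    mp≤3 : ⟦ m ⟧ * p ≤ ⟦ 3 ⟧
    mp≤3 = proj₂ (proj₂ near)
    k = (n ℕ.* n) ℕ./ (8 ℕ.* m)
    -- The origin of 96 = 3 · 32: 96 m ≤ p ν m ≤ 3 ν.
    32m≤n : 32 ℕ.* m ≤ℕ n
    32m≤n = ℕ.*-cancelˡ-≤ 3 (ℕ.≤-trans (ℕ.≤-reflexive (sym (ℕ.*-assoc 3 32 m))) (⟦⟧-cancel-≤ (begin
      ⟦ 96 ℕ.* m ⟧ ≡⟨ ⟦⟧-* 96 m ⟩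
      ⟦ 96 ⟧ * ⟦ m ⟧ ≤⟨ *-monoʳ 0≤⟦ m ⟧ 96≤pν ⟩
      p * ν * ⟦ m ⟧ ≡⟨ regroup p ν ⟦ m ⟧ ⟩
      ⟦ m ⟧ * p * ν ≤⟨ *-monoʳ (<⇒≤ 0<ν) mp≤3 ⟩
      ⟦ 3 ⟧ * ν ≡⟨ ⟦⟧-* 3 n ⟨
      ⟦ 3 ℕ.* n ⟧ ∎)))
      where
      open ≤-Reasoning
      regroup : ∀ p ν m → p * ν * m ≡ m * p * ν
      regroup = solve-∀ ℚ-ring
    ν²p≤ : ν * (ν * p) ≤ ⟦ 24 ⟧ * (1ℚ + ⟦ k ⟧)
    ν²p≤ = begin
      ν * (ν * p) ≡⟨ *-assoc ν ν p ⟨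
      ν * ν * p ≡⟨ cong (_* p) (⟦⟧-* n n) ⟨
      ⟦ n ℕ.* n ⟧ * p ≤⟨ *-monoʳ 0≤p (⟦⟧-mono (m≤[1+m/n]*n (n ℕ.* n) (8 ℕ.* m))) ⟩
      ⟦ suc k ℕ.* (8 ℕ.* m) ⟧ * p ≡⟨ cong (_* p) (trans (⟦⟧-* (suc k) (8 ℕ.* m)) (cong (⟦ suc k ⟧ *_) (⟦⟧-* 8 m))) ⟩
      ⟦ suc k ⟧ * (⟦ 8 ⟧ * ⟦ m ⟧) * p ≡⟨ regroup ⟦ suc k ⟧ ⟦ m ⟧ p ⟩
      ⟦ 8 ⟧ * ⟦ suc k ⟧ * (⟦ m ⟧ * p) ≤⟨ *-monoˡ (0≤* 0≤⟦ 8 ⟧ 0≤⟦ suc k ⟧) mp≤3 ⟩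
      ⟦ 8 ⟧ * ⟦ suc k ⟧ * ⟦ 3 ⟧ ≡⟨ collect ⟦ suc k ⟧ ⟩
      ⟦ 24 ⟧ * ⟦ suc k ⟧ ∎
      where
      open ≤-Reasoning
      regroup : ∀ k m p → k * (⟦ 8 ⟧ * m) * p ≡ ⟦ 8 ⟧ * k * (m * p)
      regroup = solve-∀ ℚ-ring
      collect : ∀ k → ⟦ 8 ⟧ * k * ⟦ 3 ⟧ ≡ ⟦ 24 ⟧ * k
      collect = solve-∀ ℚ-ring
    48≤ν²p : ⟦ 48 ⟧ ≤ ν * (ν * p)
    48≤ν²p = ≤-trans (⟦⟧-mono {48} {96} (ℕ.m≤m+n 48 48)) (≤-trans 96≤pν (≤-trans (≤-reflexive (swap p ν))
      (*-monoʳ (0≤* (<⇒≤ 0<ν) 0≤p) (≤-trans (≤-reflexive (sym (+-identityʳ 1ℚ))) (⟦⟧-mono {1} (ℕ.≤-trans (ℕ.s≤s ℕ.z≤n) 8≤n))))))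
      where
      swap : ∀ p ν → p * ν ≡ 1ℚ * (ν * p)
      swap = solve-∀ ℚ-ring
    k-large : ν * (ν * p) ≤ (ℤ.+ 48 / 1) * ⟦ k ⟧
    k-large = ≤-by (two * (⟦ 24 ⟧ * (1ℚ + ⟦ k ⟧) - ν * (ν * p)) + (ν * (ν * p) - ⟦ 48 ⟧))
      (0≤+ (0≤* 0≤2 (0≤y-x ν²p≤)) (0≤y-x 48≤ν²p)) (identity (ν * (ν * p)) ⟦ k ⟧)
      where
      identity : ∀ x k → (ℤ.+ 48 / 1) * k ≡ x + (two * (⟦ 24 ⟧ * (1ℚ + k) - x) + (x - ⟦ 48 ⟧))
      identity = solve-∀ ℚ-ring
    ½^n-small : ½ ^ n ≤ ½ * ε
    ½^n-small = begin
      ½ ^ n ≡⟨ halve (½ ^ n) ⟩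
      ½ * (½ ^ n * two) ≤⟨ *-monoˡ 0≤½ (*-monoˡ (0≤^ 0≤½ n) 2≤εn) ⟩
      ½ * (½ ^ n * (ε * ν)) ≡⟨ regroup (½ ^ n) ε ν ⟩
      ½ * (ε * (½ ^ n * ν)) ≤⟨ *-monoˡ 0≤½ (*-monoˡ (<⇒≤ 0<ε) (½^n*n≤1 n)) ⟩
      ½ * (ε * 1ℚ) ≡⟨ cong (½ *_) (*-identityʳ ε) ⟩
      ½ * ε ∎
      where
      open ≤-Reasoning
      halve : ∀ x → x ≡ ½ * (x * two)
      halve = solve-∀ ℚ-ring
      regroup : ∀ x ε ν → ½ * (x * (ε * ν)) ≡ ½ * (ε * (x * ν))
      regroup = solve-∀ ℚ-ring

-- The isolated-vertex regime

emptyRow : ∀ {m} → Vec Bool m → ℚ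
emptyRow []      = 1ℚ
emptyRow (x ∷ r) = (1ℚ - ι x) * emptyRow r

-- The indicator is a product over the incident pairs, so that its mean factors; `isolated-idem`
-- expresses that its values are 0 and 1.
isolated : ∀ {n} → Graph n → Fin n → ℚ
isolated {suc n} (g , r) zero    = emptyRow r
isolated {suc n} (g , r) (suc i) = (1ℚ - ι (lookup r i)) * isolated g i

co-ι-idem : ∀ b → (1ℚ - ι b) * (1ℚ - ι b) ≡ 1ℚ - ι b
co-ι-idem true  = refl
co-ι-idem false = refl

co-ι-ι : ∀ b → (1ℚ - ι b) * ι b ≡ 0ℚ
co-ι-ι true  = refl
co-ι-ι false = refl

*-interchange : ∀ a b c d → (a * b) * (c * d) ≡ (a * c) * (b * d)
*-interchange = solve-∀ ℚ-ring

emptyRow-absorb : ∀ {m} (r : Vec Bool m) j → emptyRow r * (1ℚ - ι (lookup r j)) ≡ emptyRow r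
emptyRow-absorb (x ∷ r) zero    = trans (swap (1ℚ - ι x) (emptyRow r)) (cong (_* emptyRow r) (co-ι-idem x))
  where
  swap : ∀ a b → (a * b) * a ≡ (a * a) * b
  swap = solve-∀ ℚ-ring
emptyRow-absorb (x ∷ r) (suc j) = trans (*-assoc (1ℚ - ι x) (emptyRow r) _) (cong ((1ℚ - ι x) *_) (emptyRow-absorb r j))

emptyRow-idem : ∀ {m} (r : Vec Bool m) → emptyRow r * emptyRow r ≡ emptyRow r
emptyRow-idem []      = refl
emptyRow-idem (x ∷ r) = trans (*-interchange (1ℚ - ι x) (emptyRow r) (1ℚ - ι x) (emptyRow r)) (cong₂ _*_ (co-ι-idem x) (emptyRow-idem r))

isolated-idem : ∀ {n} (G : Graph n) i → isolated G i * isolated G i ≡ isolated G i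
isolated-idem {suc n} (g , r) zero    = emptyRow-idem r
isolated-idem {suc n} (g , r) (suc i) = trans (*-interchange (1ℚ - ι (lookup r i)) (isolated g i) (1ℚ - ι (lookup r i)) (isolated g i))
  (cong₂ _*_ (co-ι-idem (lookup r i)) (isolated-idem g i))

0≤isolated : ∀ {n} (G : Graph n) i → 0ℚ ≤ isolated G i
0≤isolated G i = ≤-trans (0≤x² (isolated G i)) (≤-reflexive (isolated-idem G i))

isolated-edge : ∀ {n} (G : Graph n) i j → isolated G i * edge G i j ≡ 0ℚ
isolated-edge {suc n} (g , r) zero    zero    = *-zeroʳ (emptyRow r)
isolated-edge {suc n} (g , r) zero    (suc j) = trans (cong (_* ι (lookup r j)) (sym (emptyRow-absorb r j)))
  (trans (*-assoc (emptyRow r) (1ℚ - ι (lookup r j)) (ι (lookup r j))) (trans (cong (emptyRow r *_) (co-ι-ι (lookup r j))) (*-zeroʳ (emptyRow r))))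
isolated-edge {suc n} (g , r) (suc i) zero    = trans (swap (1ℚ - ι (lookup r i)) (isolated g i) (ι (lookup r i)))
  (trans (cong (_* isolated g i) (co-ι-ι (lookup r i))) (*-zeroˡ (isolated g i)))
  where
  swap : ∀ a b c → (a * b) * c ≡ (a * c) * b
  swap = solve-∀ ℚ-ring
isolated-edge {suc n} (g , r) (suc i) (suc j) = trans (*-assoc (1ℚ - ι (lookup r i)) (isolated g i) (edge g i j))
  (trans (cong ((1ℚ - ι (lookup r i)) *_) (isolated-edge g i j)) (*-zeroʳ (1ℚ - ι (lookup r i))))

row𝔼-emptyRow : ∀ p m → row𝔼 p m emptyRow ≡ (1ℚ - p) ^ m
row𝔼-emptyRow p zero    = refl
row𝔼-emptyRow p (suc m) = trans (row𝔼-cong p m (λ r → lemma p (emptyRow r)))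
  (trans (row𝔼-*ˡ p m (1ℚ - p) emptyRow) (cong ((1ℚ - p) *_) (row𝔼-emptyRow p m)))
  where
  lemma : ∀ p x → p * ((1ℚ - 1ℚ) * x) + (1ℚ - p) * ((1ℚ - 0ℚ) * x) ≡ (1ℚ - p) * x
  lemma = solve-∀ ℚ-ring

row𝔼-absent : ∀ p m (i : Fin m) → row𝔼 p m (λ r → 1ℚ - ι (lookup r i)) ≡ 1ℚ - p
row𝔼-absent p (suc m) zero    = trans (row𝔼-cong p m (λ _ → lemma p)) (row𝔼-const p m (1ℚ - p))
  where
  lemma : ∀ p → p * (1ℚ - 1ℚ) + (1ℚ - p) * (1ℚ - 0ℚ) ≡ 1ℚ - p
  lemma = solve-∀ ℚ-ring
row𝔼-absent p (suc m) (suc i) = trans (row𝔼-cong p m (λ r → lemma p (1ℚ - ι (lookup r i)))) (row𝔼-absent p m i)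
  where
  lemma : ∀ p x → p * x + (1ℚ - p) * x ≡ x
  lemma = solve-∀ ℚ-ring

row𝔼-absent₂ : ∀ p m (i j : Fin m) → i ≢ j →
  row𝔼 p m (λ r → (1ℚ - ι (lookup r i)) * (1ℚ - ι (lookup r j))) ≡ (1ℚ - p) * (1ℚ - p)
row𝔼-absent₂ p (suc m) zero    zero    i≢j = contradiction refl i≢j
row𝔼-absent₂ p (suc m) zero    (suc j) i≢j = trans (row𝔼-cong p m (λ r → lemma p (1ℚ - ι (lookup r j))))
  (trans (row𝔼-*ˡ p m (1ℚ - p) _) (cong ((1ℚ - p) *_) (row𝔼-absent p m j)))
  where
  lemma : ∀ p x → p * ((1ℚ - 1ℚ) * x) + (1ℚ - p) * ((1ℚ - 0ℚ) * x) ≡ (1ℚ - p) * x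
  lemma = solve-∀ ℚ-ring
row𝔼-absent₂ p (suc m) (suc i) zero    i≢j = trans (row𝔼-cong p (suc m) (λ r → *-comm (1ℚ - ι (lookup r (suc i))) (1ℚ - ι (lookup r zero))))
  (row𝔼-absent₂ p (suc m) zero (suc i) (i≢j ∘ sym))
row𝔼-absent₂ p (suc m) (suc i) (suc j) i≢j = trans (row𝔼-cong p m (λ r → lemma p ((1ℚ - ι (lookup r i)) * (1ℚ - ι (lookup r j)))))
  (row𝔼-absent₂ p m i j (i≢j ∘ cong suc))
  where
  lemma : ∀ p x → p * x + (1ℚ - p) * x ≡ x
  lemma = solve-∀ ℚ-ring

𝔼-isolated : ∀ p n (i : Fin (suc n)) → 𝔼 p (suc n) (λ G → isolated G i) ≡ (1ℚ - p) ^ n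
𝔼-isolated p n       zero    = trans (𝔼-cong p n (λ _ → row𝔼-emptyRow p n)) (𝔼-const p n _)
𝔼-isolated p (suc n) (suc i) = trans
  (𝔼-cong p (suc n) (λ g → trans (row𝔼-cong p (suc n) (λ r → *-comm (1ℚ - ι (lookup r i)) (isolated g i)))
    (trans (row𝔼-*ˡ p (suc n) (isolated g i) (λ r → 1ℚ - ι (lookup r i))) (trans (cong (isolated g i *_) (row𝔼-absent p (suc n) i)) (*-comm (isolated g i) (1ℚ - p))))))
  (trans (𝔼-*ˡ p (suc n) (1ℚ - p) (λ g → isolated g i)) (cong ((1ℚ - p) *_) (𝔼-isolated p n i)))

-- The factor 1 - p accounts for the pair i j, which both isolation events forbid.
𝔼-isolated₂ : ∀ p n (i j : Fin (suc n)) → i ≢ j →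
  (1ℚ - p) * 𝔼 p (suc n) (λ G → isolated G i * isolated G j) ≡ (1ℚ - p) ^ n * (1ℚ - p) ^ n
𝔼-isolated₂ p n       zero    zero    i≢j = contradiction refl i≢j
𝔼-isolated₂ p (suc n) zero    (suc j) i≢j = begin
  (1ℚ - p) * 𝔼 p (suc n) (λ g → row𝔼 p (suc n) (λ r → emptyRow r * ((1ℚ - ι (lookup r j)) * isolated g j)))
    ≡⟨ cong ((1ℚ - p) *_) (𝔼-cong p (suc n) (λ g → trans (row𝔼-cong p (suc n) (λ r →
         trans (sym (*-assoc (emptyRow r) (1ℚ - ι (lookup r j)) (isolated g j)))
        (trans (cong (_* isolated g j) (emptyRow-absorb r j)) (*-comm (emptyRow r) (isolated g j)))))
        (trans (row𝔼-*ˡ p (suc n) (isolated g j) emptyRow) (trans (cong (isolated g j *_) (row𝔼-emptyRow p (suc n))) (*-comm (isolated g j) q))))) ⟩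
  (1ℚ - p) * 𝔼 p (suc n) (λ g → q * isolated g j)
    ≡⟨ cong ((1ℚ - p) *_) (trans (𝔼-*ˡ p (suc n) q (λ g → isolated g j)) (cong (q *_) (𝔼-isolated p n j))) ⟩
  (1ℚ - p) * (q * (1ℚ - p) ^ n) ≡⟨ regroup (1ℚ - p) q ((1ℚ - p) ^ n) ⟩
  q * q ∎
  where
  open ≡-Reasoning
  q = (1ℚ - p) ^ suc n
  regroup : ∀ a b c → a * (b * c) ≡ b * (a * c)
  regroup = solve-∀ ℚ-ring
𝔼-isolated₂ p (suc n) (suc i) zero    i≢j = trans
  (cong ((1ℚ - p) *_) (𝔼-cong p (suc (suc n)) (λ G → *-comm (isolated G (suc i)) (isolated G zero))))
  (𝔼-isolated₂ p (suc n) zero (suc i) (i≢j ∘ sym))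
𝔼-isolated₂ p (suc n) (suc i) (suc j) i≢j = begin
  (1ℚ - p) * 𝔼 p (suc n) (λ g → row𝔼 p (suc n) (λ r → ((1ℚ - ι (lookup r i)) * isolated g i) * ((1ℚ - ι (lookup r j)) * isolated g j)))
    ≡⟨ cong ((1ℚ - p) *_) (𝔼-cong p (suc n) (λ g → trans (row𝔼-cong p (suc n) (λ r → regroup (1ℚ - ι (lookup r i)) (isolated g i) (1ℚ - ι (lookup r j)) (isolated g j)))
         (trans (row𝔼-*ˡ p (suc n) (isolated g i * isolated g j) (λ r → (1ℚ - ι (lookup r i)) * (1ℚ - ι (lookup r j))))
         (trans (cong (isolated g i * isolated g j *_) (row𝔼-absent₂ p (suc n) i j (i≢j ∘ cong suc)))
                (*-comm (isolated g i * isolated g j) ((1ℚ - p) * (1ℚ - p))))))) ⟩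
  (1ℚ - p) * 𝔼 p (suc n) (λ g → (1ℚ - p) * (1ℚ - p) * (isolated g i * isolated g j))
    ≡⟨ cong ((1ℚ - p) *_) (𝔼-*ˡ p (suc n) ((1ℚ - p) * (1ℚ - p)) _) ⟩
  (1ℚ - p) * ((1ℚ - p) * (1ℚ - p) * joint) ≡⟨ rotate (1ℚ - p) joint ⟩
  (1ℚ - p) * (1ℚ - p) * ((1ℚ - p) * joint) ≡⟨ cong ((1ℚ - p) * (1ℚ - p) *_) (𝔼-isolated₂ p n i j (i≢j ∘ cong suc)) ⟩
  (1ℚ - p) * (1ℚ - p) * ((1ℚ - p) ^ n * (1ℚ - p) ^ n) ≡⟨ *-interchange (1ℚ - p) (1ℚ - p) _ _ ⟩
  (1ℚ - p) ^ suc n * (1ℚ - p) ^ suc n ∎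
  where
  open ≡-Reasoning
  joint = 𝔼 p (suc n) (λ g → isolated g i * isolated g j)
  regroup : ∀ a b c d → (a * b) * (c * d) ≡ (b * d) * (a * c)
  regroup = solve-∀ ℚ-ring
  rotate : ∀ a b → a * (a * a * b) ≡ a * a * (a * b)
  rotate = solve-∀ ℚ-ring

-- For i ≠ j the joint mean is q² / (1 - p). The division is avoided by (1 + 2 p)(1 - p) = 1 + p (1
-- - 2 p) ≥ 1.
𝔼-isolated-pair≤ : ∀ {p} → Probability p → two * p ≤ 1ℚ → ∀ n (i j : Fin (suc n)) → let q = (1ℚ - p) ^ n in
  𝔼 p (suc n) (λ G → isolated G i * isolated G j) ≤ δ i j * q + (1ℚ + two * p) * (q * q)
𝔼-isolated-pair≤ {p} P@(0≤p , p≤1) 2p≤1 n i j with i Fin.≟ j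
... | yes refl = ≤-by ((1ℚ + two * p) * (q * q)) (0≤* (0≤+ 0≤1 (0≤* 0≤2 0≤p)) (0≤x² q))
  (cong (_+ (1ℚ + two * p) * (q * q)) (trans (*-identityˡ q) (sym (trans (𝔼-cong p (suc n) (λ G → isolated-idem G i)) (𝔼-isolated p n i)))))
  where q = (1ℚ - p) ^ n
... | no i≢j = ≤-by (p * (1ℚ - two * p) * joint) (0≤* (0≤* 0≤p (0≤y-x 2p≤1)) 0≤joint)
  (trans (cong (λ z → 0ℚ * q + (1ℚ + two * p) * z) (sym (𝔼-isolated₂ p n i j i≢j))) (identity p q joint))
  where
  q = (1ℚ - p) ^ n
  joint = 𝔼 p (suc n) (λ G → isolated G i * isolated G j)
  0≤joint : 0ℚ ≤ joint
  0≤joint = ≤-trans (≤-reflexive (sym (𝔼-const p (suc n) 0ℚ))) (𝔼-mono P (suc n) (λ G → 0≤* (0≤isolated G i) (0≤isolated G j)))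
  identity : ∀ p q joint → 0ℚ * q + (1ℚ + two * p) * ((1ℚ - p) * joint) ≡ joint + p * (1ℚ - two * p) * joint
  identity = solve-∀ ℚ-ring

isolatedCount : ∀ {n} → Graph n → ℚ
isolatedCount G = ∑[ i ] isolated G i

𝔼-isolatedVariance≤ : ∀ {p} → Probability p → two * p ≤ 1ℚ → ∀ n → let ν = ⟦ suc n ⟧ ; q = (1ℚ - p) ^ n in
  𝔼 p (suc n) (λ G → (isolatedCount G - ν * q) * (isolatedCount G - ν * q)) ≤ ν * q + two * p * ((ν * q) * (ν * q))
𝔼-isolatedVariance≤ {p} P 2p≤1 n = begin
  𝔼 p (suc n) (λ G → (isolatedCount G - μ) * (isolatedCount G - μ))
    ≡⟨ 𝔼-cong p (suc n) (λ G → expand (isolatedCount G) μ) ⟩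
  𝔼 p (suc n) (λ G → isolatedCount G * isolatedCount G + (- (two * μ) * isolatedCount G + μ * μ))
    ≡⟨ trans (𝔼-+ p (suc n) _ _) (cong (𝔼 p (suc n) (λ G → isolatedCount G * isolatedCount G) +_)
         (trans (𝔼-+ p (suc n) _ _) (cong₂ _+_ (trans (𝔼-*ˡ p (suc n) (- (two * μ)) isolatedCount) (cong (- (two * μ) *_) mean)) (𝔼-const p (suc n) (μ * μ))))) ⟩
  𝔼 p (suc n) (λ G → isolatedCount G * isolatedCount G) + (- (two * μ) * μ + μ * μ)
    ≤⟨ +-monoˡ-≤ (- (two * μ) * μ + μ * μ) second-moment ⟩
  ν * (q + ν * ((1ℚ + two * p) * (q * q))) + (- (two * μ) * μ + μ * μ) ≡⟨ collect p ν q ⟩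
  ν * q + two * p * ((ν * q) * (ν * q)) ∎
  where
  open ≤-Reasoning
  ν = ⟦ suc n ⟧
  q = (1ℚ - p) ^ n
  μ = ν * q
  expand : ∀ x m → (x - m) * (x - m) ≡ x * x + (- (two * m) * x + m * m)
  expand = solve-∀ ℚ-ring
  collect : ∀ p ν q → ν * (q + ν * ((1ℚ + two * p) * (q * q))) + (- (two * (ν * q)) * (ν * q) + (ν * q) * (ν * q)) ≡ ν * q + two * p * ((ν * q) * (ν * q))
  collect = solve-∀ ℚ-ring
  mean : 𝔼 p (suc n) isolatedCount ≡ μ
  mean = trans (𝔼-∑ p (suc n) _) (trans (∑-cong (𝔼-isolated p n)) (∑-const (suc n) q))
  second-moment : 𝔼 p (suc n) (λ G → isolatedCount G * isolatedCount G) ≤ ν * (q + ν * ((1ℚ + two * p) * (q * q)))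
  second-moment = ≤-trans (≤-reflexive (𝔼-∑² p (suc n) _))
    (∑-≤-const _ (λ i → ≤-trans (∑-mono (𝔼-isolated-pair≤ P 2p≤1 n i))
      (≤-reflexive (trans (∑-+ _ _) (cong₂ _+_ (trans (∑-*ʳ q (δ i)) (trans (cong (_* q) (∑-δ i)) (*-identityˡ q))) (∑-const (suc n) _))))))

bernoulli-lower : ∀ {x} → 0ℚ ≤ x → x ≤ 1ℚ → ∀ m → 1ℚ - ⟦ m ⟧ * x ≤ (1ℚ - x) ^ m
bernoulli-lower {x} 0≤x x≤1 zero    = ≤-reflexive (lemma x)
  where
  lemma : ∀ x → 1ℚ - 0ℚ * x ≡ 1ℚ
  lemma = solve-∀ ℚ-ring
bernoulli-lower {x} 0≤x x≤1 (suc m) = ≤-trans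
  (≤-by (⟦ m ⟧ * (x * x)) (0≤* 0≤⟦ m ⟧ (0≤x² x)) (lemma x ⟦ m ⟧)) (*-monoˡ (0≤y-x x≤1) (bernoulli-lower 0≤x x≤1 m))
  where
  lemma : ∀ x m → (1ℚ - x) * (1ℚ - m * x) ≡ 1ℚ - (1ℚ + m) * x + m * (x * x)
  lemma = solve-∀ ℚ-ring

-- (1 - p)ⁿ is split into 2 K blocks of length b = 1 + ⌊n / 2 K⌋, each at least 1 - b p ≥ ¼.
power-lower : ∀ {p} K n .{{_ : ℕ.NonZero K}} → 0ℚ ≤ p → p ≤ ½ * ½ → p * ⟦ n ⟧ ≤ ⟦ K ⟧ → (½ * ½) ^ (2 ℕ.* K) ≤ (1ℚ - p) ^ n
power-lower {p} K@(suc _) n 0≤p p≤¼ pn≤K = begin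
  (½ * ½) ^ (2 ℕ.* K) ≤⟨ ^-mono (0≤* 0≤½ 0≤½) (≤-trans ¼≤ (bernoulli-lower 0≤p p≤1 b)) (2 ℕ.* K) ⟩
  ((1ℚ - p) ^ b) ^ (2 ℕ.* K) ≡⟨ ^-assocʳ (1ℚ - p) b (2 ℕ.* K) ⟩
  (1ℚ - p) ^ (b ℕ.* (2 ℕ.* K)) ≤⟨ ^-antimono (0≤y-x p≤1) 1-p≤1 (m≤[1+m/n]*n n (2 ℕ.* K)) ⟩
  (1ℚ - p) ^ n ∎
  where
  open ≤-Reasoning
  c = n ℕ./ (2 ℕ.* K)
  b = suc c
  p≤1 : p ≤ 1ℚ
  p≤1 = ≤-trans p≤¼ (*≤* (ℤ.+≤+ (ℕ.s≤s ℕ.z≤n)))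
  1-p≤1 : 1ℚ - p ≤ 1ℚ
  1-p≤1 = ≤-by p 0≤p (cancel p)
    where
    cancel : ∀ x → 1ℚ ≡ 1ℚ - x + x
    cancel = solve-∀ ℚ-ring
  0<K : 0ℚ < ⟦ K ⟧
  0<K = <-≤-trans (positive⁻¹ ⟦ 1 ⟧) (⟦⟧-mono {1} {K} (ℕ.s≤s ℕ.z≤n))
  cp≤½ : ⟦ c ⟧ * p ≤ ½
  cp≤½ = *-cancelˡ-≤-pos ⟦ K ⟧ {{positive 0<K}} (begin
    ⟦ K ⟧ * (⟦ c ⟧ * p) ≡⟨ regroup ⟦ K ⟧ ⟦ c ⟧ p ⟩
    ½ * (p * (⟦ c ⟧ * (⟦ 2 ⟧ * ⟦ K ⟧))) ≡⟨ cong (λ z → ½ * (p * z)) (trans (⟦⟧-* c (2 ℕ.* K)) (cong (⟦ c ⟧ *_) (⟦⟧-* 2 K))) ⟨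
    ½ * (p * ⟦ c ℕ.* (2 ℕ.* K) ⟧) ≤⟨ *-monoˡ 0≤½ (≤-trans (*-monoˡ 0≤p (⟦⟧-mono (ℕ.m/n*n≤m n (2 ℕ.* K)))) pn≤K) ⟩
    ½ * ⟦ K ⟧ ≡⟨ *-comm ½ ⟦ K ⟧ ⟩
    ⟦ K ⟧ * ½ ∎)
    where
    regroup : ∀ K c p → K * (c * p) ≡ ½ * (p * (c * (⟦ 2 ⟧ * K)))
    regroup = solve-∀ ℚ-ring
  ¼≤ : ½ * ½ ≤ 1ℚ - ⟦ b ⟧ * p
  ¼≤ = ≤-by ((½ - ⟦ c ⟧ * p) + (½ * ½ - p)) (0≤+ (0≤y-x cp≤½) (0≤y-x p≤¼)) (identity ⟦ c ⟧ p)
    where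
    identity : ∀ c p → 1ℚ - (1ℚ + c) * p ≡ ½ * ½ + ((½ - c * p) + (½ * ½ - p))
    identity = solve-∀ ℚ-ring

-- Chebyshev with deviation μ. Without a Sullivan vertex every indegree is at least 1, so no vertex
-- is isolated and the deviation is exactly μ, which X < μ² excludes.
isolated-almost-surely : ∀ {p ε} n → Probability p → 0ℚ < ε → two * p ≤ 1ℚ → two * p ≤ ½ * ε →
  1ℚ ≤ ½ * ε * (⟦ suc n ⟧ * (1ℚ - p) ^ n) → AlmostSurelySullivan p (suc n) ε
isolated-almost-surely {p} {ε} n P 0<ε 2p≤1 2p≤½ε large = almost-surely {ε = ε} P X (λ G → 0≤x² (isolatedCount G - μ)) 0<t 𝔼X≤ good
  where
  q = (1ℚ - p) ^ n
  μ = ⟦ suc n ⟧ * q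
  0<μ : 0ℚ < μ
  0<μ = *-cancelˡ-<-nonNeg (½ * ε) {{nonNegative (0≤* 0≤½ (<⇒≤ 0<ε))}} (≤-<-trans (≤-reflexive (*-zeroʳ (½ * ε))) (<-≤-trans (positive⁻¹ 1ℚ) large))
  t = μ * μ
  0<t : 0ℚ < t
  0<t = 0<* 0<μ 0<μ
  X : Graph (suc n) → ℚ
  X G = (isolatedCount G - μ) * (isolatedCount G - μ)
  𝔼X≤ : 𝔼 p (suc n) X ≤ ε * t
  𝔼X≤ = ≤-trans (𝔼-isolatedVariance≤ P 2p≤1 n)
    (≤-by (μ * (½ * ε * μ - 1ℚ) + (½ * ε - two * p) * (μ * μ))
      (0≤+ (0≤* (<⇒≤ 0<μ) (0≤y-x large)) (0≤* (0≤y-x 2p≤½ε) (0≤x² μ))) (identity μ ε p))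
    where
    identity : ∀ m ε p → ε * (m * m) ≡ m + two * p * (m * m) + (m * (½ * ε * m - 1ℚ) + (½ * ε - two * p) * (m * m))
    identity = solve-∀ ℚ-ring
  good : ∀ G → X G < t → EveryOrientationHasSullivan G
  good G X<t = sullivan-by-contradiction G λ D oriented noSullivan →
    let open Orientation G D oriented noSullivan
        isolated≤0 : ∀ v → isolated G v ≤ 0ℚ
        isolated≤0 v = ≤-trans (≤-reflexive (sym (*-identityʳ (isolated G v))))
          (≤-trans (*-monoˡ (0≤isolated G v) (≤-trans (1≤indeg v) (∑-mono (λ w → ≤-by (arc v w) (0≤arc v w) (trans (sym (arc-sum v w)) (+-comm (arc v w) (arc w v)))))))
                   (≤-reflexive (trans (sym (∑-*ˡ (isolated G v) (edge G v))) (trans (∑-cong (isolated-edge G v)) (∑-0 (suc n))))))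
        count≡0 : isolatedCount G ≡ 0ℚ
        count≡0 = trans (∑-cong (λ v → ≤-antisym (isolated≤0 v) (0≤isolated G v))) (∑-0 (suc n))
    in <-irrefl (trans (cong (λ c → (c - μ) * (c - μ)) count≡0) (square μ)) X<t
    where
    square : ∀ m → (0ℚ - m) * (0ℚ - m) ≡ m * m
    square = solve-∀ ℚ-ring

isolated-regime : ∀ {ε} K .{{_ : ℕ.NonZero K}} → 0ℚ < ε →
  ∃[ N ] (∀ n → N ≤ℕ n → ∀ {p} → Probability p → p * ⟦ n ⟧ ≤ ⟦ K ⟧ → AlmostSurelySullivan p n ε)
isolated-regime {ε} K 0<ε = suc (N₁ ℕ.+ (N₂ ℕ.+ N₃)) , finish
  where
  0<½ε : 0ℚ < ½ * ε
  0<½ε = 0<* (positive⁻¹ ½) 0<ε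
  c = (½ * ½) ^ (2 ℕ.* K)
  0<c : 0ℚ < c
  0<c = 0<^ (positive⁻¹ (½ * ½)) (2 ℕ.* K)
  -- The three thresholds secure, in turn, 2 p ≤ ½ ε, p ≤ ¼, and an expected number of isolated
  -- vertices of at least 2 / ε.
  large₁ = archimedean-* (two * ⟦ K ⟧) 0<½ε
  large₂ = archimedean-* ⟦ K ⟧ (positive⁻¹ (½ * ½))
  large₃ = archimedean-* 1ℚ (0<* 0<½ε 0<c)
  N₁ = proj₁ large₁
  N₂ = proj₁ large₂
  N₃ = proj₁ large₃
  finish : ∀ n → suc (N₁ ℕ.+ (N₂ ℕ.+ N₃)) ≤ℕ n → ∀ {p} → Probability p → p * ⟦ n ⟧ ≤ ⟦ K ⟧ → AlmostSurelySullivan p n ε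
  finish (suc n) (ℕ.s≤s N≤n) {p} P@(0≤p , p≤1) pν≤K =
    isolated-almost-surely n P 0<ε (≤-trans (*-monoˡ 0≤2 p≤¼) (*≤* (ℤ.+≤+ (ℕ.s≤s ℕ.z≤n)))) 2p≤½ε enough
    where
    ν = ⟦ suc n ⟧
    0<ν : 0ℚ < ν
    0<ν = <-≤-trans (positive⁻¹ ⟦ 1 ⟧) (⟦⟧-mono {1} {suc n} (ℕ.s≤s ℕ.z≤n))
    N≤1+n = ℕ.≤-trans N≤n (ℕ.n≤1+n n)
    2p≤½ε : two * p ≤ ½ * ε
    2p≤½ε = *-cancelʳ-≤-pos ν {{positive 0<ν}} (≤-trans (≤-reflexive (*-assoc two p ν))
      (≤-trans (*-monoˡ 0≤2 pν≤K) (proj₂ large₁ (suc n) (ℕ.≤-trans (ℕ.m≤m+n N₁ _) N≤1+n))))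
    p≤¼ : p ≤ ½ * ½
    p≤¼ = *-cancelʳ-≤-pos ν {{positive 0<ν}} (≤-trans pν≤K (proj₂ large₂ (suc n) (ℕ.≤-trans (ℕ.≤-trans (ℕ.m≤m+n N₂ N₃) (ℕ.m≤n+m _ N₁)) N≤1+n)))
    pn≤K : p * ⟦ n ⟧ ≤ ⟦ K ⟧
    pn≤K = ≤-trans (*-monoˡ 0≤p (⟦⟧-mono (ℕ.n≤1+n n))) pν≤K
    enough : 1ℚ ≤ ½ * ε * (ν * (1ℚ - p) ^ n)
    enough = ≤-trans (proj₂ large₃ (suc n) (ℕ.≤-trans (ℕ.≤-trans (ℕ.m≤n+m N₃ N₂) (ℕ.m≤n+m _ N₁)) N≤1+n))
      (≤-trans (≤-reflexive (regroup (½ * ε) c ν)) (*-monoˡ (<⇒≤ 0<½ε) (*-monoˡ (<⇒≤ 0<ν) (power-lower K n 0≤p p≤¼ pn≤K))))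
      where
      regroup : ∀ e c ν → e * c * ν ≡ e * (ν * c)
      regroup = solve-∀ ℚ-ring

-- Combining the three regimes

theoremA2 : (p : ℕ → ℚ)
    → (∀ n → 0ℚ ≤ p n × p n ≤ 1ℚ)
    → (∃[ δ ] (0ℚ < δ × ∃[ N₀ ] (∀ n → N₀ ≤ℕ n → p n ≤ ½ - δ)))
    → ∀ (ε : ℚ) → 0ℚ < ε
    → ∃[ N ] (∀ n → N ≤ℕ n →
    ∃[ f ] ((∀ (G : Graph n) → f G ≡ true → EveryOrientationHasSullivan G)
    × (1ℚ - ε ≤ probOf (p n) n f)))
theoremA2 p P (η , 0<η , N₀ , p≤½-η) ε 0<ε = N₀ ℕ.+ (N₁ ℕ.+ (N₂ ℕ.+ N₃)) , cases
  where
  κ = ε * (ℤ.+ 1 / 18432)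
  0<κ : 0ℚ < κ
  0<κ = 0<* 0<ε (positive⁻¹ (ℤ.+ 1 / 18432))
  -- The cut-offs fit `sparse-moment≤`: p ≤ 4 κ² makes the term ν⁴ p⁴ at most 4 κ² ν⁴ p³, and 4 κ² K
  -- ≥ 1 with p ν ≥ K does the same for ν³ p².
  p₀ = ⟦ 4 ⟧ * (κ * κ)
  0<p₀ : 0ℚ < p₀
  0<p₀ = 0<* (positive⁻¹ ⟦ 4 ⟧) (0<* 0<κ 0<κ)
  K-large = archimedean-* 1ℚ 0<p₀
  K = 96 ℕ.+ proj₁ K-large
  isolatedCase = isolated-regime K 0<ε
  sparseCase = sparse-regime 0<κ K (ℕ.m≤m+n 96 _) (proj₂ K-large K (ℕ.m≤n+m _ 96))
  denseCase = dense-regime 0<η 0<p₀ 0<ε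
  N₁ = proj₁ isolatedCase
  N₂ = proj₁ sparseCase
  N₃ = proj₁ denseCase
  rescale : ∀ ε → ε * (ℤ.+ 1 / 18432) * (ℤ.+ 18432 / 1) ≡ ε
  rescale = solve-∀ ℚ-ring
  -- The regime is selected for each n separately, so `p` may move between the three ranges as n
  -- grows.
  cases : ∀ n → N₀ ℕ.+ (N₁ ℕ.+ (N₂ ℕ.+ N₃)) ≤ℕ n → AlmostSurelySullivan (p n) n ε
  cases n N≤n = choose (≤-total (p n * ⟦ n ⟧) ⟦ K ⟧) (≤-total (p n) p₀)
    where
    N₁₂₃≤n = ℕ.≤-trans (ℕ.m≤n+m (N₁ ℕ.+ (N₂ ℕ.+ N₃)) N₀) N≤n
    N₂₃≤n = ℕ.≤-trans (ℕ.m≤n+m (N₂ ℕ.+ N₃) N₁) N₁₂₃≤n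
    choose : (p n * ⟦ n ⟧ ≤ ⟦ K ⟧ ⊎ ⟦ K ⟧ ≤ p n * ⟦ n ⟧) → (p n ≤ p₀ ⊎ p₀ ≤ p n) → AlmostSurelySullivan (p n) n ε
    choose (inj₁ pν≤K) _           = proj₂ isolatedCase n (ℕ.≤-trans (ℕ.m≤m+n N₁ (N₂ ℕ.+ N₃)) N₁₂₃≤n) (P n) pν≤K
    choose (inj₂ K≤pν) (inj₁ p≤p₀) = subst (AlmostSurelySullivan (p n) n) (rescale ε)
      (proj₂ sparseCase n (ℕ.≤-trans (ℕ.m≤m+n N₂ N₃) N₂₃≤n) (P n) K≤pν p≤p₀)
    choose (inj₂ _)    (inj₂ p₀≤p) =
      proj₂ denseCase n (ℕ.≤-trans (ℕ.m≤n+m N₃ N₂) N₂₃≤n) (P n) p₀≤p (p≤½-η n (ℕ.≤-trans (ℕ.m≤m+n N₀ (N₁ ℕ.+ (N₂ ℕ.+ N₃))) N≤n))
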